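{- Let $\mathbf{d}$ be a Dyck path on an $n\times n$ board with bounce number $|\mathbf{m}|=3$, let $P=P(\mathbf{d})$, and let $G=\mathrm{inc}(P)$. Let $c=|S_1|$, $b=|S_2|$, $a=|S_3|$. Then for every integer $l$ with $0\le l\le\min\{a,b,c\}$, the coefficient of $e_{(n-2l,l,l)}$ in the expansion of $X_G(\mathbf{x},q)$ in the elementary symmetric function basis lies in $\mathbb{N}[q]$.
   Context: A Dyck path on an $n\times n$ board is a sequence $\mathbf{d}=(d_1,\dots,d_{n-1})$ of positive integers with $d_1\le\cdots\le d_{n-1}\le n$ and $d_i\ge i$. The poset $P(\mathbf{d})$ on $[n]$ has relations $i\prec j$ iff $i<n$ and $d_i<j\le n$ (a natural unit interval order). The bounce sequence $\mathbf{m}=(m_0,\dots,m_l)$ is given by $m_0=d_1$, $m_i=d_{m_{i-1}+1}$, stopping at $m_l=n$; the bounce number is $|\mathbf{m}|=l+1$. When $|\mathbf{m}|=3$, $\mathbf{m}=(m_0,m_1,n)$ and $S_1=\{1,\dots,m_0\}$, $S_2=\{m_0+1,\dots,m_1\}$, $S_3=\{m_1+1,\dots,n\}$. The incomparability graph $\mathrm{inc}(P)$ has vertex set $[n]$ with an edge between two elements iff they are incomparable in $P$. For a graph $G$ on vertex set $[n]$, the chromatic quasisymmetric function is $X_G(\mathbf{x},q)=\sum_{\kappa}q^{\mathrm{asc}(\kappa)}\prod_{v}x_{\kappa(v)}$, summed over proper colorings $\kappa:[n]\to\{1,2,3,\dots\}$, where $\mathrm{asc}(\kappa)$ is the number of edges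 $\{i,j\}$ with $i<j$ and $\kappa(i)<\kappa(j)$; for $G=\mathrm{inc}(P(\mathbf{d}))$ it is symmetric in $\mathbf{x}$, and $e_\lambda$ denotes the elementary symmetric functions. -}

module Defs where

open import Data.Nat using (ℕ; zero; suc; _+_; _∸_; _≤_; _<_; _<ᵇ_; _≡ᵇ_; _⊓_)
open import Data.Integer using (ℤ; +_) renaming (_+_ to _+ℤ_; _*_ to _*ℤ_)
open import Data.Fin using (Fin; toℕ)
open import Data.Vec using (Vec; []; _∷_; lookup; tabulate; zipWith; replicate)
open import Data.List using (List; []; _∷_; _++_; map; concatMap; filterᵇ; length; allFin; upTo)
open import Data.Bool using (Bool; true; false; if_then_else_; _∧_; not)
open import Data.Product using (_×_; _,_)

-- Dyck paths, encoded as d : ℕ → ℕ where only d 1, …, d (n-1) matter.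

IsDyckPath : ℕ → (ℕ → ℕ) → Set
IsDyckPath n d =
  (∀ i → 1 ≤ i → i < n → (i ≤ d i) × (d i ≤ n)) ×
  (∀ i → 1 ≤ i → suc i < n → d i ≤ d (suc i))

_≤ᵇ_ : ℕ → ℕ → Bool
m ≤ᵇ k = m <ᵇ suc k

-- d extended by the convention d_n = n (used only by the bounce path)
dext : ℕ → (ℕ → ℕ) → ℕ → ℕ
dext n d i = if i <ᵇ n then d i else n

-- bounce sequence m_0 = d_1, m_i = d_{m_{i-1}+1}, stopping at n
-- (fuel argument; fuel n is always sufficient for a Dyck path)
bounceFrom : ℕ → ℕ → (ℕ → ℕ) → ℕ → List ℕ
bounceFrom zero    n d cur = cur ∷ []
bounceFrom (suc f) n d cur =
  if cur ≡ᵇ n then cur ∷ [] else cur ∷ bounceFrom f n d (dext n d (suc cur))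

bounceSeq : ℕ → (ℕ → ℕ) → List ℕ
bounceSeq n d = bounceFrom n n d (dext n d 1)

bounceNumber : ℕ → (ℕ → ℕ) → ℕ
bounceNumber n d = length (bounceSeq n d)

-- when the bounce number is 3: m = (m₀, m₁, n)
m₀ : ℕ → (ℕ → ℕ) → ℕ
m₀ n d = dext n d 1

m₁ : ℕ → (ℕ → ℕ) → ℕ
m₁ n d = dext n d (suc (m₀ n d))

sizeS₁ sizeS₂ sizeS₃ : ℕ → (ℕ → ℕ) → ℕ
sizeS₁ n d = m₀ n d
sizeS₂ n d = m₁ n d ∸ m₀ n d
sizeS₃ n d = n ∸ m₁ n d

precᵇ : ℕ → (ℕ → ℕ) → ℕ → ℕ → Bool
precᵇ n d i j = (i <ᵇ n) ∧ ((d i <ᵇ j) ∧ (j ≤ᵇ n))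

incᵇ : ℕ → (ℕ → ℕ) → ℕ → ℕ → Bool
incᵇ n d i j = not (i ≡ᵇ j) ∧ (not (precᵇ n d i j) ∧ not (precᵇ n d j i))

-- vertex v : Fin n stands for the element suc (toℕ v) of [n]
elt : {n : ℕ} → Fin n → ℕ
elt v = suc (toℕ v)

edges : (n : ℕ) → (ℕ → ℕ) → List (Fin n × Fin n)
edges n d =
  filterᵇ (λ { (i , j) → (toℕ i <ᵇ toℕ j) ∧ incᵇ n d (elt i) (elt j) })
          (concatMap (λ i → map (λ j → (i , j)) (allFin n)) (allFin n))

allVecs : {A : Set} → List A → (k : ℕ) → List (Vec A k)
allVecs xs zero    = [] ∷ []
allVecs xs (suc k) = concatMap (λ x → map (x ∷_) (allVecs xs k)) xs

allBool : List Bool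
allBool = true ∷ false ∷ []

countᵇ : {A : Set} → (A → Bool) → List A → ℕ
countᵇ p xs = length (filterᵇ p xs)

vecEqᵇ : {k : ℕ} → Vec ℕ k → Vec ℕ k → Bool
vecEqᵇ []       []       = true
vecEqᵇ (x ∷ xs) (y ∷ ys) = (x ≡ᵇ y) ∧ vecEqᵇ xs ys

-- Polynomials in x₁,…,x_N with coefficients in ℤ[q], as finite lists of
-- terms  (coefficient , exponent of q , exponent vector of x)

Term : ℕ → Set
Term N = ℤ × ℕ × Vec ℕ N

sumℤ : List ℤ → ℤ
sumℤ []       = + 0
sumℤ (x ∷ xs) = x +ℤ sumℤ xs

coeffOf : {N : ℕ} → List (Term N) → Vec ℕ N → ℕ → ℤ
coeffOf ts α k =
  sumℤ (map (λ { (a , i , u) → a })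
            (filterᵇ (λ { (a , i , u) → (i ≡ᵇ k) ∧ vecEqᵇ u α }) ts))

mulTerms : {N : ℕ} → List (Term N) → List (Term N) → List (Term N)
mulTerms xs ys =
  concatMap (λ { (a , i , u) → map (λ { (b , j , v) → (a *ℤ b , i + j , zipWith _+_ u v) }) ys }) xs

oneTerms : {N : ℕ} → List (Term N)
oneTerms {N} = (+ 1 , 0 , replicate N 0) ∷ []

-- multiply by a polynomial in q given by its coefficient list (c₀, c₁, …)
scaleQ : {N : ℕ} → List ℤ → List (Term N) → List (Term N)
scaleQ cs ts = go 0 cs
  where
  go : ℕ → List ℤ → List _
  go k []       = []
  go k (c ∷ cs) = map (λ { (a , i , u) → (c *ℤ a , i + k , u) }) ts ++ go (suc k) cs

properᵇ : {n N : ℕ} → List (Fin n × Fin n) → Vec (Fin N) n → Bool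
properᵇ []             κ = true
properᵇ ((i , j) ∷ es) κ = not (toℕ (lookup κ i) ≡ᵇ toℕ (lookup κ j)) ∧ properᵇ es κ

asc : {n N : ℕ} → List (Fin n × Fin n) → Vec (Fin N) n → ℕ
asc es κ = countᵇ (λ { (i , j) → toℕ (lookup κ i) <ᵇ toℕ (lookup κ j) }) es

content : {n N : ℕ} → Vec (Fin N) n → Vec ℕ N
content {n} κ = tabulate (λ c → countᵇ (λ v → toℕ (lookup κ v) ≡ᵇ toℕ c) (allFin n))

chromQSF : (n : ℕ) → (ℕ → ℕ) → (N : ℕ) → List (Term N)
chromQSF n d N =
  map (λ κ → (+ 1 , asc (edges n d) κ , content κ))
      (filterᵇ (properᵇ (edges n d)) (allVecs (allFin N) n))

eTerms : (N m : ℕ) → List (Term N)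
eTerms N m =
  map (λ S → (+ 1 , 0 , Data.Vec.map (λ b → if b then 1 else 0) S))
      (filterᵇ (λ S → countᵇ (λ b → b) (Data.Vec.toList S) ≡ᵇ m) (allVecs allBool N))

eλ : (N : ℕ) → List ℕ → List (Term N)
eλ N []       = oneTerms
eλ N (m ∷ μ)  = mulTerms (eTerms N m) (eλ N μ)

-- partitions of n with all parts ≤ k, as weakly decreasing lists of positive
-- integers (fuel argument; fuel n suffices)
partitionsLE : ℕ → ℕ → ℕ → List (List ℕ)
partitionsLE f       zero    k = [] ∷ []
partitionsLE zero    (suc n) k = []
partitionsLE (suc f) (suc n) k =
  concatMap (λ p → map (p ∷_) (partitionsLE f (suc n ∸ p) p))
            (map suc (upTo (suc n ⊓ k)))

partitions : ℕ → List (List ℕ)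
partitions n = partitionsLE n n n

eExpansion : (n N : ℕ) → (List ℕ → List ℤ) → List (Term N)
eExpansion n N c = concatMap (λ μ → scaleQ (c μ) (eλ N μ)) (partitions n)

hookish : ℕ → ℕ → List ℕ
hookish n zero    = n ∷ []
hookish n (suc l) = (n ∸ (suc l + suc l)) ∷ suc l ∷ suc l ∷ []

{-# OPTIONS --safe #-}

-- Bounce number 3 means that chains of P have at most 3 elements, so X_G is a combination of the
-- e_u with at most 3 parts, and by duality the coefficient of e_u is obtained by applying to X_G
-- the functional that corresponds to the monomial symmetric polynomial m_u(x,y,z).  Now
--   m_(n-2l,l,l) = (xyz)^l p_(n-3l)(x,y,z).
-- The factor (xyz)^l removes l stable triples from G, and p_m extracts the coefficient of e_m for
-- the graph that is left, again a unit interval graph.  That coefficient is the q-count of acyclic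
-- orientations with one source: as the later neighbours of the first vertex x form a clique, a
-- stable set contains at most one of them, and deleting x gives a recursion without signs.
-- The expansion of X_G itself exists because X_G is symmetric (the vertices of two fixed colours
-- induce a union of monotone paths) and the system for the coefficients is unitriangular.
module Submission where

open import Defs
open import Data.Nat using (ℕ; zero; suc; _+_; _*_; _∸_; _≤_; _<_; _<ᵇ_; _≡ᵇ_; _⊓_; z≤n; s≤s)
import Data.Nat.Properties as ℕₚ
open import Data.Nat.Solver using (module +-*-Solver)
open import Data.Integer using (ℤ; +_; -[1+_]; +≤+)
  renaming (_+_ to _+ℤ_; _*_ to _*ℤ_; -_ to -ℤ_; _-_ to _-ℤ_; _≤_ to _≤ℤ_)
import Data.Integer.Properties as ℤₚ
open import Data.Integer.Tactic.RingSolver using (solve-∀)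
open import Data.Bool using (Bool; true; false; if_then_else_; _∧_; _∨_; not; T)
import Data.Bool.Properties as 𝔹ₚ
open import Data.Fin using (Fin; toℕ; zero; suc)
import Data.Fin.Properties as Finₚ
open import Data.List using (List; []; _∷_; _++_; map; concatMap; filterᵇ; length; replicate; allFin; upTo; tabulate; applyUpTo)
import Data.List.Properties as Listₚ
open import Data.List.Relation.Unary.All using (All; []; _∷_)
import Data.List.Relation.Unary.All as All
import Data.List.Relation.Unary.All.Properties as Allₚ
open import Data.List.Relation.Unary.Any using (Any; here; there)
open import Data.List.Relation.Unary.AllPairs using (AllPairs; []; _∷_)
import Data.List.Relation.Unary.AllPairs as AllPairs
import Data.List.Relation.Unary.AllPairs.Properties as AllPairsₚ
open import Data.List.Membership.Propositional using (_∈_; find; lose)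
import Data.List.Membership.Propositional.Properties as ∈ₚ
open import Data.Maybe using (Maybe; just; nothing; maybe)
open import Data.List.Relation.Ternary.Interleaving.Propositional using (Interleaving; []; consˡ; consʳ)
open import Data.List.Relation.Binary.Permutation.Propositional using (_↭_; ↭-sym; ↭-trans; prep)
  renaming (refl to ↭refl; swap to ↭swap; trans to ↭trans)
import Data.List.Relation.Binary.Permutation.Propositional.Properties as Permₚ
open import Data.Vec using (Vec; []; _∷_; toList; fromList; lookup)
import Data.Vec as Vec
import Data.Vec.Properties as Vecₚ
open import Data.Product using (Σ; _×_; _,_; proj₁; proj₂; ∃)
open import Data.Sum using (_⊎_; inj₁; inj₂)
open import Data.Empty using (⊥; ⊥-elim)
open import Function using (_∘_)
open import Relation.Nullary using (¬_; yes; no; does)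
open import Relation.Binary.PropositionalEquality using (_≡_; _≢_; refl; sym; trans; cong; cong₂; subst; module ≡-Reasoning)

-- Each functional is a signed sum of coefficients of monomials x^β. On e_a e_b e_c a part j of β
-- acts as e_j(x,y,z), so the sign (-1)^(j-1) for each part yields the series 1/(1 - e_1 + e_2 -
-- e_3) = 1/((1-x)(1-y)(1-z)): every product takes the value 1. Weighting by the first part yields 1
-- + (e_1 - 2e_2 + 3e_3)/((1-x)(1-y)(1-z)) = 1 + x/(1-x) + y/(1-y) + z/(1-z), which in degree m > 0
-- is p_m. This is the origin of the constants 1, -2, 3. On colourings the same sums become
-- inclusion-exclusion over stable sets of sources. Positivity comes from insertion: an acyclic
-- orientation of the later vertices orders the clique of later neighbours of x linearly, x enters
-- at one of deg x + 1 places, the power of q counts the neighbours placed after x, and x is a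
-- source only in front of all of them. The inclusion-exclusion sums obey the recursion that this
-- suggests term by term, so no set of orientations is ever formed.

Poly : Set
Poly = ℕ → ℤ

private variable
  A B D V : Set

-- Iverson brackets, linear functionals and finite sums

⟦_⟧_ : Bool → ℤ → ℤ
⟦ true ⟧ z = z
⟦ false ⟧ z = + 0
infixr 8 ⟦_⟧_

-- Sums over lists, splittings and assignments and extractions of coefficients are all instances, so
-- every exchange of two such operations follows from these three laws. `congr` is a field because
-- pointwise equal functions need not be propositionally equal.
record Linear (L : (D → ℤ) → ℤ) : Set where
  field
    congr : ∀ {f g} → (∀ d → f d ≡ g d) → L f ≡ L g
    add   : ∀ f g → L (λ d → f d +ℤ g d) ≡ L f +ℤ L g
    scale : ∀ c f → L (λ d → c *ℤ f d) ≡ c *ℤ L f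

  zer : L (λ _ → + 0) ≡ + 0
  zer = scale (+ 0) (λ _ → + 0)

  vanish : ∀ {f} → (∀ d → f d ≡ + 0) → L f ≡ + 0
  vanish f≡0 = trans (congr f≡0) zer

  neg : ∀ f → L (λ d → -ℤ f d) ≡ -ℤ L f
  neg f = begin
    L (λ d → -ℤ f d)              ≡⟨ congr (λ d → sym (ℤₚ.-1*i≡-i (f d))) ⟩
    L (λ d → -[1+ 0 ] *ℤ f d)     ≡⟨ scale -[1+ 0 ] f ⟩
    -[1+ 0 ] *ℤ L f               ≡⟨ ℤₚ.-1*i≡-i (L f) ⟩
    -ℤ L f                        ∎
    where open ≡-Reasoning

  sub : ∀ f g → L (λ d → f d -ℤ g d) ≡ L f -ℤ L g
  sub f g = trans (add f (λ d → -ℤ g d)) (cong (L f +ℤ_) (neg g))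

  iverson : ∀ b f → L (λ d → ⟦ b ⟧ f d) ≡ ⟦ b ⟧ L f
  iverson true  f = refl
  iverson false f = zer

open Linear

eval-linear : (d : D) → Linear (λ f → f d)
eval-linear d .congr h = h d
eval-linear d .add f g = refl
eval-linear d .scale c f = refl

zero-linear : Linear {D} (λ f → + 0)
zero-linear .congr h = refl
zero-linear .add f g = refl
zero-linear .scale c f = sym (ℤₚ.*-zeroʳ c)

+-linear : {L M : (D → ℤ) → ℤ} → Linear L → Linear M → Linear (λ f → L f +ℤ M f)
+-linear l m .congr h = cong₂ _+ℤ_ (congr l h) (congr m h)
+-linear {L = L} {M} l m .add f g = trans (cong₂ _+ℤ_ (add l f g) (add m f g)) (rearrange (L f) (L g) (M f) (M g))
  where
  rearrange : ∀ a b c d → (a +ℤ b) +ℤ (c +ℤ d) ≡ (a +ℤ c) +ℤ (b +ℤ d)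
  rearrange = solve-∀
+-linear {L = L} {M} l m .scale c f =
  trans (cong₂ _+ℤ_ (scale l c f) (scale m c f)) (sym (ℤₚ.*-distribˡ-+ c (L f) (M f)))

*-linear : {L : (D → ℤ) → ℤ} (a : ℤ) → Linear L → Linear (λ f → a *ℤ L f)
*-linear a l .congr h = cong (a *ℤ_) (congr l h)
*-linear {L = L} a l .add f g = trans (cong (a *ℤ_) (add l f g)) (ℤₚ.*-distribˡ-+ a (L f) (L g))
*-linear {L = L} a l .scale c f = trans (cong (a *ℤ_) (scale l c f)) (swap a c (L f))
  where
  swap : ∀ a c x → a *ℤ (c *ℤ x) ≡ c *ℤ (a *ℤ x)
  swap = solve-∀

pull-linear : {L : (D → ℤ) → ℤ} (s : D → A) → Linear L → Linear (λ (f : A → ℤ) → L (f ∘ s))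
pull-linear s l .congr h = congr l (h ∘ s)
pull-linear s l .add f g = add l (f ∘ s) (g ∘ s)
pull-linear s l .scale c f = scale l c (f ∘ s)

iverson-linear : {L : (D → ℤ) → ℤ} (b : Bool) → Linear L → Linear (λ f → ⟦ b ⟧ L f)
iverson-linear true  l = l
iverson-linear false l = zero-linear

bind-linear : {L : (D → ℤ) → ℤ} {M : D → (A → ℤ) → ℤ} →
  Linear L → (∀ d → Linear (M d)) → Linear (λ f → L (λ d → M d f))
bind-linear l m .congr h = congr l (λ d → congr (m d) h)
bind-linear {M = M} l m .add f g =
  trans (congr l (λ d → add (m d) f g)) (add l (λ d → M d f) (λ d → M d g))
bind-linear {M = M} l m .scale c f =
  trans (congr l (λ d → scale (m d) c f)) (scale l c (λ d → M d f))

⟦⟧-zero : ∀ b → ⟦ b ⟧ (+ 0) ≡ + 0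
⟦⟧-zero true  = refl
⟦⟧-zero false = refl

⟦⟧-∧ : ∀ b c z → ⟦ b ∧ c ⟧ z ≡ ⟦ b ⟧ ⟦ c ⟧ z
⟦⟧-∧ true  c z = refl
⟦⟧-∧ false c z = refl

⟦⟧-comm : ∀ b c z → ⟦ b ⟧ ⟦ c ⟧ z ≡ ⟦ c ⟧ ⟦ b ⟧ z
⟦⟧-comm true  c     z = refl
⟦⟧-comm false true  z = refl
⟦⟧-comm false false z = refl

∑ : List A → (A → ℤ) → ℤ
∑ xs f = sumℤ (map f xs)

∑-linear : (xs : List A) → Linear (∑ xs)
∑-linear []       = zero-linear
∑-linear (x ∷ xs) = +-linear (eval-linear x) (∑-linear xs)

∑-comm : {L : (D → ℤ) → ℤ} → Linear L → (xs : List A) (f : A → D → ℤ) →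
  L (λ d → ∑ xs (λ x → f x d)) ≡ ∑ xs (λ x → L (f x))
∑-comm l []       f = zer l
∑-comm {L = L} l (x ∷ xs) f =
  trans (add l (f x) (λ d → ∑ xs (λ y → f y d))) (cong (L (f x) +ℤ_) (∑-comm l xs f))

∑-++ : (xs ys : List A) (f : A → ℤ) → ∑ (xs ++ ys) f ≡ ∑ xs f +ℤ ∑ ys f
∑-++ []       ys f = sym (ℤₚ.+-identityˡ _)
∑-++ (x ∷ xs) ys f = trans (cong (f x +ℤ_) (∑-++ xs ys f)) (sym (ℤₚ.+-assoc (f x) _ _))

∑-map : (g : A → B) (xs : List A) (f : B → ℤ) → ∑ (map g xs) f ≡ ∑ xs (f ∘ g)
∑-map g []       f = refl
∑-map g (x ∷ xs) f = cong (f (g x) +ℤ_) (∑-map g xs f)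

∑-concatMap : (g : A → List B) (xs : List A) (f : B → ℤ) →
  ∑ (concatMap g xs) f ≡ ∑ xs (λ x → ∑ (g x) f)
∑-concatMap g []       f = refl
∑-concatMap g (x ∷ xs) f =
  trans (∑-++ (g x) (concatMap g xs) f) (cong (∑ (g x) f +ℤ_) (∑-concatMap g xs f))

∑-filter : (p : A → Bool) (xs : List A) (f : A → ℤ) → ∑ (filterᵇ p xs) f ≡ ∑ xs (λ x → ⟦ p x ⟧ f x)
∑-filter p []       f = refl
∑-filter p (x ∷ xs) f with p x
... | true  = cong (f x +ℤ_) (∑-filter p xs f)
... | false = trans (∑-filter p xs f) (sym (ℤₚ.+-identityˡ _))

-- Polynomials in q: powers, q-integers, nonnegativity

shift : ℕ → Poly → Poly
shift zero    f k       = f k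
shift (suc w) f zero    = + 0
shift (suc w) f (suc k) = shift w f k

shift-linear : ∀ w k → Linear (λ f → shift w f k)
shift-linear zero    k       = eval-linear k
shift-linear (suc w) zero    = zero-linear
shift-linear (suc w) (suc k) = shift-linear w k

shift-+ : ∀ v w f k → shift (v + w) f k ≡ shift v (shift w f) k
shift-+ zero    w f k       = refl
shift-+ (suc v) w f zero    = refl
shift-+ (suc v) w f (suc k) = shift-+ v w f k

shift-comm : ∀ {L : (D → ℤ) → ℤ} → Linear L → ∀ w (f : D → Poly) k →
  L (λ d → shift w (f d) k) ≡ shift w (λ j → L (λ d → f d j)) k
shift-comm l zero    f k       = refl
shift-comm l (suc w) f zero    = zer l
shift-comm l (suc w) f (suc k) = shift-comm l w f k

shift-shift : ∀ v w f k → shift v (shift w f) k ≡ shift w (shift v f) k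
shift-shift v w f k = begin
  shift v (shift w f) k  ≡⟨ sym (shift-+ v w f k) ⟩
  shift (v + w) f k      ≡⟨ cong (λ u → shift u f k) (ℕₚ.+-comm v w) ⟩
  shift (w + v) f k      ≡⟨ shift-+ w v f k ⟩
  shift w (shift v f) k  ∎
  where open ≡-Reasoning

-- [ a ]_q · f
bracket : ℕ → Poly → Poly
bracket zero    f k = + 0
bracket (suc a) f k = bracket a f k +ℤ shift a f k

bracket-linear : ∀ a k → Linear (λ f → bracket a f k)
bracket-linear zero    k = zero-linear
bracket-linear (suc a) k = +-linear (bracket-linear a k) (shift-linear a k)

bracket-comm : ∀ {L : (D → ℤ) → ℤ} → Linear L → ∀ a (f : D → Poly) k →
  L (λ d → bracket a (f d) k) ≡ bracket a (λ j → L (λ d → f d j)) k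
bracket-comm l zero    f k = zer l
bracket-comm l (suc a) f k =
  trans (add l _ _) (cong₂ _+ℤ_ (bracket-comm l a f k) (shift-comm l a f k))

NonNeg : Poly → Set
NonNeg f = ∀ k → + 0 ≤ℤ f k

shift-nonneg : ∀ w {f} → NonNeg f → NonNeg (shift w f)
shift-nonneg zero    h k       = h k
shift-nonneg (suc w) h zero    = +≤+ z≤n
shift-nonneg (suc w) h (suc k) = shift-nonneg w h k

bracket-nonneg : ∀ a {f} → NonNeg f → NonNeg (bracket a f)
bracket-nonneg zero    h k = +≤+ z≤n
bracket-nonneg (suc a) h k = ℤₚ.+-mono-≤ (bracket-nonneg a h k) (shift-nonneg a h k)

⟦⟧-nonneg : ∀ b {z} → + 0 ≤ℤ z → + 0 ≤ℤ ⟦ b ⟧ z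
⟦⟧-nonneg true  h = h
⟦⟧-nonneg false h = +≤+ z≤n

-- Splittings of a list of vertices

splitSum : List V → (List V → List V → ℤ) → ℤ
splitSum []      f = f [] []
splitSum (x ∷ S) f = splitSum S (λ A R → f (x ∷ A) R) +ℤ splitSum S (λ A R → f A (x ∷ R))

splitSum-cong : (S : List V) {f g : List V → List V → ℤ} →
  (∀ {A R} → Interleaving A R S → f A R ≡ g A R) → splitSum S f ≡ splitSum S g
splitSum-cong []      h = h []
splitSum-cong (x ∷ S) h =
  cong₂ _+ℤ_ (splitSum-cong S (λ i → h (consˡ i))) (splitSum-cong S (λ i → h (consʳ i)))

splitSum-vanish : (S : List V) {f : List V → List V → ℤ} →
  (∀ {A R} → Interleaving A R S → f A R ≡ + 0) → splitSum S f ≡ + 0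
splitSum-vanish []      h = h []
splitSum-vanish (x ∷ S) h =
  cong₂ _+ℤ_ (splitSum-vanish S (λ i → h (consˡ i))) (splitSum-vanish S (λ i → h (consʳ i)))

splitSum-comm : {L : (D → ℤ) → ℤ} → Linear L → (S : List V) (f : List V → List V → D → ℤ) →
  L (λ d → splitSum S (λ A R → f A R d)) ≡ splitSum S (λ A R → L (f A R))
splitSum-comm l []      f = refl
splitSum-comm l (x ∷ S) f = trans (add l _ _)
  (cong₂ _+ℤ_ (splitSum-comm l S (λ A R → f (x ∷ A) R)) (splitSum-comm l S (λ A R → f A (x ∷ R))))

splitSum-linear : (S : List V) (f : List V → List V → D) →
  Linear (λ g → splitSum S (λ A R → g (f A R)))
splitSum-linear []      f = eval-linear (f [] [])
splitSum-linear (x ∷ S) f =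
  +-linear (splitSum-linear S (λ A R → f (x ∷ A) R)) (splitSum-linear S (λ A R → f A (x ∷ R)))

splitSum-+ : (S : List V) (f g : List V → List V → ℤ) →
  splitSum S (λ A R → f A R +ℤ g A R) ≡ splitSum S f +ℤ splitSum S g
splitSum-+ S f g = add (splitSum-linear S _,_) (λ (A , R) → f A R) (λ (A , R) → g A R)

splitSum-nonneg : (S : List V) {f : List V → List V → ℤ} →
  (∀ {A R} → Interleaving A R S → + 0 ≤ℤ f A R) → + 0 ≤ℤ splitSum S f
splitSum-nonneg []      h = h []
splitSum-nonneg (x ∷ S) h =
  ℤₚ.+-mono-≤ (splitSum-nonneg S (λ i → h (consˡ i))) (splitSum-nonneg S (λ i → h (consʳ i)))

splitSum-null : (S : List V) (f : List V → List V → ℤ) →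
  splitSum S (λ A R → ⟦ length A ≡ᵇ 0 ⟧ f A R) ≡ f [] S
splitSum-null []      f = refl
splitSum-null (x ∷ S) f = begin
  splitSum S (λ A R → + 0) +ℤ splitSum S (λ A R → ⟦ length A ≡ᵇ 0 ⟧ f A (x ∷ R))
    ≡⟨ cong₂ _+ℤ_ (splitSum-vanish S (λ _ → refl)) (splitSum-null S (λ A R → f A (x ∷ R))) ⟩
  + 0 +ℤ f [] (x ∷ S)
    ≡⟨ ℤₚ.+-identityˡ _ ⟩
  f [] (x ∷ S) ∎
  where open ≡-Reasoning

-- Both sides run over the ways to distribute `S` into three blocks. This is what allows two
-- consecutive colour classes to be treated as one set.
splitSum-assoc : (S : List V) (f : List V → List V → List V → ℤ) →
  splitSum S (λ A R → splitSum R (λ B Q → f A B Q)) ≡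
  splitSum S (λ W Q → splitSum W (λ A B → f A B Q))
splitSum-assoc []      f = refl
splitSum-assoc (x ∷ S) f = begin
  splitSum S (λ A R → splitSum R (λ B Q → f (x ∷ A) B Q)) +ℤ
  splitSum S (λ A R → splitSum R (λ B Q → f A (x ∷ B) Q) +ℤ splitSum R (λ B Q → f A B (x ∷ Q)))
    ≡⟨ cong (splitSum S (λ A R → splitSum R (λ B Q → f (x ∷ A) B Q)) +ℤ_)
        (splitSum-+ S (λ A R → splitSum R (λ B Q → f A (x ∷ B) Q)) (λ A R → splitSum R (λ B Q → f A B (x ∷ Q)))) ⟩
  splitSum S (λ A R → splitSum R (λ B Q → f (x ∷ A) B Q)) +ℤ
  (splitSum S (λ A R → splitSum R (λ B Q → f A (x ∷ B) Q)) +ℤ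
   splitSum S (λ A R → splitSum R (λ B Q → f A B (x ∷ Q))))
    ≡⟨ cong₂ _+ℤ_ (splitSum-assoc S (λ A → f (x ∷ A)))
        (cong₂ _+ℤ_ (splitSum-assoc S (λ A B → f A (x ∷ B)))
                    (splitSum-assoc S (λ A B Q → f A B (x ∷ Q)))) ⟩
  splitSum S (λ W Q → splitSum W (λ A B → f (x ∷ A) B Q)) +ℤ
  (splitSum S (λ W Q → splitSum W (λ A B → f A (x ∷ B) Q)) +ℤ
   splitSum S (λ W Q → splitSum W (λ A B → f A B (x ∷ Q))))
    ≡⟨ sym (ℤₚ.+-assoc (splitSum S (λ W Q → splitSum W (λ A B → f (x ∷ A) B Q))) _ _) ⟩
  _ ≡⟨ cong (_+ℤ splitSum S (λ W Q → splitSum W (λ A B → f A B (x ∷ Q)))) 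
        (sym (splitSum-+ S (λ W Q → splitSum W (λ A B → f (x ∷ A) B Q)) (λ W Q → splitSum W (λ A B → f A (x ∷ B) Q)))) ⟩
  _ ∎
  where open ≡-Reasoning

-- Counting along a list and its splittings

sumBy : (A → ℕ) → List A → ℕ
sumBy f []       = 0
sumBy f (x ∷ xs) = f x + sumBy f xs

sumBy-cong : {f g : A → ℕ} → (∀ x → f x ≡ g x) → ∀ xs → sumBy f xs ≡ sumBy g xs
sumBy-cong h []       = refl
sumBy-cong h (x ∷ xs) = cong₂ _+_ (h x) (sumBy-cong h xs)

+-interchange : ∀ a b c d → (a + b) + (c + d) ≡ (a + c) + (b + d)
+-interchange = solve 4 (λ a b c d → (a :+ b) :+ (c :+ d) := (a :+ c) :+ (b :+ d)) refl
  where open +-*-Solver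

sumBy-+ : (f g : A → ℕ) → ∀ xs → sumBy (λ x → f x + g x) xs ≡ sumBy f xs + sumBy g xs
sumBy-+ f g []       = refl
sumBy-+ f g (x ∷ xs) =
  trans (cong (_+_ (f x + g x)) (sumBy-+ f g xs)) (+-interchange (f x) (g x) (sumBy f xs) (sumBy g xs))

sumBy-zero : (xs : List A) → sumBy (λ _ → 0) xs ≡ 0
sumBy-zero []       = refl
sumBy-zero (x ∷ xs) = sumBy-zero xs

sumBy-split : (f : V → ℕ) {A R S : List V} → Interleaving A R S → sumBy f S ≡ sumBy f A + sumBy f R
sumBy-split f []        = refl
sumBy-split f {x ∷ A} {R} (consˡ i) =
  trans (cong (_+_ (f x)) (sumBy-split f i)) (sym (ℕₚ.+-assoc (f x) (sumBy f A) (sumBy f R)))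
sumBy-split f {A} {x ∷ R} (consʳ i) =
  trans (cong (_+_ (f x)) (sumBy-split f i)) (left-comm (f x) (sumBy f A) (sumBy f R))
  where
  open +-*-Solver
  left-comm : ∀ a b c → a + (b + c) ≡ b + (a + c)
  left-comm = solve 3 (λ a b c → a :+ (b :+ c) := b :+ (a :+ c)) refl

length-split : {A R S : List V} → Interleaving A R S → length S ≡ length A + length R
length-split []        = refl
length-split (consˡ i) = cong suc (length-split i)
length-split {A = A} {x ∷ R} (consʳ i) = trans (cong suc (length-split i)) (sym (ℕₚ.+-suc (length A) (length R)))

All-split : {P : V → Set} {A R S : List V} → Interleaving A R S → All P S → All P A × All P R
All-split []        []       = [] , []
All-split (consˡ i) (p ∷ ps) with All-split i ps
... | a , r = p ∷ a , r
All-split (consʳ i) (p ∷ ps) with All-split i ps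
... | a , r = a , p ∷ r

AllPairs-split : {_≺_ : V → V → Set} {A R S : List V} → Interleaving A R S →
  AllPairs _≺_ S → AllPairs _≺_ A × AllPairs _≺_ R
AllPairs-split []        []       = [] , []
AllPairs-split (consˡ i) (p ∷ ps) with All-split i p | AllPairs-split i ps
... | pa , pr | a , r = pa ∷ a , r
AllPairs-split (consʳ i) (p ∷ ps) with All-split i p | AllPairs-split i ps
... | pa , pr | a , r = a , pr ∷ r

bit : Bool → ℕ
bit true  = 1
bit false = 0

# : (A → Bool) → List A → ℕ
# p = sumBy (λ x → bit (p x))

#-none : {p : A → Bool} {xs : List A} → All (λ x → p x ≡ false) xs → # p xs ≡ 0
#-none []       = refl
#-none (h ∷ hs) rewrite h = #-none hs

δ₀ : Poly
δ₀ k = ⟦ k ≡ᵇ 0 ⟧ (+ 1)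

-- For e = {(u , v) : u < v adjacent}, the sum over proper colourings of S having β_c vertices
-- of colour c, the smallest colour class A being split off first.
module Digraph {V : Set} (e : V → V → Bool) where

  deg : V → List V → ℕ
  deg x = # (e x)

  cross : List V → List V → ℕ
  cross A R = sumBy (λ a → deg a R) A

  colourings : List V → List ℕ → Poly
  colourings S []      k = ⟦ length S ≡ᵇ 0 ⟧ δ₀ k
  colourings S (b ∷ β) k = splitSum S (λ A R →
    ⟦ cross A A ≡ᵇ 0 ⟧ ⟦ length A ≡ᵇ b ⟧ shift (cross A R) (colourings R β) k)

  cross-splitʳ : (A : List V) {B Q R : List V} → Interleaving B Q R →
    cross A R ≡ cross A B + cross A Q
  cross-splitʳ A {B} {Q} i = trans (sumBy-cong (λ a → sumBy-split _ i) A)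
    (sumBy-+ (λ a → deg a B) (λ a → deg a Q) A)

  cross-splitˡ : (Q : List V) {A B W : List V} → Interleaving A B W →
    cross W Q ≡ cross A Q + cross B Q
  cross-splitˡ Q = sumBy-split _

  cross-∷ʳ : (A : List V) (x : V) (R : List V) → cross A (x ∷ R) ≡ # (λ a → e a x) A + cross A R
  cross-∷ʳ A x R = sumBy-+ (λ a → bit (e a x)) (λ a → deg a R) A

  colourings-zero : ∀ S β k → colourings S (0 ∷ β) k ≡ colourings S β k
  colourings-zero S β k = begin
    splitSum S (λ A R → ⟦ cross A A ≡ᵇ 0 ⟧ ⟦ length A ≡ᵇ 0 ⟧ shift (cross A R) (colourings R β) k)
      ≡⟨ splitSum-cong S (λ {A} _ → ⟦⟧-comm (cross A A ≡ᵇ 0) (length A ≡ᵇ 0) _) ⟩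
    splitSum S (λ A R → ⟦ length A ≡ᵇ 0 ⟧ ⟦ cross A A ≡ᵇ 0 ⟧ shift (cross A R) (colourings R β) k)
      ≡⟨ splitSum-null S (λ A R → ⟦ cross A A ≡ᵇ 0 ⟧ shift (cross A R) (colourings R β) k) ⟩
    colourings S β k ∎
    where open ≡-Reasoning

  colourings-nonneg : ∀ β S → NonNeg (colourings S β)
  colourings-nonneg []      S k = ⟦⟧-nonneg (length S ≡ᵇ 0) (⟦⟧-nonneg (k ≡ᵇ 0) (+≤+ z≤n))
  colourings-nonneg (b ∷ β) S k = splitSum-nonneg S (λ {A} {R} _ →
    ⟦⟧-nonneg (cross A A ≡ᵇ 0) (⟦⟧-nonneg (length A ≡ᵇ b)
      (shift-nonneg (cross A R) (colourings-nonneg β R) k)))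

  -- The functional acts on the tail `g d` only, hence on the graph that remains after a first class
  -- of size `b` is removed.
  colourings-comm : {L : (D → ℤ) → ℤ} → Linear L → (g : D → List ℕ) → ∀ S b k →
    L (λ d → colourings S (b ∷ g d) k) ≡ splitSum S (λ A R →
      ⟦ cross A A ≡ᵇ 0 ⟧ ⟦ length A ≡ᵇ b ⟧ shift (cross A R) (λ j → L (λ d → colourings R (g d) j)) k)
  colourings-comm {D = D} {L = L} l g S b k = trans (splitSum-comm l S (λ A R d →
      ⟦ cross A A ≡ᵇ 0 ⟧ ⟦ length A ≡ᵇ b ⟧ term A R d))
    (splitSum-cong S (λ {A} {R} _ →
      trans (iverson l (cross A A ≡ᵇ 0) (λ d → ⟦ length A ≡ᵇ b ⟧ term A R d))
        (cong (⟦ cross A A ≡ᵇ 0 ⟧_) (trans (iverson l (length A ≡ᵇ b) (term A R))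
          (cong (⟦ length A ≡ᵇ b ⟧_) (shift-comm l (cross A R) (λ d → colourings R (g d)) k))))))
    where
    term : List V → List V → D → ℤ
    term A R d = shift (cross A R) (colourings R (g d)) k

-- The coefficient of e_m for a unit interval graph

sgn : ℕ → ℤ
sgn zero    = + 1
sgn (suc n) = -ℤ sgn n

shift-bracket : ∀ c a f k → shift c (bracket a f) k ≡ bracket a (shift c f) k
shift-bracket c zero    f k = zer (shift-linear c k)
shift-bracket c (suc a) f k = trans (add (shift-linear c k) (bracket a f) (shift a f))
  (cong₂ _+ℤ_ (shift-bracket c a f k) (shift-shift c a f k))

iverson-cong : ∀ b {x y} → (b ≡ true → x ≡ y) → ⟦ b ⟧ x ≡ ⟦ b ⟧ y
iverson-cong true  h = h refl
iverson-cong false h = refl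

≡ᵇ-sound : ∀ m n → (m ≡ᵇ n) ≡ true → m ≡ n
≡ᵇ-sound m n h = ℕₚ.≡ᵇ⇒≡ m n (subst T (sym h) _)

≡ᵇ-refl : ∀ n → (n ≡ᵇ n) ≡ true
≡ᵇ-refl zero    = refl
≡ᵇ-refl (suc n) = ≡ᵇ-refl n

≡ᵇ-≢ : ∀ m n → m ≢ n → (m ≡ᵇ n) ≡ false
≡ᵇ-≢ m n h with m ≡ᵇ n in eq
... | true  = ⊥-elim (h (≡ᵇ-sound m n eq))
... | false = refl

bit≡0 : ∀ b → bit b ≡ 0 → b ≡ false
bit≡0 false h = refl

-- Sum of (-1)^(|β| - length β) f β over the compositions β with at most m parts, all ≤ 3.
altSum : ℕ → (List ℕ → ℤ) → ℤ
altSum zero    f = f []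
altSum (suc m) f =
  f [] +ℤ ((altSum m (f ∘ (1 ∷_)) -ℤ altSum m (f ∘ (2 ∷_))) +ℤ altSum m (f ∘ (3 ∷_)))

-- The same sum weighted by the first part; on homogeneous symmetric functions of degree m
-- whose monomials have exponents ≤ 3, it is the coefficient of e_m.
headSum : ℕ → (List ℕ → ℤ) → ℤ
headSum m f =
  f [] +ℤ ((altSum m (f ∘ (1 ∷_)) +ℤ -[1+ 1 ] *ℤ altSum m (f ∘ (2 ∷_))) +ℤ + 3 *ℤ altSum m (f ∘ (3 ∷_)))

neg-linear : {L : (D → ℤ) → ℤ} → Linear L → Linear (λ f → -ℤ L f)
neg-linear {L = L} l .congr h = cong -ℤ_ (congr l h)
neg-linear {L = L} l .add f g = trans (cong -ℤ_ (add l f g)) (ℤₚ.neg-distrib-+ (L f) (L g))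
neg-linear {L = L} l .scale c f = trans (cong -ℤ_ (scale l c f)) (ℤₚ.neg-distribʳ-* c (L f))

altSum-linear : ∀ m → Linear (altSum m)
altSum-linear zero    = eval-linear []
altSum-linear (suc m) = +-linear (eval-linear [])
  (+-linear (+-linear (part 1) (neg-linear (part 2))) (part 3))
  where
  part : ∀ b → Linear (λ f → altSum m (f ∘ (b ∷_)))
  part b = pull-linear (b ∷_) (altSum-linear m)

headSum-linear : ∀ m → Linear (headSum m)
headSum-linear m = +-linear (eval-linear [])
  (+-linear (+-linear (part 1) (*-linear -[1+ 1 ] (part 2))) (*-linear (+ 3) (part 3)))
  where
  part : ∀ b → Linear (λ f → altSum m (f ∘ (b ∷_)))
  part b = pull-linear (b ∷_) (altSum-linear m)

-- The hypotheses concern individual vertices, so they hold for every sublist of a sorted list and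
-- induced subgraphs need no transport. `interval` makes the later neighbours of a vertex a clique;
-- `height` bounds stable sets by three.
module UnitInterval {V : Set} (_≺_ : V → V → Set) (e : V → V → Bool)
  (backward : ∀ {x y} → x ≺ y → e y x ≡ false)
  (loopless : ∀ x → e x x ≡ false)
  (interval : ∀ {x y z} → x ≺ y → y ≺ z → e x z ≡ true → (e x y ≡ true) × (e y z ≡ true))
  (height   : ∀ {x y z w} → x ≺ y → y ≺ z → z ≺ w →
              e x y ≡ false → e y z ≡ false → e z w ≡ false → ⊥)
  where

  open Digraph e public

  Sorted : List V → Set
  Sorted = AllPairs _≺_

  cross-smallest : ∀ {x} {A : List V} → All (x ≺_) A → ∀ R → cross A (x ∷ R) ≡ cross A R
  cross-smallest {x} {A} x≺A R =
    trans (cross-∷ʳ A x R) (cong (_+ cross A R) (#-none (All.map backward x≺A)))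

  cross-∷ : ∀ {x} {A : List V} → All (x ≺_) A → cross (x ∷ A) (x ∷ A) ≡ deg x A + cross A A
  cross-∷ {x} {A} x≺A rewrite loopless x = cong (_+_ (deg x A)) (cross-smallest x≺A A)

  -- For the first neighbour `y` of `x` in `A` and a further one `z`, `interval` would make `y` and
  -- `z` adjacent. The recursions without signs rest on this dichotomy.
  stable-deg : ∀ {x} {A : List V} → All (x ≺_) A → Sorted A → cross A A ≡ 0 →
    (deg x A ≡ 0) ⊎ (deg x A ≡ 1)
  stable-deg []            []             st = inj₁ refl
  stable-deg {x} {y ∷ A} (x≺y ∷ x≺A) (y≺A ∷ sA) st with e x y in exy
  ... | false = stable-deg x≺A sA (ℕₚ.m+n≡0⇒n≡0 (deg y A) (trans (sym (cross-∷ y≺A)) st))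
  ... | true  = inj₂ (cong suc (#-none (go y≺A degy)))
    where
    degy : deg y A ≡ 0
    degy = ℕₚ.m+n≡0⇒m≡0 (deg y A) (trans (sym (cross-∷ y≺A)) st)
    go : ∀ {B} → All (y ≺_) B → deg y B ≡ 0 → All (λ z → e x z ≡ false) B
    go []          h = []
    go {z ∷ B} (y≺z ∷ y≺B) h with e x z in exz
    ... | false = exz ∷ go y≺B (ℕₚ.m+n≡0⇒n≡0 (bit (e y z)) h)
    ... | true with bit≡0 (e y z) (ℕₚ.m+n≡0⇒m≡0 (bit (e y z)) h) | proj₂ (interval x≺y y≺z exz)
    ...   | eyz | eyz′ with trans (sym eyz) eyz′
    ...     | ()

  stable-length : ∀ {A : List V} → Sorted A → cross A A ≡ 0 → length A ≤ 3
  stable-length {[]} sA st = z≤n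
  stable-length {_ ∷ []} sA st = s≤s z≤n
  stable-length {_ ∷ _ ∷ []} sA st = s≤s (s≤s z≤n)
  stable-length {_ ∷ _ ∷ _ ∷ []} sA st = s≤s (s≤s (s≤s z≤n))
  stable-length {x ∷ y ∷ z ∷ w ∷ A} (x≺ ∷ y≺ ∷ z≺ ∷ _) st =
    ⊥-elim (height (All.head x≺) (All.head y≺) (All.head z≺)
      (nonadjacent x y (z ∷ w ∷ A) (proj₁ st₁)) (nonadjacent y z (w ∷ A) (proj₁ st₂))
      (nonadjacent z w A (proj₁ st₃)))
    where
    nonadjacent : ∀ u v B → deg u (v ∷ B) ≡ 0 → e u v ≡ false
    nonadjacent u v B h = bit≡0 (e u v) (ℕₚ.m+n≡0⇒m≡0 (bit (e u v)) h)
    unfold : ∀ {u B} → All (u ≺_) B → cross (u ∷ B) (u ∷ B) ≡ 0 → (deg u B ≡ 0) × (cross B B ≡ 0)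
    unfold {u} {B} u≺B h with trans (sym (cross-∷ u≺B)) h
    ... | h′ = ℕₚ.m+n≡0⇒m≡0 (deg u B) h′ , ℕₚ.m+n≡0⇒n≡0 (deg u B) h′
    st₁ = unfold x≺ st
    st₂ = unfold y≺ (proj₂ st₁)
    st₃ = unfold z≺ (proj₂ st₂)

  -- q-count of the acyclic orientations of S
  orientations : List V → Poly
  orientations []      = δ₀
  orientations (x ∷ S) = bracket (suc (deg x S)) (orientations S)

  -- Inclusion-exclusion over a set `A` of sources outside `p`: all edges between `A` and `R` leave
  -- `A`, which gives the factor q^(cross A R), and `R` is oriented freely. Here q marks the edges
  -- directed from the smaller to the larger vertex.
  avoidTerm : (V → Bool) → List V → List V → Poly
  avoidTerm p A R k = ⟦ cross A A ≡ᵇ 0 ⟧ ⟦ # p A ≡ᵇ 0 ⟧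
    (sgn (length A) *ℤ shift (cross A R) (orientations R) k)

  -- q-count of the acyclic orientations of S with all sources in p
  sourcesIn : (V → Bool) → List V → Poly
  sourcesIn p S k = splitSum S (λ A R → avoidTerm p A R k)

  -- The sum of (-1)^(|A|-1) |A| over the subsets A of a finite set T is 1 if T has one element and
  -- 0 otherwise; here T is the set of sources of an orientation.
  rootTerm : List V → List V → Poly
  rootTerm A R k = ⟦ cross A A ≡ᵇ 0 ⟧
    (+ length A *ℤ -ℤ (sgn (length A) *ℤ shift (cross A R) (orientations R) k))

  -- q-count of the acyclic orientations of S with exactly one source
  rooted : List V → Poly
  rooted S k = splitSum S (λ A R → rootTerm A R k)

  private
    signed : ℕ → ℕ → Poly → Poly
    signed n c f j = sgn n *ℤ shift c f j

    signed-bracket : ∀ n c a f k →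
      sgn n *ℤ shift c (bracket a f) k ≡ bracket a (signed n c f) k
    signed-bracket n c a f k = trans (cong (sgn n *ℤ_) (shift-bracket c a f k))
      (sym (scale (bracket-linear a k) (sgn n) (shift c f)))

    signed-suc : ∀ n r c f k →
      sgn (suc n) *ℤ shift (r + c) f k ≡ -ℤ shift r (signed n c f) k
    signed-suc n r c f k = begin
      -ℤ sgn n *ℤ shift (r + c) f k        ≡⟨ sym (ℤₚ.neg-distribˡ-* (sgn n) (shift (r + c) f k)) ⟩
      -ℤ (sgn n *ℤ shift (r + c) f k)      ≡⟨ cong (λ z → -ℤ (sgn n *ℤ z)) (shift-+ r c f k) ⟩
      -ℤ (sgn n *ℤ shift r (shift c f) k)  ≡⟨ cong -ℤ_ (sym (scale (shift-linear r k) (sgn n) (shift c f))) ⟩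
      -ℤ shift r (signed n c f) k          ∎
      where open ≡-Reasoning

    -- `st`, `π` and `d` count the edges inside `A`, the members of `p` in `A` and the neighbours of
    -- `x` in `A`; `r` is the degree of `x` into `R`. If d = 1, then `x` cannot join `A`, and [r+1]
    -- is already [d+r]. If d = 0, then [r+1] = [r] + q^r, and the term with `x` in `A` cancels q^r
    -- unless `x` lies in `p`.
    avoid-arith : ∀ st π px d r (g : Poly) k → (st ≡ 0 → (d ≡ 0) ⊎ (d ≡ 1)) →
      ⟦ d + st ≡ᵇ 0 ⟧ ⟦ bit px + π ≡ᵇ 0 ⟧ (-ℤ shift r g k) +ℤ
      ⟦ st ≡ᵇ 0 ⟧ ⟦ π ≡ᵇ 0 ⟧ bracket (suc r) g k ≡
      bracket (d + r) (λ j → ⟦ st ≡ᵇ 0 ⟧ ⟦ π ≡ᵇ 0 ⟧ g j) k +ℤ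
      ⟦ px ⟧ shift (d + r) (λ j → ⟦ st ≡ᵇ 0 ⟧ ⟦ (π ≡ᵇ 0) ∧ (d ≡ᵇ 0) ⟧ g j) k
    avoid-arith (suc st) π px d r g k h rewrite ℕₚ.+-suc d st =
      sym (cong₂ _+ℤ_ (zer (bracket-linear (d + r) k)) (zer (iverson-linear px (shift-linear (d + r) k))))
    avoid-arith zero (suc π) px d r g k h
      rewrite ℕₚ.+-suc (bit px) π
            | zer (bracket-linear (d + r) k) | zer (iverson-linear px (shift-linear (d + r) k))
            | ⟦⟧-zero (d + 0 ≡ᵇ 0) = refl
    avoid-arith zero zero px d r g k h with h refl
    avoid-arith zero zero true  .0 r g k h | inj₁ refl = ℤₚ.+-identityˡ _
    avoid-arith zero zero false .0 r g k h | inj₁ refl = cancel (shift r g k) (bracket r g k)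
      where
      cancel : ∀ s b → -ℤ s +ℤ (b +ℤ s) ≡ b +ℤ + 0
      cancel = solve-∀
    avoid-arith zero zero px .1 r g k h | inj₂ refl =
      trans (ℤₚ.+-identityˡ (bracket (suc r) g k)) (sym (trans (cong (bracket (suc r) g k +ℤ_)
        (zer (iverson-linear px (shift-linear (suc r) k)))) (ℤₚ.+-identityʳ (bracket (suc r) g k))))

    -- The same two cases with weights n+1 and n: for d = 0 the balance is (n+1) q^r - n ([r] + q^r)
    -- = -n [r] + q^r.
    root-arith : ∀ st n d r (g : Poly) k → (st ≡ 0 → (d ≡ 0) ⊎ (d ≡ 1)) →
      ⟦ d + st ≡ᵇ 0 ⟧ (+ suc n *ℤ -ℤ (-ℤ shift r g k)) +ℤ
      ⟦ st ≡ᵇ 0 ⟧ (+ n *ℤ -ℤ bracket (suc r) g k) ≡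
      bracket (d + r) (λ j → ⟦ st ≡ᵇ 0 ⟧ (+ n *ℤ -ℤ g j)) k +ℤ
      shift (d + r) (λ j → ⟦ st ≡ᵇ 0 ⟧ ⟦ d ≡ᵇ 0 ⟧ g j) k
    root-arith (suc st) n d r g k h rewrite ℕₚ.+-suc d st =
      sym (cong₂ _+ℤ_ (zer (bracket-linear (d + r) k)) (zer (shift-linear (d + r) k)))
    root-arith zero n d r g k h with h refl
    root-arith zero n .0 r g k h | inj₁ refl = trans (arith (+ n) (shift r g k) (bracket r g k))
      (cong (_+ℤ shift r g k) (sym (trans (scale (bracket-linear r k) (+ n) (λ j → -ℤ g j))
        (cong (+ n *ℤ_) (neg (bracket-linear r k) g)))))
      where
      arith : ∀ n s b → (+ 1 +ℤ n) *ℤ -ℤ (-ℤ s) +ℤ n *ℤ -ℤ (b +ℤ s) ≡ n *ℤ -ℤ b +ℤ s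
      arith = solve-∀
    root-arith zero n .1 r g k h | inj₂ refl = trans (ℤₚ.+-identityˡ (+ n *ℤ -ℤ bracket (suc r) g k)) (sym (trans
      (cong₂ _+ℤ_ (trans (scale (bracket-linear (suc r) k) (+ n) (λ j → -ℤ g j))
        (cong (+ n *ℤ_) (neg (bracket-linear (suc r) k) g))) (zer (shift-linear (suc r) k)))
      (ℤₚ.+-identityʳ (+ n *ℤ -ℤ bracket (suc r) g k))))

    #-∨ : ∀ (p q : V → Bool) A → (# (λ y → p y ∨ q y) A ≡ᵇ 0) ≡ (# p A ≡ᵇ 0) ∧ (# q A ≡ᵇ 0)
    #-∨ p q []      = refl
    #-∨ p q (x ∷ A) with p x | q x
    ... | true  | _     = refl
    ... | false | true  = sym (𝔹ₚ.∧-zeroʳ (# p A ≡ᵇ 0))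
    ... | false | false = #-∨ p q A

  avoidTerm-∷ : ∀ p {x A R S} k → Interleaving A R S → All (x ≺_) S → Sorted S →
    avoidTerm p (x ∷ A) R k +ℤ avoidTerm p A (x ∷ R) k ≡
    bracket (deg x S) (avoidTerm p A R) k +ℤ
    ⟦ p x ⟧ shift (deg x S) (avoidTerm (λ y → p y ∨ e x y) A R) k
  avoidTerm-∷ p {x} {A} {R} k i x≺S sS
    rewrite cross-∷ (proj₁ (All-split i x≺S)) | cross-smallest (proj₁ (All-split i x≺S)) R
          | sumBy-split (λ y → bit (e x y)) i | #-∨ p (e x) A
          | signed-suc (length A) (deg x R) (cross A R) (orientations R) k
          | signed-bracket (length A) (cross A R) (suc (deg x R)) (orientations R) k
    = avoid-arith (cross A A) (# p A) (p x) (deg x A) (deg x R)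
        (signed (length A) (cross A R) (orientations R)) k
        (stable-deg (proj₁ (All-split i x≺S)) (proj₁ (AllPairs-split i sS)))

  sourcesIn-∷ : ∀ p {x S} k → All (x ≺_) S → Sorted S →
    sourcesIn p (x ∷ S) k ≡ bracket (deg x S) (sourcesIn p S) k +ℤ
      ⟦ p x ⟧ shift (deg x S) (sourcesIn (λ y → p y ∨ e x y) S) k
  sourcesIn-∷ p {x} {S} k x≺S sS = begin
    sourcesIn p (x ∷ S) k
      ≡⟨ sym (splitSum-+ S _ _) ⟩
    splitSum S (λ A R → avoidTerm p (x ∷ A) R k +ℤ avoidTerm p A (x ∷ R) k)
      ≡⟨ splitSum-cong S (λ i → avoidTerm-∷ p k i x≺S sS) ⟩
    splitSum S (λ A R → bracket (deg x S) (avoidTerm p A R) k +ℤ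
      ⟦ p x ⟧ shift (deg x S) (avoidTerm (λ y → p y ∨ e x y) A R) k)
      ≡⟨ splitSum-+ S _ _ ⟩
    splitSum S (λ A R → bracket (deg x S) (avoidTerm p A R) k) +ℤ
    splitSum S (λ A R → ⟦ p x ⟧ shift (deg x S) (avoidTerm (λ y → p y ∨ e x y) A R) k)
      ≡⟨ sym (cong₂ _+ℤ_ (splitSum-comm (bracket-linear (deg x S) k) S (avoidTerm p))
           (splitSum-comm (iverson-linear (p x) (shift-linear (deg x S) k)) S
             (avoidTerm (λ y → p y ∨ e x y)))) ⟩
    bracket (deg x S) (sourcesIn p S) k +ℤ
    ⟦ p x ⟧ shift (deg x S) (sourcesIn (λ y → p y ∨ e x y) S) k ∎
    where open ≡-Reasoning

  δ₀-nonneg : NonNeg δ₀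
  δ₀-nonneg k = ⟦⟧-nonneg (k ≡ᵇ 0) (+≤+ z≤n)

  sourcesIn-nonneg : ∀ S → Sorted S → ∀ p → NonNeg (sourcesIn p S)
  sourcesIn-nonneg []      _           p k = subst (+ 0 ≤ℤ_) (sym (ℤₚ.*-identityˡ (δ₀ k))) (δ₀-nonneg k)
  sourcesIn-nonneg (x ∷ S) (x≺S ∷ sS) p k = subst (+ 0 ≤ℤ_) (sym (sourcesIn-∷ p k x≺S sS))
    (ℤₚ.+-mono-≤ (bracket-nonneg (deg x S) (sourcesIn-nonneg S sS p) k)
      (⟦⟧-nonneg (p x) (shift-nonneg (deg x S) (sourcesIn-nonneg S sS _) k)))

  -- An acyclic orientation of a nonempty graph has a source. In the recursion with `p` empty the
  -- second term disappears, and the factor [deg x S] is 0 for a single vertex.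
  sourcesIn-none : ∀ S → Sorted S → ∀ k →
    sourcesIn (λ _ → false) S k ≡ ⟦ length S ≡ᵇ 0 ⟧ δ₀ k
  sourcesIn-none []          _                  k = ℤₚ.*-identityˡ (δ₀ k)
  sourcesIn-none (x ∷ [])    (x≺S ∷ sS) k = sourcesIn-∷ (λ _ → false) k x≺S sS
  sourcesIn-none (x ∷ y ∷ S) (x≺S ∷ sS) k = trans (sourcesIn-∷ (λ _ → false) k x≺S sS)
    (trans (ℤₚ.+-identityʳ (bracket (deg x (y ∷ S)) (sourcesIn (λ _ → false) (y ∷ S)) k))
      (vanish (bracket-linear (deg x (y ∷ S)) k) (sourcesIn-none (y ∷ S) sS)))

  rootTerm-∷ : ∀ {x A R S} k → Interleaving A R S → All (x ≺_) S → Sorted S →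
    rootTerm (x ∷ A) R k +ℤ rootTerm A (x ∷ R) k ≡
    bracket (deg x S) (rootTerm A R) k +ℤ shift (deg x S) (avoidTerm (e x) A R) k
  rootTerm-∷ {x} {A} {R} k i x≺S sS
    rewrite cross-∷ (proj₁ (All-split i x≺S)) | cross-smallest (proj₁ (All-split i x≺S)) R
          | sumBy-split (λ y → bit (e x y)) i
          | signed-suc (length A) (deg x R) (cross A R) (orientations R) k
          | signed-bracket (length A) (cross A R) (suc (deg x R)) (orientations R) k
    = root-arith (cross A A) (length A) (deg x A) (deg x R)
        (signed (length A) (cross A R) (orientations R)) k
        (stable-deg (proj₁ (All-split i x≺S)) (proj₁ (AllPairs-split i sS)))

  -- Either `x` is no source and `S` already has exactly one, or `x` is the only source, and then
  -- every source of `S` is a neighbour of `x`.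
  rooted-∷ : ∀ {x S} k → All (x ≺_) S → Sorted S →
    rooted (x ∷ S) k ≡ bracket (deg x S) (rooted S) k +ℤ shift (deg x S) (sourcesIn (e x) S) k
  rooted-∷ {x} {S} k x≺S sS = begin
    rooted (x ∷ S) k
      ≡⟨ sym (splitSum-+ S _ _) ⟩
    splitSum S (λ A R → rootTerm (x ∷ A) R k +ℤ rootTerm A (x ∷ R) k)
      ≡⟨ splitSum-cong S (λ i → rootTerm-∷ k i x≺S sS) ⟩
    splitSum S (λ A R → bracket (deg x S) (rootTerm A R) k +ℤ
      shift (deg x S) (avoidTerm (e x) A R) k)
      ≡⟨ splitSum-+ S _ _ ⟩
    splitSum S (λ A R → bracket (deg x S) (rootTerm A R) k) +ℤ
    splitSum S (λ A R → shift (deg x S) (avoidTerm (e x) A R) k)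
      ≡⟨ sym (cong₂ _+ℤ_ (splitSum-comm (bracket-linear (deg x S) k) S rootTerm)
           (splitSum-comm (shift-linear (deg x S) k) S (avoidTerm (e x)))) ⟩
    bracket (deg x S) (rooted S) k +ℤ shift (deg x S) (sourcesIn (e x) S) k ∎
    where open ≡-Reasoning

  rooted-nonneg : ∀ S → Sorted S → NonNeg (rooted S)
  rooted-nonneg []      _          k = +≤+ z≤n
  rooted-nonneg (x ∷ S) (x≺S ∷ sS) k = subst (+ 0 ≤ℤ_) (sym (rooted-∷ k x≺S sS))
    (ℤₚ.+-mono-≤ (bracket-nonneg (deg x S) (rooted-nonneg S sS) k)
      (shift-nonneg (deg x S) (sourcesIn-nonneg S sS (e x)) k))

  -- From colourings to acyclic orientations

  private
    part : (List V → Poly) → ℕ → List V → Poly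
    part F b S k = splitSum S (λ A R →
      ⟦ cross A A ≡ᵇ 0 ⟧ ⟦ length A ≡ᵇ b ⟧ shift (cross A R) (F R) k)

    -- A class of `b` vertices leaves at most `m`, so compositions with at most `m` positive parts
    -- cover all ways to colour the rest.
    altSum-part : ∀ m b S k → Sorted S → length S ≤ b + m →
      (∀ R → Sorted R → length R ≤ m → ∀ j → altSum m (λ β → colourings R β j) ≡ orientations R j) →
      altSum m (λ β → colourings S (b ∷ β) k) ≡ part orientations b S k
    altSum-part m b S k sS S≤ ih = trans (colourings-comm (altSum-linear m) (λ β → β) S b k)
      (splitSum-cong S (λ {A} {R} i → cong (⟦ cross A A ≡ᵇ 0 ⟧_)
        (iverson-cong (length A ≡ᵇ b) (λ A≡b → inner i (≡ᵇ-sound (length A) b A≡b)))))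
      where
      inner : ∀ {A R} → Interleaving A R S → length A ≡ b →
        shift (cross A R) (λ j → altSum m (λ β → colourings R β j)) k ≡
        shift (cross A R) (orientations R) k
      inner {A} {R} i refl = congr (shift-linear (cross A R) k) (ih R (proj₂ (AllPairs-split i sS))
        (ℕₚ.+-cancelˡ-≤ (length A) (length R) m (subst (_≤ length A + m) (length-split i) S≤)))

    alt-arith : ∀ st n (x : ℤ) → (st ≡ 0 → n ≤ 3) →
      ((⟦ st ≡ᵇ 0 ⟧ ⟦ n ≡ᵇ 1 ⟧ x -ℤ ⟦ st ≡ᵇ 0 ⟧ ⟦ n ≡ᵇ 2 ⟧ x) +ℤ ⟦ st ≡ᵇ 0 ⟧ ⟦ n ≡ᵇ 3 ⟧ x) +ℤ
      ⟦ st ≡ᵇ 0 ⟧ (sgn n *ℤ x) ≡ ⟦ n ≡ᵇ 0 ⟧ ⟦ st ≡ᵇ 0 ⟧ x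
    alt-arith (suc st) n x h = sym (⟦⟧-zero (n ≡ᵇ 0))
    alt-arith zero 0 x h = lem x
      where
      lem : ∀ x → ((+ 0 -ℤ + 0) +ℤ + 0) +ℤ + 1 *ℤ x ≡ x
      lem = solve-∀
    alt-arith zero 1 x h = lem x
      where
      lem : ∀ x → ((x -ℤ + 0) +ℤ + 0) +ℤ (-ℤ + 1) *ℤ x ≡ + 0
      lem = solve-∀
    alt-arith zero 2 x h = lem x
      where
      lem : ∀ x → ((+ 0 -ℤ x) +ℤ + 0) +ℤ (-ℤ (-ℤ + 1)) *ℤ x ≡ + 0
      lem = solve-∀
    alt-arith zero 3 x h = lem x
      where
      lem : ∀ x → ((+ 0 -ℤ + 0) +ℤ x) +ℤ (-ℤ (-ℤ (-ℤ + 1))) *ℤ x ≡ + 0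
      lem = solve-∀
    alt-arith zero (suc (suc (suc (suc n)))) x h with h refl
    ... | s≤s (s≤s (s≤s ()))

    head-arith : ∀ st n (x : ℤ) → (st ≡ 0 → n ≤ 3) →
      (⟦ st ≡ᵇ 0 ⟧ ⟦ n ≡ᵇ 1 ⟧ x +ℤ -[1+ 1 ] *ℤ ⟦ st ≡ᵇ 0 ⟧ ⟦ n ≡ᵇ 2 ⟧ x) +ℤ
      + 3 *ℤ ⟦ st ≡ᵇ 0 ⟧ ⟦ n ≡ᵇ 3 ⟧ x ≡
      ⟦ st ≡ᵇ 0 ⟧ (+ n *ℤ -ℤ (sgn n *ℤ x))
    head-arith (suc st) n x h = refl
    head-arith zero 0 x h = refl
    head-arith zero 1 x h = lem x
      where
      lem : ∀ x → (x +ℤ + 0) +ℤ + 0 ≡ + 1 *ℤ -ℤ ((-ℤ + 1) *ℤ x)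
      lem = solve-∀
    head-arith zero 2 x h = lem x
      where
      lem : ∀ x → (+ 0 +ℤ -[1+ 1 ] *ℤ x) +ℤ + 0 ≡ + 2 *ℤ -ℤ ((-ℤ (-ℤ + 1)) *ℤ x)
      lem = solve-∀
    head-arith zero 3 x h = lem x
      where
      lem : ∀ x → (+ 0 +ℤ + 0) +ℤ + 3 *ℤ x ≡ + 3 *ℤ -ℤ ((-ℤ (-ℤ (-ℤ + 1))) *ℤ x)
      lem = solve-∀
    head-arith zero (suc (suc (suc (suc n)))) x h with h refl
    ... | s≤s (s≤s (s≤s ()))

    -- By `sourcesIn-none` the signed sum over all stable `A` collapses. As stable sets have at most
    -- three elements, the classes of sizes 1, 2, 3 cancel every term of it except the one with `A`
    -- empty, which is `orientations S`.
    parts-alt : ∀ S k → Sorted S →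
      (part orientations 1 S k -ℤ part orientations 2 S k) +ℤ part orientations 3 S k +ℤ
      ⟦ length S ≡ᵇ 0 ⟧ δ₀ k ≡ orientations S k
    parts-alt S k sS = begin
      (part orientations 1 S k -ℤ part orientations 2 S k) +ℤ part orientations 3 S k +ℤ
      ⟦ length S ≡ᵇ 0 ⟧ δ₀ k
        ≡⟨ cong₂ _+ℤ_ gather (sym (sourcesIn-none S sS k)) ⟩
      splitSum S (λ A R → (x 1 A R -ℤ x 2 A R) +ℤ x 3 A R) +ℤ sourcesIn (λ _ → false) S k
        ≡⟨ sym (splitSum-+ S _ _) ⟩
      splitSum S (λ A R → ((x 1 A R -ℤ x 2 A R) +ℤ x 3 A R) +ℤ avoidTerm (λ _ → false) A R k)
        ≡⟨ splitSum-cong S (λ {A} {R} i → termwise A R i) ⟩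
      splitSum S (λ A R → ⟦ length A ≡ᵇ 0 ⟧ ⟦ cross A A ≡ᵇ 0 ⟧ shift (cross A R) (orientations R) k)
        ≡⟨ splitSum-null S (λ A R → ⟦ cross A A ≡ᵇ 0 ⟧ shift (cross A R) (orientations R) k) ⟩
      orientations S k ∎
      where
      open ≡-Reasoning
      x : ℕ → List V → List V → ℤ
      x b A R = ⟦ cross A A ≡ᵇ 0 ⟧ ⟦ length A ≡ᵇ b ⟧ shift (cross A R) (orientations R) k
      l = splitSum-linear S _,_
      gather : (part orientations 1 S k -ℤ part orientations 2 S k) +ℤ part orientations 3 S k ≡
        splitSum S (λ A R → (x 1 A R -ℤ x 2 A R) +ℤ x 3 A R)
      gather = sym (trans (splitSum-+ S (λ A R → x 1 A R -ℤ x 2 A R) (x 3))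
        (cong (_+ℤ splitSum S (x 3)) (sub l (λ (A , R) → x 1 A R) (λ (A , R) → x 2 A R))))
      termwise : ∀ A R → Interleaving A R S →
        ((x 1 A R -ℤ x 2 A R) +ℤ x 3 A R) +ℤ avoidTerm (λ _ → false) A R k ≡
        ⟦ length A ≡ᵇ 0 ⟧ ⟦ cross A A ≡ᵇ 0 ⟧ shift (cross A R) (orientations R) k
      termwise A R i rewrite sumBy-zero A =
        alt-arith (cross A A) (length A) (shift (cross A R) (orientations R) k)
          (stable-length (proj₁ (AllPairs-split i sS)))

  altSum-colourings : ∀ m S → Sorted S → length S ≤ m → ∀ k →
    altSum m (λ β → colourings S β k) ≡ orientations S k
  altSum-colourings zero    []      sS S≤m k = refl
  altSum-colourings (suc m) S       sS S≤m k = begin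
    colourings S [] k +ℤ ((a 1 -ℤ a 2) +ℤ a 3)
      ≡⟨ cong (colourings S [] k +ℤ_) (cong₂ _+ℤ_ (cong₂ _-ℤ_
           (altSum-part m 1 S k sS S≤m ih)
           (altSum-part m 2 S k sS (ℕₚ.m≤n⇒m≤1+n S≤m) ih))
           (altSum-part m 3 S k sS (ℕₚ.m≤n⇒m≤1+n (ℕₚ.m≤n⇒m≤1+n S≤m)) ih)) ⟩
    colourings S [] k +ℤ ((p 1 -ℤ p 2) +ℤ p 3)
      ≡⟨ ℤₚ.+-comm (colourings S [] k) _ ⟩
    ((p 1 -ℤ p 2) +ℤ p 3) +ℤ colourings S [] k
      ≡⟨ parts-alt S k sS ⟩
    orientations S k ∎
    where
    open ≡-Reasoning
    a p : ℕ → ℤ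
    a b = altSum m (λ β → colourings S (b ∷ β) k)
    p b = part orientations b S k
    ih : ∀ R → Sorted R → length R ≤ m → ∀ j → altSum m (λ β → colourings R β j) ≡ orientations R j
    ih = altSum-colourings m

  -- The first class carries the weight of `rootTerm`, and the remaining classes sum to
  -- `orientations`. The summand `colourings S []` belongs to degree 0: the empty graph has one
  -- orientation, and that has no source.
  headSum-colourings : ∀ m S → Sorted S → length S ≤ m → ∀ k →
    headSum m (λ β → colourings S β k) ≡ colourings S [] k +ℤ rooted S k
  headSum-colourings m S sS S≤m k = cong (colourings S [] k +ℤ_) (begin
    (a 1 +ℤ -[1+ 1 ] *ℤ a 2) +ℤ + 3 *ℤ a 3
      ≡⟨ cong₂ _+ℤ_ (cong₂ _+ℤ_ (h 1) (cong (-[1+ 1 ] *ℤ_) (h 2))) (cong (+ 3 *ℤ_) (h 3)) ⟩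
    (splitSum S (x 1) +ℤ -[1+ 1 ] *ℤ splitSum S (x 2)) +ℤ + 3 *ℤ splitSum S (x 3)
      ≡⟨ sym (cong₂ _+ℤ_ (cong (splitSum S (x 1) +ℤ_)
           (scale l -[1+ 1 ] (λ (A , R) → x 2 A R))) (scale l (+ 3) (λ (A , R) → x 3 A R))) ⟩
    (splitSum S (x 1) +ℤ splitSum S (λ A R → -[1+ 1 ] *ℤ x 2 A R)) +ℤ splitSum S (λ A R → + 3 *ℤ x 3 A R)
      ≡⟨ sym (trans (splitSum-+ S _ _) (cong (_+ℤ splitSum S (λ A R → + 3 *ℤ x 3 A R)) (splitSum-+ S _ _))) ⟩
    splitSum S (λ A R → (x 1 A R +ℤ -[1+ 1 ] *ℤ x 2 A R) +ℤ + 3 *ℤ x 3 A R)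
      ≡⟨ splitSum-cong S (λ {A} {R} i → head-arith (cross A A) (length A)
           (shift (cross A R) (orientations R) k) (stable-length (proj₁ (AllPairs-split i sS)))) ⟩
    rooted S k ∎)
    where
    open ≡-Reasoning
    a : ℕ → ℤ
    a b = altSum m (λ β → colourings S (b ∷ β) k)
    x : ℕ → List V → List V → ℤ
    x b A R = ⟦ cross A A ≡ᵇ 0 ⟧ ⟦ length A ≡ᵇ b ⟧ shift (cross A R) (orientations R) k
    l = splitSum-linear S _,_
    h : ∀ b → a b ≡ part orientations b S k
    h b = altSum-part m b S k sS (ℕₚ.m≤n⇒m≤o+n b S≤m) (altSum-colourings m)

  -- Each leading 3 splits off a stable triple, which only multiplies by a power of q and leaves a
  -- sorted list.
  headSum-triples-nonneg : ∀ m l S → Sorted S → length S ≤ m →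
    NonNeg (λ k → headSum m (λ β → colourings S (replicate l 3 ++ β) k))
  headSum-triples-nonneg m zero    S sS S≤m k = subst (+ 0 ≤ℤ_) (sym (headSum-colourings m S sS S≤m k))
    (ℤₚ.+-mono-≤ (colourings-nonneg [] S k) (rooted-nonneg S sS k))
  headSum-triples-nonneg m (suc l) S sS S≤m k =
    subst (+ 0 ≤ℤ_) (sym (colourings-comm (headSum-linear m) (replicate l 3 ++_) S 3 k))
    (splitSum-nonneg S (λ {A} {R} i → ⟦⟧-nonneg (cross A A ≡ᵇ 0) (⟦⟧-nonneg (length A ≡ᵇ 3)
      (shift-nonneg (cross A R) (headSum-triples-nonneg m l R (proj₂ (AllPairs-split i sS))
        (ℕₚ.≤-trans (subst (length R ≤_) (sym (length-split i)) (ℕₚ.m≤n+m (length R) (length A))) S≤m)) k))))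

  -- Symmetry of the colourings by exchange of two consecutive colours

  private
    true-or-false : ∀ b → (b ≡ true) ⊎ (b ≡ false)
    true-or-false true  = inj₁ refl
    true-or-false false = inj₂ refl

    -- `f` stands for everything outside `A` and `B`; it can be held fixed because it will depend on
    -- their union only.
    pairTerm : Poly → List V → List V → ℕ → ℕ → Poly
    pairTerm f A B a b k = ⟦ cross A A ≡ᵇ 0 ⟧ ⟦ length A ≡ᵇ a ⟧ ⟦ cross B B ≡ᵇ 0 ⟧ ⟦ length B ≡ᵇ b ⟧
      shift (cross A B) f k

    twoColour headFirst : Poly → List V → ℕ → ℕ → Poly
    twoColour f W a b k = splitSum W (λ A B → pairTerm f A B a b k)
    headFirst f []      a b k = + 0
    headFirst f (x ∷ W) a b k = splitSum W (λ A B → pairTerm f (x ∷ A) B a b k)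

    headSecond : Poly → List V → ℕ → ℕ → Poly
    headSecond f []      a b k = + 0
    headSecond f (x ∷ W) a b k = splitSum W (λ A B → pairTerm f A (x ∷ B) a b k)

    -- Multiplication of a generating function in x and y by x and by y; `a` and `b` are the
    -- exponents.
    X Y : (ℕ → ℕ → Poly) → ℕ → ℕ → Poly
    X K zero    b k = + 0
    X K (suc a) b k = K a b k
    Y K a zero    k = + 0
    Y K a (suc b) k = K a b k

    Symmetric : (ℕ → ℕ → Poly) → Set
    Symmetric K = ∀ a b k → K a b k ≡ K b a k

    -- The component of the first vertex is a path; F and G count the colourings giving that
    -- vertex the first and the second colour.  On a path with 2m+1 vertices they are
    -- q^m x^(m+1) y^m and q^m x^m y^(m+1), on a path with 2m vertices q^m x^m y^m and
    -- q^(m-1) x^m y^m.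
    data Path (F G : ℕ → ℕ → Poly) : Set where
      odd  : ∀ K → Symmetric K → (∀ a b k → F a b k ≡ X K a b k) → (∀ a b k → G a b k ≡ Y K a b k) → Path F G
      even : ∀ K → Symmetric K → (∀ a b k → F a b k ≡ shift 1 (K a b) k) → (∀ a b k → G a b k ≡ K a b k) → Path F G

    XY-flip : ∀ {K} → Symmetric K → ∀ a b k → X K a b k ≡ Y K b a k
    XY-flip s zero    b k = refl
    XY-flip s (suc a) b k = s a b k

    -- The total is (x + y) K for an odd path and (1 + q) K for an even one.
    path-symmetric : ∀ {F G} → Path F G → Symmetric (λ a b k → F a b k +ℤ G a b k)
    path-symmetric (odd K s hF hG) a b k = begin
      _                           ≡⟨ cong₂ _+ℤ_ (hF a b k) (hG a b k) ⟩
      X K a b k +ℤ Y K a b k      ≡⟨ cong₂ _+ℤ_ (XY-flip s a b k) (sym (XY-flip s b a k)) ⟩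
      Y K b a k +ℤ X K b a k      ≡⟨ ℤₚ.+-comm (Y K b a k) (X K b a k) ⟩
      X K b a k +ℤ Y K b a k      ≡⟨ sym (cong₂ _+ℤ_ (hF b a k) (hG b a k)) ⟩
      _                           ∎
      where open ≡-Reasoning
    path-symmetric (even K s hF hG) a b k = cong₂ _+ℤ_
      (trans (hF a b k) (trans (congr (shift-linear 1 k) (s a b)) (sym (hF b a k))))
      (trans (hG a b k) (trans (s a b k) (sym (hG b a k))))

    module _ (f : Poly) where

      conflict₁ : ∀ {x y A} B a b k → All (x ≺_) (y ∷ A) → e x y ≡ true →
        pairTerm f (x ∷ y ∷ A) B a b k ≡ + 0
      conflict₁ B a b k x≺ exy rewrite cross-∷ x≺ | exy = refl

      conflict₂ : ∀ {x y B} A a b k → All (x ≺_) (y ∷ B) → e x y ≡ true →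
        pairTerm f A (x ∷ y ∷ B) a b k ≡ + 0
      conflict₂ A a b k x≺ exy rewrite cross-∷ x≺ | exy =
        zer (iverson-linear (cross A A ≡ᵇ 0) (iverson-linear (length A ≡ᵇ a) (eval-linear 0)))

      extend₁ : ∀ {x A} B w a b k → All (x ≺_) A → deg x A ≡ 0 → deg x B ≡ w →
        pairTerm f (x ∷ A) B a b k ≡ X (λ a b → shift w (pairTerm f A B a b)) a b k
      extend₁ {x} {A} B w zero b k x≺ dA dB = ⟦⟧-zero (cross (x ∷ A) (x ∷ A) ≡ᵇ 0)
      extend₁ {x} {A} B .(deg x B) (suc a) b k x≺ dA refl rewrite cross-∷ x≺ | dA =
        trans (cong c (shift-+ (deg x B) (cross A B) f k))
          (shift-comm (iverson-linear (cross A A ≡ᵇ 0) (iverson-linear (length A ≡ᵇ a)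
            (iverson-linear (cross B B ≡ᵇ 0) (iverson-linear (length B ≡ᵇ b) (eval-linear 0)))))
            (deg x B) (λ _ → shift (cross A B) f) k)
        where
        c : ℤ → ℤ
        c z = ⟦ cross A A ≡ᵇ 0 ⟧ ⟦ length A ≡ᵇ a ⟧ ⟦ cross B B ≡ᵇ 0 ⟧ ⟦ length B ≡ᵇ b ⟧ z

      extend₂ : ∀ {x B} A a b k → All (x ≺_) A → All (x ≺_) B → deg x B ≡ 0 →
        pairTerm f A (x ∷ B) a b k ≡ Y (pairTerm f A B) a b k
      extend₂ {x} {B} A a zero k x≺A x≺B dB =
        zer (iverson-linear (cross A A ≡ᵇ 0) (iverson-linear (length A ≡ᵇ a)
          (iverson-linear (cross (x ∷ B) (x ∷ B) ≡ᵇ 0) (eval-linear 0))))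
      extend₂ {x} {B} A a (suc b) k x≺A x≺B dB
        rewrite cross-∷ x≺B | dB | cross-smallest x≺A B = refl

      X-sum : ∀ (W : List V) (t : List V → List V → ℕ → ℕ → Poly) a b k →
        splitSum W (λ A B → X (t A B) a b k) ≡ X (λ a b k → splitSum W (λ A B → t A B a b k)) a b k
      X-sum W t zero    b k = splitSum-vanish W (λ _ → refl)
      X-sum W t (suc a) b k = refl

      Y-sum : ∀ (W : List V) (t : List V → List V → ℕ → ℕ → Poly) a b k →
        splitSum W (λ A B → Y (t A B) a b k) ≡ Y (λ a b k → splitSum W (λ A B → t A B a b k)) a b k
      Y-sum W t a zero    k = splitSum-vanish W (λ _ → refl)
      Y-sum W t a (suc b) k = refl

      X-cong : ∀ {K L : ℕ → ℕ → Poly} → (∀ a b k → K a b k ≡ L a b k) → ∀ a b k → X K a b k ≡ X L a b k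
      X-cong h zero    b k = refl
      X-cong h (suc a) b k = h a b k

      Y-cong : ∀ {K L : ℕ → ℕ → Poly} → (∀ a b k → K a b k ≡ L a b k) → ∀ a b k → Y K a b k ≡ Y L a b k
      Y-cong h a zero    k = refl
      Y-cong h a (suc b) k = h a b k

      -- `x` is a component by itself, so the two-colourings of the rest `W`, with all its
      -- components, form the symmetric factor `K`.
      isolated : ∀ {x W} → All (x ≺_) W → All (λ y → e x y ≡ false) W → Symmetric (twoColour f W) →
        Path (headFirst f (x ∷ W)) (headSecond f (x ∷ W))
      isolated {x} {W} x≺W x≁W s = odd (twoColour f W) s
        (λ a b k → trans (splitSum-cong W (λ {A} {B} i → extend₁ B 0 a b k
            (proj₁ (All-split i x≺W)) (#-none (proj₁ (All-split i x≁W))) (#-none (proj₂ (All-split i x≁W)))))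
          (X-sum W (pairTerm f) a b k))
        (λ a b k → trans (splitSum-cong W (λ {A} {B} i → extend₂ A a b k
            (proj₁ (All-split i x≺W)) (proj₂ (All-split i x≺W)) (#-none (proj₂ (All-split i x≁W)))))
          (Y-sum W (pairTerm f) a b k))

      nonadjacent-after : ∀ {x z W} → x ≺ z → All (z ≺_) W → e x z ≡ false → All (λ w → e x w ≡ false) W
      nonadjacent-after {x} {z} x≺z z≺W exz = All.map (λ {w} z≺w → go w z≺w) z≺W
        where
        go : ∀ w → z ≺ w → e x w ≡ false
        go w z≺w with e x w in exw
        ... | false = refl
        ... | true with trans (sym exz) (proj₁ (interval x≺z z≺w exw))
        ...   | ()

      -- `x` takes the colour opposite to that of `y`, and the edge is an ascent only if `x` has the
      -- first colour. So F and G become X (q G) and Y F, which exchanges odd and even paths.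
      adjacent : ∀ {x y W} → x ≺ y → All (x ≺_) W → e x y ≡ true → All (λ w → e x w ≡ false) W →
        Path (headFirst f (y ∷ W)) (headSecond f (y ∷ W)) →
        Path (headFirst f (x ∷ y ∷ W)) (headSecond f (x ∷ y ∷ W))
      adjacent {x} {y} {W} x≺y x≺W exy x≁W p = conclude p
        where
        first : ∀ a b k → headFirst f (x ∷ y ∷ W) a b k ≡ X (λ a b → shift 1 (headSecond f (y ∷ W) a b)) a b k
        first a b k = trans (cong₂ _+ℤ_
            (splitSum-vanish W (λ {A} {B} i → conflict₁ B a b k (x≺y ∷ proj₁ (All-split i x≺W)) exy))
            (trans (splitSum-cong W (λ {A} {B} i → extend₁ (y ∷ B) 1 a b k (proj₁ (All-split i x≺W))
                (#-none (proj₁ (All-split i x≁W)))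
                (cong₂ _+_ (cong bit exy) (#-none (proj₂ (All-split i x≁W))))))
              (X-sum W (λ A B a b → shift 1 (pairTerm f A (y ∷ B) a b)) a b k)))
          (trans (ℤₚ.+-identityˡ _) (X-cong (λ a b k →
            sym (splitSum-comm (shift-linear 1 k) W (λ A B → pairTerm f A (y ∷ B) a b))) a b k))
        second : ∀ a b k → headSecond f (x ∷ y ∷ W) a b k ≡ Y (headFirst f (y ∷ W)) a b k
        second a b k = trans (cong₂ _+ℤ_
            (trans (splitSum-cong W (λ {A} {B} i → extend₂ (y ∷ A) a b k (x≺y ∷ proj₁ (All-split i x≺W))
                (proj₂ (All-split i x≺W)) (#-none (proj₂ (All-split i x≁W)))))
              (Y-sum W (λ A B → pairTerm f (y ∷ A) B) a b k))
            (splitSum-vanish W (λ {A} {B} i → conflict₂ A a b k (x≺y ∷ proj₂ (All-split i x≺W)) exy)))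
          (ℤₚ.+-identityʳ _)
        XYK-symmetric : ∀ {K} → Symmetric K → Symmetric (X (Y K))
        XYK-symmetric s zero    zero    k = refl
        XYK-symmetric s zero    (suc b) k = refl
        XYK-symmetric s (suc a) zero    k = refl
        XYK-symmetric s (suc a) (suc b) k = s a b k
        X-shift : ∀ K a b k → X (λ a b → shift 1 (Y K a b)) a b k ≡ shift 1 (X (Y K) a b) k
        X-shift K zero    b k = sym (zer (shift-linear 1 k))
        X-shift K (suc a) b k = refl
        YX : ∀ K a b k → Y (X K) a b k ≡ X (Y K) a b k
        YX K zero    zero    k = refl
        YX K zero    (suc b) k = refl
        YX K (suc a) zero    k = refl
        YX K (suc a) (suc b) k = refl
        conclude : Path (headFirst f (y ∷ W)) (headSecond f (y ∷ W)) →
          Path (headFirst f (x ∷ y ∷ W)) (headSecond f (x ∷ y ∷ W))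
        conclude (odd K s hF hG) = even (X (Y K)) (XYK-symmetric s)
          (λ a b k → trans (first a b k) (trans
            (X-cong (λ a b k → congr (shift-linear 1 k) (hG a b)) a b k) (X-shift K a b k)))
          (λ a b k → trans (second a b k) (trans (Y-cong hF a b k) (YX K a b k)))
        conclude (even K s hF hG) = odd (λ a b → shift 1 (K a b))
          (λ a b k → congr (shift-linear 1 k) (s a b))
          (λ a b k → trans (first a b k) (X-cong (λ a b k → congr (shift-linear 1 k) (hG a b)) a b k))
          (λ a b k → trans (second a b k) (Y-cong hF a b k))

      -- By `interval` also `y` and `z` are adjacent, so two colours do not suffice. Both counts are
      -- 0, which fits `even` with K = 0.
      triangle : ∀ {x y z W} → Sorted (x ∷ y ∷ z ∷ W) → e x y ≡ true → e x z ≡ true →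
        Path (headFirst f (x ∷ y ∷ z ∷ W)) (headSecond f (x ∷ y ∷ z ∷ W))
      triangle {x} {y} {z} {W} ((x≺y ∷ x≺z ∷ x≺W) ∷ (y≺z ∷ y≺W) ∷ _) exy exz =
        even (λ _ _ _ → + 0) (λ _ _ _ → refl)
          (λ a b k → trans (cong₂ _+ℤ_
              (cong₂ _+ℤ_
                (splitSum-vanish W (λ {A} {B} i → conflict₁ B a b k (x≺y ∷ x≺z ∷ proj₁ (All-split i x≺W)) exy))
                (splitSum-vanish W (λ {A} {B} i → conflict₁ (z ∷ B) a b k (x≺y ∷ proj₁ (All-split i x≺W)) exy)))
              (cong₂ _+ℤ_
                (splitSum-vanish W (λ {A} {B} i → conflict₁ (y ∷ B) a b k (x≺z ∷ proj₁ (All-split i x≺W)) exz))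
                (splitSum-vanish W (λ {A} {B} i → conflict₂ (x ∷ A) a b k (y≺z ∷ proj₂ (All-split i y≺W)) eyz))))
            (sym (zer (shift-linear 1 k))))
          (λ a b k → cong₂ _+ℤ_
              (cong₂ _+ℤ_
                (splitSum-vanish W (λ {A} {B} i → conflict₁ (x ∷ B) a b k (y≺z ∷ proj₁ (All-split i y≺W)) eyz))
                (splitSum-vanish W (λ {A} {B} i → conflict₂ (y ∷ A) a b k (x≺z ∷ proj₂ (All-split i x≺W)) exz)))
              (cong₂ _+ℤ_
                (splitSum-vanish W (λ {A} {B} i → conflict₂ (z ∷ A) a b k (x≺y ∷ proj₂ (All-split i x≺W)) exy))
                (splitSum-vanish W (λ {A} {B} i → conflict₂ A a b k (x≺y ∷ x≺z ∷ proj₂ (All-split i x≺W)) exy))))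
        where
        eyz : e y z ≡ true
        eyz = proj₂ (interval x≺y y≺z exz)

      -- By `nonadjacent-after` the later neighbours of `x` form an initial segment of the list, so
      -- the first two adjacencies decide among the three cases.
      path-∷ : ∀ x y W → Sorted (x ∷ y ∷ W) → Path (headFirst f (y ∷ W)) (headSecond f (y ∷ W)) →
        Path (headFirst f (x ∷ y ∷ W)) (headSecond f (x ∷ y ∷ W))
      path-∷ x y W ((x≺y ∷ x≺W) ∷ sW@(y≺W ∷ sW′)) p with true-or-false (e x y)
      ... | inj₂ exy = isolated (x≺y ∷ x≺W) (exy ∷ nonadjacent-after x≺y y≺W exy) (path-symmetric p)
      path-∷ x y []      ((x≺y ∷ x≺W) ∷ sW) p | inj₁ exy = adjacent x≺y x≺W exy [] p
      path-∷ x y (z ∷ W) ((x≺y ∷ x≺z ∷ x≺W) ∷ sW@(y≺W ∷ z≺W ∷ sW′)) p | inj₁ exy with true-or-false (e x z)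
      ... | inj₂ exz = adjacent x≺y (x≺z ∷ x≺W) exy (exz ∷ nonadjacent-after x≺z z≺W exz) p
      ... | inj₁ exz = triangle ((x≺y ∷ x≺z ∷ x≺W) ∷ sW) exy exz

      path : ∀ x W → Sorted (x ∷ W) → Path (headFirst f (x ∷ W)) (headSecond f (x ∷ W))
      path x []      sW         = isolated [] [] (λ a b k → ⟦⟧-comm (0 ≡ᵇ a) (0 ≡ᵇ b) (f k))
      path x (y ∷ W) s@(_ ∷ sW) = path-∷ x y W s (path y W sW)

      twoColour-symmetric : ∀ W → Sorted W → Symmetric (twoColour f W)
      twoColour-symmetric []      sW a b k = ⟦⟧-comm (0 ≡ᵇ a) (0 ≡ᵇ b) (f k)
      twoColour-symmetric (x ∷ W) sW       = path-symmetric (path x W sW)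

  private
    -- As cross A Q + cross B Q = cross W Q, the power of q towards the later classes does not see
    -- how `W` is divided into `A` and `B`.
    colourings-pair : ∀ S a b β k → colourings S (a ∷ b ∷ β) k ≡
      splitSum S (λ W Q → twoColour (shift (cross W Q) (colourings Q β)) W a b k)
    colourings-pair S a b β k = begin
      colourings S (a ∷ b ∷ β) k
        ≡⟨ splitSum-cong S (λ {A} {R} _ → outer A R) ⟩
      splitSum S (λ A R → splitSum R (λ B Q → term A B Q (cross A Q + cross B Q)))
        ≡⟨ splitSum-assoc S (λ A B Q → term A B Q (cross A Q + cross B Q)) ⟩
      splitSum S (λ W Q → splitSum W (λ A B → term A B Q (cross A Q + cross B Q)))
        ≡⟨ splitSum-cong S (λ {W} {Q} _ → splitSum-cong W (λ {A} {B} i →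
             cong (term A B Q) (sym (cross-splitˡ Q i)))) ⟩
      splitSum S (λ W Q → twoColour (shift (cross W Q) (colourings Q β)) W a b k) ∎
      where
      open ≡-Reasoning
      term : List V → List V → List V → ℕ → ℤ
      term A B Q w = pairTerm (shift w (colourings Q β)) A B a b k
      outer : ∀ A R →
        ⟦ cross A A ≡ᵇ 0 ⟧ ⟦ length A ≡ᵇ a ⟧ shift (cross A R) (colourings R (b ∷ β)) k ≡
        splitSum R (λ B Q → term A B Q (cross A Q + cross B Q))
      outer A R = trans (splitSum-comm linA R (λ B Q j →
          ⟦ cross B B ≡ᵇ 0 ⟧ ⟦ length B ≡ᵇ b ⟧ shift (cross B Q) (colourings Q β) j))
        (splitSum-cong R (λ {B} {Q} i → cong (λ z → ⟦ cross A A ≡ᵇ 0 ⟧ ⟦ length A ≡ᵇ a ⟧ z) (begin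
          shift (cross A R) (λ j → ⟦ cross B B ≡ᵇ 0 ⟧ ⟦ length B ≡ᵇ b ⟧ shift (cross B Q) (colourings Q β) j) k
            ≡⟨ iverson lin (cross B B ≡ᵇ 0) _ ⟩
          ⟦ cross B B ≡ᵇ 0 ⟧ shift (cross A R) (λ j → ⟦ length B ≡ᵇ b ⟧ shift (cross B Q) (colourings Q β) j) k
            ≡⟨ cong (⟦ cross B B ≡ᵇ 0 ⟧_) (iverson lin (length B ≡ᵇ b) _) ⟩
          ⟦ cross B B ≡ᵇ 0 ⟧ ⟦ length B ≡ᵇ b ⟧ shift (cross A R) (shift (cross B Q) (colourings Q β)) k
            ≡⟨ cong (λ z → ⟦ cross B B ≡ᵇ 0 ⟧ ⟦ length B ≡ᵇ b ⟧ z) (inner B Q i) ⟩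
          ⟦ cross B B ≡ᵇ 0 ⟧ ⟦ length B ≡ᵇ b ⟧
            shift (cross A B) (shift (cross A Q + cross B Q) (colourings Q β)) k ∎)))
        where
        lin = shift-linear (cross A R) k
        linA = iverson-linear (cross A A ≡ᵇ 0) (iverson-linear (length A ≡ᵇ a) lin)
        inner : ∀ B Q → Interleaving B Q R → shift (cross A R) (shift (cross B Q) (colourings Q β)) k ≡
          shift (cross A B) (shift (cross A Q + cross B Q) (colourings Q β)) k
        inner B Q i rewrite cross-splitʳ A i = trans (shift-+ (cross A B) (cross A Q) _ k)
          (congr (shift-linear (cross A B) k)
            (λ j → sym (shift-+ (cross A Q) (cross B Q) (colourings Q β) j)))

  colourings-swap : ∀ S → Sorted S → ∀ a b β k →
    colourings S (a ∷ b ∷ β) k ≡ colourings S (b ∷ a ∷ β) k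
  colourings-swap S sS a b β k = begin
    colourings S (a ∷ b ∷ β) k
      ≡⟨ colourings-pair S a b β k ⟩
    splitSum S (λ W Q → twoColour (shift (cross W Q) (colourings Q β)) W a b k)
      ≡⟨ splitSum-cong S (λ {W} {Q} i → twoColour-symmetric (shift (cross W Q) (colourings Q β)) W
           (proj₁ (AllPairs-split i sS)) a b k) ⟩
    splitSum S (λ W Q → twoColour (shift (cross W Q) (colourings Q β)) W b a k)
      ≡⟨ sym (colourings-pair S b a β k) ⟩
    colourings S (b ∷ a ∷ β) k ∎
    where open ≡-Reasoning

  colourings-prep : ∀ b β γ → (∀ S → Sorted S → ∀ k → colourings S β k ≡ colourings S γ k) →
    ∀ S → Sorted S → ∀ k → colourings S (b ∷ β) k ≡ colourings S (b ∷ γ) k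
  colourings-prep b β γ h S sS k = splitSum-cong S (λ {A} {R} i →
    cong (λ z → ⟦ cross A A ≡ᵇ 0 ⟧ ⟦ length A ≡ᵇ b ⟧ z)
      (congr (shift-linear (cross A R) k) (h R (proj₂ (AllPairs-split i sS)))))

  colourings-↭ : ∀ {β γ} → β ↭ γ → ∀ S → Sorted S → ∀ k → colourings S β k ≡ colourings S γ k
  colourings-↭ ↭refl         S sS k = refl
  colourings-↭ (prep {xs = β} {ys = γ} b p) S sS k = colourings-prep b β γ (colourings-↭ p) S sS k
  colourings-↭ (↭swap {xs = β} {ys = γ} a b p) S sS k = trans
    (colourings-prep a (b ∷ β) (b ∷ γ) (colourings-prep b β γ (colourings-↭ p)) S sS k)
    (colourings-swap S sS a b γ k)
  colourings-↭ (↭trans p q)  S sS k = trans (colourings-↭ p S sS k) (colourings-↭ q S sS k)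

  -- Vanishing for large classes and for the wrong degree

  private
    vanishing-term : ∀ {A R : List V} {b} β k → (∀ j → colourings R β j ≡ + 0) →
      ⟦ cross A A ≡ᵇ 0 ⟧ ⟦ length A ≡ᵇ b ⟧ shift (cross A R) (colourings R β) k ≡ + 0
    vanishing-term {A} {R} {b} β k = vanish
      (iverson-linear (cross A A ≡ᵇ 0) (iverson-linear (length A ≡ᵇ b) (shift-linear (cross A R) k)))

  colourings-wide : ∀ β → Any (4 ≤_) β → ∀ S → Sorted S → ∀ k → colourings S β k ≡ + 0
  colourings-wide (b ∷ β) (here 4≤b) S sS k = splitSum-vanish S go
    where
    go : ∀ {A R} → Interleaving A R S →
      ⟦ cross A A ≡ᵇ 0 ⟧ ⟦ length A ≡ᵇ b ⟧ shift (cross A R) (colourings R β) k ≡ + 0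
    go {A} {R} i with cross A A ≡ᵇ 0 in st | length A ≡ᵇ b in ln
    ... | false | _     = refl
    ... | true  | false = refl
    ... | true  | true  = ⊥-elim (ℕₚ.<⇒≱ 4≤b (subst (_≤ 3) (≡ᵇ-sound (length A) b ln)
      (stable-length (proj₁ (AllPairs-split i sS)) (≡ᵇ-sound (cross A A) 0 st))))
  colourings-wide (b ∷ β) (there h) S sS k = splitSum-vanish S (λ {A} {R} i →
    vanishing-term {A} {R} {b} β k (colourings-wide β h R (proj₂ (AllPairs-split i sS))))

  colourings-degree : ∀ β S → sumBy (λ b → b) β ≢ length S → ∀ k → colourings S β k ≡ + 0
  colourings-degree []      []      h k = ⊥-elim (h refl)
  colourings-degree []      (x ∷ S) h k = refl
  colourings-degree (b ∷ β) S       h k = splitSum-vanish S go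
    where
    go : ∀ {A R} → Interleaving A R S →
      ⟦ cross A A ≡ᵇ 0 ⟧ ⟦ length A ≡ᵇ b ⟧ shift (cross A R) (colourings R β) k ≡ + 0
    go {A} {R} i with length A ≡ᵇ b in ln
    ... | false = ⟦⟧-zero (cross A A ≡ᵇ 0)
    ... | true  = vanish (iverson-linear (cross A A ≡ᵇ 0) (shift-linear (cross A R) k))
      (colourings-degree β R (λ h′ → h (trans (cong₂ _+_ (sym (≡ᵇ-sound (length A) b ln)) h′)
        (sym (length-split i)))))

-- Products of three elementary symmetric functions

-- Exponents are integers so that lowering never truncates: a negative exponent stays negative, and
-- `threeRow-neg` gives 0 there.
pr : ℤ → ℤ
pr (+ zero)   = -[1+ 0 ]
pr (+ suc a)  = + a
pr -[1+ n ]   = -[1+ suc n ]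

isZero : ℤ → Bool
isZero (+ zero)  = true
isZero (+ suc a) = false
isZero -[1+ n ]  = false

-- column m g is the coefficient function of e_m(x,y,z) · Σ g(a,b,c) x^a y^b z^c.
column : ℕ → (ℤ → ℤ → ℤ → ℤ) → ℤ → ℤ → ℤ → ℤ
column 0 g a b c = g a b c
column 1 g a b c = g (pr a) b c +ℤ (g a (pr b) c +ℤ g a b (pr c))
column 2 g a b c = g (pr a) (pr b) c +ℤ (g (pr a) b (pr c) +ℤ g a (pr b) (pr c))
column 3 g a b c = g (pr a) (pr b) (pr c)
column (suc (suc (suc (suc _)))) g a b c = + 0

-- The coefficient of x^β in e_a e_b e_c, read as the coefficient of x^a y^b z^c in the product of
-- the e_{β_i}(x,y,z).
threeRow : List ℕ → ℤ → ℤ → ℤ → ℤ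
threeRow []      a b c = ⟦ isZero a ⟧ ⟦ isZero b ⟧ ⟦ isZero c ⟧ (+ 1)
threeRow (m ∷ β) = column m (threeRow β)

column-cong : ∀ m {g h : ℤ → ℤ → ℤ → ℤ} → (∀ a b c → g a b c ≡ h a b c) →
  ∀ a b c → column m g a b c ≡ column m h a b c
column-cong 0 e a b c = e a b c
column-cong 1 e a b c = cong₂ _+ℤ_ (e _ _ _) (cong₂ _+ℤ_ (e _ _ _) (e _ _ _))
column-cong 2 e a b c = cong₂ _+ℤ_ (e _ _ _) (cong₂ _+ℤ_ (e _ _ _) (e _ _ _))
column-cong 3 e a b c = e _ _ _
column-cong (suc (suc (suc (suc _)))) e a b c = refl

column-zero : ∀ m a b c → column m (λ _ _ _ → + 0) a b c ≡ + 0
column-zero 0 a b c = refl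
column-zero 1 a b c = refl
column-zero 2 a b c = refl
column-zero 3 a b c = refl
column-zero (suc (suc (suc (suc _)))) a b c = refl

column-comm : ∀ p q g a b c → column p (column q g) a b c ≡ column q (column p g) a b c
column-comm 0 q g a b c = refl
column-comm (suc (suc (suc (suc p)))) q g a b c = sym (column-zero q a b c)
column-comm 1 0 g a b c = refl
column-comm 2 0 g a b c = refl
column-comm 3 0 g a b c = refl
column-comm 1 (suc (suc (suc (suc q)))) g a b c = refl
column-comm 2 (suc (suc (suc (suc q)))) g a b c = refl
column-comm 3 (suc (suc (suc (suc q)))) g a b c = refl
column-comm 1 1 g a b c = refl
column-comm 2 2 g a b c = refl
column-comm 3 3 g a b c = refl
column-comm 1 3 g a b c = refl
column-comm 3 1 g a b c = refl
column-comm 2 3 g a b c = refl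
column-comm 3 2 g a b c = refl
column-comm 2 1 g a b c = sym (column-comm 1 2 g a b c)
-- `m` is the term in which all three exponents drop: xyz occurs three times in e_1 e_2, once for
-- each choice of the row used by e_1.
column-comm 1 2 g a b c = lem (g (pr (pr a)) (pr b) c) (g (pr (pr a)) b (pr c)) (g (pr a) (pr b) (pr c))
  (g (pr a) (pr (pr b)) c) (g a (pr (pr b)) (pr c)) (g (pr a) b (pr (pr c))) (g a (pr b) (pr (pr c)))
  where
  lem : ∀ x₁ x₂ m x₃ x₄ x₅ x₆ →
    (x₁ +ℤ (x₂ +ℤ m)) +ℤ ((x₃ +ℤ (m +ℤ x₄)) +ℤ (m +ℤ (x₅ +ℤ x₆))) ≡
    (x₁ +ℤ (x₃ +ℤ m)) +ℤ ((x₂ +ℤ (m +ℤ x₅)) +ℤ (m +ℤ (x₄ +ℤ x₆)))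
  lem = solve-∀

add₃ : {L : (D → ℤ) → ℤ} → Linear L → ∀ f g h →
  L (λ d → f d +ℤ (g d +ℤ h d)) ≡ L f +ℤ (L g +ℤ L h)
add₃ {L = L} l f g h = trans (add l f (λ d → g d +ℤ h d)) (cong (L f +ℤ_) (add l g h))

column-comm-linear : {L : (D → ℤ) → ℤ} → Linear L → ∀ m (g : D → ℤ → ℤ → ℤ → ℤ) a b c →
  L (λ d → column m (g d) a b c) ≡ column m (λ x y z → L (λ d → g d x y z)) a b c
column-comm-linear l 0 g a b c = refl
column-comm-linear l 1 g a b c = add₃ l (λ d → g d (pr a) b c) (λ d → g d a (pr b) c) (λ d → g d a b (pr c))
column-comm-linear l 2 g a b c =
  add₃ l (λ d → g d (pr a) (pr b) c) (λ d → g d (pr a) b (pr c)) (λ d → g d a (pr b) (pr c))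
column-comm-linear l 3 g a b c = refl
column-comm-linear l (suc (suc (suc (suc _)))) g a b c = zer l

threeRow-↭ : ∀ {β γ} → β ↭ γ → ∀ a b c → threeRow β a b c ≡ threeRow γ a b c
threeRow-↭ ↭refl          a b c = refl
threeRow-↭ (prep m p)     a b c = column-cong m (threeRow-↭ p) a b c
threeRow-↭ (↭swap {ys = γ} m n p) a b c =
  trans (column-cong m (column-cong n (threeRow-↭ p)) a b c) (column-comm m n (threeRow γ) a b c)
threeRow-↭ (↭trans p q)   a b c = trans (threeRow-↭ p a b c) (threeRow-↭ q a b c)

threeRow-wide : ∀ β → Any (4 ≤_) β → ∀ a b c → threeRow β a b c ≡ + 0
threeRow-wide (m ∷ β) (here (s≤s (s≤s (s≤s (s≤s _))))) a b c = refl
threeRow-wide (m ∷ β) (there h) a b c =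
  trans (column-cong m (threeRow-wide β h) a b c) (column-zero m a b c)

-- A reason for a coefficient to vanish that survives the removal of a column, whichever rows the
-- column uses. Parts above 3 need no clause, since their columns are 0.
record Descending (P : List ℕ → ℤ → ℤ → ℤ → Set) : Set where
  field
    base  : ∀ {a b c} → P [] a b c → threeRow [] a b c ≡ + 0
    step₀ : ∀ {β a b c} → P (0 ∷ β) a b c → P β a b c
    step₁ : ∀ {β a b c} → P (1 ∷ β) a b c → P β (pr a) b c × P β a (pr b) c × P β a b (pr c)
    step₂ : ∀ {β a b c} → P (2 ∷ β) a b c →
            P β (pr a) (pr b) c × P β (pr a) b (pr c) × P β a (pr b) (pr c)
    step₃ : ∀ {β a b c} → P (3 ∷ β) a b c → P β (pr a) (pr b) (pr c)

  threeRow-vanish : ∀ β {a b c} → P β a b c → threeRow β a b c ≡ + 0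
  threeRow-vanish []      p = base p
  threeRow-vanish (0 ∷ β) p = threeRow-vanish β (step₀ p)
  threeRow-vanish (1 ∷ β) p with step₁ p
  ... | x , y , z = cong₂ _+ℤ_ (threeRow-vanish β x) (cong₂ _+ℤ_ (threeRow-vanish β y) (threeRow-vanish β z))
  threeRow-vanish (2 ∷ β) p with step₂ p
  ... | x , y , z = cong₂ _+ℤ_ (threeRow-vanish β x) (cong₂ _+ℤ_ (threeRow-vanish β y) (threeRow-vanish β z))
  threeRow-vanish (3 ∷ β) p = threeRow-vanish β (step₃ p)
  threeRow-vanish (suc (suc (suc (suc _))) ∷ β) p = refl

open Descending using (threeRow-vanish)

data Neg : ℤ → Set where
  below : ∀ {n} → Neg -[1+ n ]

pr-neg : ∀ {a} → Neg a → Neg (pr a)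
pr-neg below = below

data SomeNeg : ℤ → ℤ → ℤ → Set where
  fst : ∀ {a b c} → Neg a → SomeNeg a b c
  snd : ∀ {a b c} → Neg b → SomeNeg a b c
  thd : ∀ {a b c} → Neg c → SomeNeg a b c

neg-descending : Descending (λ _ → SomeNeg)
neg-descending = record
  { base = λ { (fst below) → refl ; {a} (snd below) → ⟦⟧-zero (isZero a)
             ; {a} {b} (thd below) → trans (cong (⟦ isZero a ⟧_) (⟦⟧-zero (isZero b))) (⟦⟧-zero (isZero a)) }
  ; step₀ = λ p → p
  ; step₁ = λ p → dec₁ p , dec₂ p , dec₃ p
  ; step₂ = λ p → dec₁ (dec₂ p) , dec₁ (dec₃ p) , dec₂ (dec₃ p)
  ; step₃ = λ p → dec₁ (dec₂ (dec₃ p)) }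
  where
  dec₁ : ∀ {a b c} → SomeNeg a b c → SomeNeg (pr a) b c
  dec₁ (fst n) = fst (pr-neg n)
  dec₁ (snd n) = snd n
  dec₁ (thd n) = thd n
  dec₂ : ∀ {a b c} → SomeNeg a b c → SomeNeg a (pr b) c
  dec₂ (fst n) = fst n
  dec₂ (snd n) = snd (pr-neg n)
  dec₂ (thd n) = thd n
  dec₃ : ∀ {a b c} → SomeNeg a b c → SomeNeg a b (pr c)
  dec₃ (fst n) = fst n
  dec₃ (snd n) = snd n
  dec₃ (thd n) = thd (pr-neg n)

threeRow-neg : ∀ β {a b c} → SomeNeg a b c → threeRow β a b c ≡ + 0
threeRow-neg = threeRow-vanish neg-descending

infix 4 _≪_
data _≪_ : ℕ → ℤ → Set where
  pos : ∀ {w n} → w < n → w ≪ + n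

≪-pr : ∀ {w x} → suc w ≪ x → w ≪ pr x
≪-pr (pos (s≤s h)) = pos h

≪-weaken : ∀ {w x} → suc w ≪ x → w ≪ x
≪-weaken (pos h) = pos (ℕₚ.<-trans (ℕₚ.n<1+n _) h)

pr-+ : ∀ a b → pr (a +ℤ b) ≡ pr a +ℤ b
pr-+ a b = trans (pr-minus (a +ℤ b)) (trans (lem a b) (cong (_+ℤ b) (sym (pr-minus a))))
  where
  pr-minus : ∀ x → pr x ≡ x +ℤ -[1+ 0 ]
  pr-minus (+ zero)  = refl
  pr-minus (+ suc n) = refl
  pr-minus -[1+ n ]  = cong (λ k → -[1+ suc k ]) (sym (ℕₚ.+-identityʳ n))
  lem : ∀ a b → (a +ℤ b) +ℤ -[1+ 0 ] ≡ (a +ℤ -[1+ 0 ]) +ℤ b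
  lem = solve-∀

+-pr : ∀ a b → pr (a +ℤ b) ≡ a +ℤ pr b
+-pr a b = trans (cong pr (ℤₚ.+-comm a b)) (trans (pr-+ b a) (ℤₚ.+-comm (pr b) a))

-- A column uses the first row at most once, so a nonzero coefficient requires `a` to be at most the
-- number of nonzero columns.
first-descending : Descending (λ β a b c → sumBy (_⊓ 1) β ≪ a)
first-descending = record
  { base = λ { (pos (s≤s _)) → refl }
  ; step₀ = λ p → p
  ; step₁ = λ p → ≪-pr p , ≪-weaken p , ≪-weaken p
  ; step₂ = λ p → ≪-pr p , ≪-pr p , ≪-weaken p
  ; step₃ = ≪-pr }

-- A column of height m uses the first two rows at most min(m, 2) times. These are the first two
-- Gale-Ryser inequalities; for three rows the last one is the comparison of degrees.
firstTwo-descending : Descending (λ β a b c → sumBy (_⊓ 2) β ≪ (a +ℤ b))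
firstTwo-descending = record
  { base = λ {a} {b} → base a b
  ; step₀ = λ p → p
  ; step₁ = λ {_} {a} {b} p → decˡ a b p , decʳ a b p , ≪-weaken p
  ; step₂ = λ {_} {a} {b} p → decʳ (pr a) b (decˡ a b p) , decˡ a b (≪-weaken p) , decʳ a b (≪-weaken p)
  ; step₃ = λ {_} {a} {b} p → decʳ (pr a) b (decˡ a b p) }
  where
  base : ∀ a b {c} → 0 ≪ (a +ℤ b) → threeRow [] a b c ≡ + 0
  base (+ zero)  (+ zero)  (pos ())
  base (+ zero)  (+ suc b) p = refl
  base (+ zero)  -[1+ b ]  p = refl
  base (+ suc a) b         p = refl
  base -[1+ a ]  b         p = refl
  decˡ : ∀ {w} a b → suc w ≪ (a +ℤ b) → w ≪ (pr a +ℤ b)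
  decˡ {w} a b p = subst (w ≪_) (pr-+ a b) (≪-pr p)
  decʳ : ∀ {w} a b → suc w ≪ (a +ℤ b) → w ≪ (a +ℤ pr b)
  decʳ {w} a b p = subst (w ≪_) (+-pr a b) (≪-pr p)

degree-descending : Descending (λ β a b c → (a +ℤ b) +ℤ c ≢ + sumBy (λ m → m) β)
degree-descending = record
  { base = λ {a} {b} {c} → base a b c
  ; step₀ = λ p → p
  ; step₁ = λ {_} {a} {b} {c} p → dec₁ a b c p , dec₂ a b c p , dec₃ a b c p
  ; step₂ = λ {_} {a} {b} {c} p → dec₁ a (pr b) c (dec₂ a b c p)
      , dec₁ a b (pr c) (dec₃ a b c p) , dec₂ a b (pr c) (dec₃ a b c p)
  ; step₃ = λ {_} {a} {b} {c} p → dec₁ a (pr b) (pr c) (dec₂ a b (pr c) (dec₃ a b c p)) }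
  where
  base : ∀ a b c → (a +ℤ b) +ℤ c ≢ + 0 → threeRow [] a b c ≡ + 0
  base (+ zero)  (+ zero)  (+ zero)  h = ⊥-elim (h refl)
  base (+ zero)  (+ zero)  (+ suc c) h = refl
  base (+ zero)  (+ zero)  -[1+ c ]  h = refl
  base (+ zero)  (+ suc b) c         h = refl
  base (+ zero)  -[1+ b ]  c         h = refl
  base (+ suc a) b         c         h = refl
  base -[1+ a ]  b         c         h = refl
  up : ∀ {w} x → pr x ≡ + w → x ≡ + suc w
  up (+ suc n) refl = refl
  dec₁ : ∀ {w} a b c → (a +ℤ b) +ℤ c ≢ + suc w → (pr a +ℤ b) +ℤ c ≢ + w
  dec₁ a b c h e = h (up _ (trans (pr-+ (a +ℤ b) c) (trans (cong (_+ℤ c) (pr-+ a b)) e)))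
  dec₂ : ∀ {w} a b c → (a +ℤ b) +ℤ c ≢ + suc w → (a +ℤ pr b) +ℤ c ≢ + w
  dec₂ a b c h e = h (up _ (trans (pr-+ (a +ℤ b) c) (trans (cong (_+ℤ c) (+-pr a b)) e)))
  dec₃ : ∀ {w} a b c → (a +ℤ b) +ℤ c ≢ + suc w → (a +ℤ b) +ℤ pr c ≢ + w
  dec₃ a b c h e = h (up _ (trans (+-pr (a +ℤ b) c) e))

point : ℕ → ℕ → ℕ → List ℕ
point i j k = replicate i 3 ++ replicate j 2 ++ replicate k 1

-- At the conjugate partition all choices are forced: columns of height 3 use every row and exhaust
-- the third, columns of height 2 then exhaust the second, and the rest use the first.
threeRow-point : ∀ i j k → threeRow (point i j k) (+ (i + j + k)) (+ (i + j)) (+ i) ≡ + 1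
threeRow-point (suc i) j       k       = threeRow-point i j k
threeRow-point zero    (suc j) k       = cong₂ _+ℤ_ (threeRow-point 0 j k)
  (cong₂ _+ℤ_ (threeRow-neg (point 0 j k) (thd below)) (threeRow-neg (point 0 j k) (thd below)))
threeRow-point zero    zero    (suc k) = cong₂ _+ℤ_ (threeRow-point 0 0 k)
  (cong₂ _+ℤ_ (threeRow-neg (point 0 0 k) (snd below)) (threeRow-neg (point 0 0 k) (thd below)))
threeRow-point zero    zero    zero    = refl

-- The functionals on the products e_a e_b e_c

private
  -- The seven values sit at the other corners of the unit cube below (a, b, c): three for e_1,
  -- three for e_2, one for e_3.
  combine : ∀ (γ : ℤ → ℤ → ℤ → ℤ → ℤ) (g : ℤ → ℤ → ℤ → ℤ) a b c {s₁ s₂ s₃ t₁ t₂ t₃ u} →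
    g (pr a) b c ≡ s₁ → g a (pr b) c ≡ s₂ → g a b (pr c) ≡ s₃ →
    g (pr a) (pr b) c ≡ t₁ → g (pr a) b (pr c) ≡ t₂ → g a (pr b) (pr c) ≡ t₃ →
    g (pr a) (pr b) (pr c) ≡ u →
    γ (threeRow [] a b c) (column 1 g a b c) (column 2 g a b c) (column 3 g a b c) ≡
    γ (threeRow [] a b c) (s₁ +ℤ (s₂ +ℤ s₃)) (t₁ +ℤ (t₂ +ℤ t₃)) u
  combine γ g a b c refl refl refl refl refl refl refl = refl

altSum-neg : ∀ m {a b c} → SomeNeg a b c → altSum m (λ β → threeRow β a b c) ≡ + 0
altSum-neg m n = vanish (altSum-linear m) (λ β → threeRow-neg β n)

private
  altSum-column : ∀ m p a b c → altSum m (λ β → threeRow (p ∷ β) a b c) ≡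
    column p (λ x y z → altSum m (λ β → threeRow β x y z)) a b c
  altSum-column m p = column-comm-linear (altSum-linear m) p threeRow

  alt head : ℤ → ℤ → ℤ → ℤ → ℤ
  alt  f s t u = f +ℤ ((s -ℤ t) +ℤ u)
  head f s t u = f +ℤ ((s +ℤ -[1+ 1 ] *ℤ t) +ℤ + 3 *ℤ u)

  reduce : ∀ (γ : ℤ → ℤ → ℤ → ℤ → ℤ) m a b c (let h = λ x y z → altSum m (λ β → threeRow β x y z)) →
    γ (threeRow [] a b c) (altSum m (λ β → threeRow (1 ∷ β) a b c))
      (altSum m (λ β → threeRow (2 ∷ β) a b c)) (altSum m (λ β → threeRow (3 ∷ β) a b c)) ≡
    γ (threeRow [] a b c) (column 1 h a b c) (column 2 h a b c) (column 3 h a b c)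
  reduce γ m a b c = cong₂ (λ s t → γ (threeRow [] a b c) s t (altSum m (λ β → threeRow (3 ∷ β) a b c)))
    (altSum-column m 1 a b c) (altSum-column m 2 a b c)

-- The recursion H = 1 + (e_1 - e_2 + e_3) H has the solution 1/((1-x)(1-y)(1-z)). The cases record
-- which exponents are 0, that is, which of the seven corners are negative and contribute nothing.
-- Each part uses up at least one unit of degree, so `m` parts suffice.
altSum-threeRow : ∀ m a b c → a + b + c ≤ m → altSum m (λ β → threeRow β (+ a) (+ b) (+ c)) ≡ + 1
altSum-threeRow zero    zero zero zero z≤n = refl
altSum-threeRow (suc m) a b c h = trans (reduce alt m (+ a) (+ b) (+ c)) (go a b c h)
  where
  H : ℤ → ℤ → ℤ → ℤ
  H x y z = altSum m (λ β → threeRow β x y z)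
  n : ∀ {x y z} → SomeNeg x y z → H x y z ≡ + 0
  n = altSum-neg m
  one : ∀ a b c → a + b + c ≤ m → H (+ a) (+ b) (+ c) ≡ + 1
  one = altSum-threeRow m
  shorten₂ : ∀ {a} b {c} → a + suc b + c ≤ suc m → a + b + c ≤ m
  shorten₂ {a} b {c} h = ℕₚ.≤-pred (subst (λ x → x + c ≤ suc m) (ℕₚ.+-suc a b) h)
  shorten₃ : ∀ {ab} c → ab + suc c ≤ suc m → ab + c ≤ m
  shorten₃ {ab} c h = ℕₚ.≤-pred (subst (_≤ suc m) (ℕₚ.+-suc ab c) h)
  drop₂ : ∀ {a} b {c} → a + suc b + c ≤ m → a + b + c ≤ m
  drop₂ {a} b {c} h = ℕₚ.≤-trans (ℕₚ.n≤1+n _) (subst (λ x → x + c ≤ m) (ℕₚ.+-suc a b) h)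
  go : ∀ a b c → a + b + c ≤ suc m →
    alt (threeRow [] (+ a) (+ b) (+ c)) (column 1 H (+ a) (+ b) (+ c))
      (column 2 H (+ a) (+ b) (+ c)) (column 3 H (+ a) (+ b) (+ c)) ≡ + 1
  go zero zero zero h = combine alt H (+ zero) (+ zero) (+ zero) (n (fst below)) (n (snd below)) (n (thd below))
    (n (fst below)) (n (fst below)) (n (snd below)) (n (fst below))
  go (suc a) zero zero (s≤s h) = combine alt H (+ suc a) (+ zero) (+ zero) (one a 0 0 h) (n (snd below)) (n (thd below))
    (n (snd below)) (n (thd below)) (n (snd below)) (n (snd below))
  go zero (suc b) zero (s≤s h) = combine alt H (+ zero) (+ suc b) (+ zero) (n (fst below)) (one 0 b 0 h) (n (thd below))
    (n (fst below)) (n (fst below)) (n (thd below)) (n (fst below))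
  go zero zero (suc c) (s≤s h) = combine alt H (+ zero) (+ zero) (+ suc c) (n (fst below)) (n (snd below)) (one 0 0 c h)
    (n (fst below)) (n (fst below)) (n (snd below)) (n (fst below))
  go (suc a) (suc b) zero (s≤s h) = combine alt H (+ suc a) (+ suc b) (+ zero) (one a (suc b) 0 h) (one (suc a) b 0 (shorten₂ {suc a} b (s≤s h)))
    (n (thd below)) (one a b 0 (drop₂ {a} b h)) (n (thd below)) (n (thd below)) (n (thd below))
  go (suc a) zero (suc c) (s≤s h) = combine alt H (+ suc a) (+ zero) (+ suc c) (one a 0 (suc c) h) (n (snd below))
    (one (suc a) 0 c (shorten₃ {suc a + 0} c (s≤s h))) (n (snd below))
    (one a 0 c (ℕₚ.≤-trans (ℕₚ.+-monoʳ-≤ (a + 0) (ℕₚ.n≤1+n c)) h)) (n (snd below)) (n (snd below))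
  go zero (suc b) (suc c) (s≤s h) = combine alt H (+ zero) (+ suc b) (+ suc c) (n (fst below)) (one 0 b (suc c) h)
    (one 0 (suc b) c (shorten₃ {suc b} c (s≤s h))) (n (fst below)) (n (fst below))
    (one 0 b c (ℕₚ.≤-trans (ℕₚ.+-monoʳ-≤ b (ℕₚ.n≤1+n c)) h)) (n (fst below))
  go (suc a) (suc b) (suc c) (s≤s h) = combine alt H (+ suc a) (+ suc b) (+ suc c) (one a (suc b) (suc c) h)
    (one (suc a) b (suc c) (shorten₂ {suc a} b (s≤s h)))
    (one (suc a) (suc b) c (shorten₃ {suc a + suc b} c (s≤s h)))
    (one a b (suc c) (drop₂ {a} b h))
    (one a (suc b) c (ℕₚ.≤-trans (ℕₚ.+-monoʳ-≤ (a + suc b) (ℕₚ.n≤1+n c)) h))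
    (one (suc a) b c (ℕₚ.≤-trans (ℕₚ.+-monoʳ-≤ (suc a + b) (ℕₚ.n≤1+n c)) (shorten₂ {suc a} b (s≤s h))))
    (one a b c (ℕₚ.≤-trans (ℕₚ.+-monoʳ-≤ (a + b) (ℕₚ.n≤1+n c)) (drop₂ {a} b h)))

private
  headSum-reduce : ∀ m a b c (let h = λ x y z → altSum m (λ β → threeRow β x y z)) →
    headSum m (λ β → threeRow β a b c) ≡
    head (threeRow [] a b c) (column 1 h a b c) (column 2 h a b c) (column 3 h a b c)
  headSum-reduce = reduce head

headSum-one : ∀ m a → a ≤ m → headSum m (λ β → threeRow β (+ a) (+ 0) (+ 0)) ≡ + 1
-- Only the summand at the empty composition survives. It serves the case n = 3l, where (xyz)^l is
-- itself the monomial function of (l,l,l).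
headSum-one m zero    h = trans (headSum-reduce m (+ 0) (+ 0) (+ 0))
  (combine head H (+ 0) (+ 0) (+ 0) (n (fst below)) (n (snd below)) (n (thd below))
    (n (fst below)) (n (fst below)) (n (snd below)) (n (fst below)))
  where
  H : ℤ → ℤ → ℤ → ℤ
  H x y z = altSum m (λ β → threeRow β x y z)
  n : ∀ {x y z} → SomeNeg x y z → H x y z ≡ + 0
  n = altSum-neg m
headSum-one m (suc a) h = trans (headSum-reduce m (+ suc a) (+ 0) (+ 0))
  (combine head H (+ suc a) (+ 0) (+ 0)
    (altSum-threeRow m a 0 0 (ℕₚ.≤-trans (ℕₚ.≤-reflexive (trans (ℕₚ.+-identityʳ (a + 0)) (ℕₚ.+-identityʳ a)))
      (ℕₚ.≤-trans (ℕₚ.n≤1+n a) h)))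
    (n (snd below)) (n (thd below)) (n (snd below)) (n (thd below)) (n (snd below)) (n (snd below)))
  where
  H : ℤ → ℤ → ℤ → ℤ
  H x y z = altSum m (λ β → threeRow β x y z)
  n : ∀ {x y z} → SomeNeg x y z → H x y z ≡ + 0
  n = altSum-neg m

-- All nonnegative corners have the value 1, so the weights 1, -2, 3 give 2 - 2 = 0 if the third
-- exponent is 0, and 3 - 6 + 3 = 0 otherwise.
headSum-zero : ∀ m a b c → suc a + suc b + c ≤ m →
  headSum m (λ β → threeRow β (+ suc a) (+ suc b) (+ c)) ≡ + 0
headSum-zero m a b c h = trans (headSum-reduce m (+ suc a) (+ suc b) (+ c)) (go c h)
  where
  H : ℤ → ℤ → ℤ → ℤ
  H x y z = altSum m (λ β → threeRow β x y z)
  n : ∀ {x y z} → SomeNeg x y z → H x y z ≡ + 0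
  n = altSum-neg m
  one : ∀ a b c {t} → t ≤ m → a + b + c ≤ t → H (+ a) (+ b) (+ c) ≡ + 1
  one a b c t≤m h = altSum-threeRow m a b c (ℕₚ.≤-trans h t≤m)
  _⊕_ : ∀ {a b c d} → a ≤ b → c ≤ d → a + c ≤ b + d
  _⊕_ = ℕₚ.+-mono-≤
  up : ∀ {x} → x ≤ suc x
  up {x} = ℕₚ.n≤1+n x
  go : ∀ c → suc a + suc b + c ≤ m →
    head (threeRow [] (+ suc a) (+ suc b) (+ c)) (column 1 H (+ suc a) (+ suc b) (+ c))
      (column 2 H (+ suc a) (+ suc b) (+ c)) (column 3 H (+ suc a) (+ suc b) (+ c)) ≡ + 0
  go zero h = combine head H (+ suc a) (+ suc b) (+ 0)
    (one a (suc b) 0 h (up {a} ⊕ ℕₚ.≤-refl {suc b} ⊕ z≤n)) (one (suc a) b 0 h (ℕₚ.≤-refl {suc a} ⊕ up {b} ⊕ z≤n))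
    (n (thd below)) (one a b 0 h (up {a} ⊕ up {b} ⊕ z≤n)) (n (thd below)) (n (thd below)) (n (thd below))
  go (suc c) h = combine head H (+ suc a) (+ suc b) (+ suc c)
    (one a (suc b) (suc c) h (up {a} ⊕ ℕₚ.≤-refl {suc b} ⊕ ℕₚ.≤-refl {suc c}))
    (one (suc a) b (suc c) h (ℕₚ.≤-refl {suc a} ⊕ up {b} ⊕ ℕₚ.≤-refl {suc c}))
    (one (suc a) (suc b) c h (ℕₚ.≤-refl {suc a} ⊕ ℕₚ.≤-refl {suc b} ⊕ up {c}))
    (one a b (suc c) h (up {a} ⊕ up {b} ⊕ ℕₚ.≤-refl {suc c}))
    (one a (suc b) c h (up {a} ⊕ ℕₚ.≤-refl {suc b} ⊕ up {c}))
    (one (suc a) b c h (ℕₚ.≤-refl {suc a} ⊕ up {b} ⊕ up {c}))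
    (one a b c h (up {a} ⊕ up {b} ⊕ up {c}))
  infixl 6 _⊕_

private
  lower : ℕ → ℤ → ℤ
  lower zero    a = a
  lower (suc l) a = lower l (pr a)

  threeRow-triples : ∀ l β a b c →
    threeRow (replicate l 3 ++ β) a b c ≡ threeRow β (lower l a) (lower l b) (lower l c)
  threeRow-triples zero    β a b c = refl
  threeRow-triples (suc l) β a b c = threeRow-triples l β (pr a) (pr b) (pr c)

  lower-+ : ∀ l a → lower l (+ (l + a)) ≡ + a
  lower-+ zero    a = refl
  lower-+ (suc l) a = lower-+ l a

  lower-below : ∀ l {a} → a < l → Neg (lower l (+ a))
  lower-below (suc l) {zero}  h       = go l
    where
    go : ∀ l {n} → Neg (lower l -[1+ n ])
    go zero    = below
    go (suc l) = go l
  lower-below (suc l) {suc a} (s≤s h) = lower-below l h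

headSum-triples : ℕ → ℕ → ℕ → ℕ → ℕ → ℤ
headSum-triples m l a b c = headSum m (λ β → threeRow (replicate l 3 ++ β) (+ a) (+ b) (+ c))

private
  headSum-lower : ∀ m l a b c → headSum-triples m l a b c ≡
    headSum m (λ β → threeRow β (lower l (+ a)) (lower l (+ b)) (lower l (+ c)))
  headSum-lower m l a b c = congr (headSum-linear m) (λ β → threeRow-triples l β (+ a) (+ b) (+ c))

headSum-triples-one : ∀ m l a → a ≤ m → headSum-triples m l (l + a) l l ≡ + 1
headSum-triples-one m l a h = trans (headSum-lower m l (l + a) l l) (go (lower-+ l a) lower-0)
  where
  lower-0 : lower l (+ l) ≡ + 0
  lower-0 = trans (cong (λ x → lower l (+ x)) (sym (ℕₚ.+-identityʳ l))) (lower-+ l 0)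
  go : ∀ {x y} → x ≡ + a → y ≡ + 0 → headSum m (λ β → threeRow β x y y) ≡ + 1
  go refl refl = headSum-one m a h

-- The factor (xyz)^l lowers all exponents by l. Either the smallest becomes negative, or two of
-- them stay positive, since b = l would force c = l; power sums have no mixed monomials.
headSum-triples-zero : ∀ m l {a b c} → b ≤ a → c ≤ b → a + b + c ≤ m → ¬ ((b ≡ l) × (c ≡ l)) →
  headSum-triples m l a b c ≡ + 0
headSum-triples-zero m l {a} {b} {c} b≤a c≤b s≤m h with ℕₚ.<-≤-connex c l
... | inj₁ c<l = trans (headSum-lower m l a b c)
  (vanish (headSum-linear m) (λ β → threeRow-neg β {lower l (+ a)} {lower l (+ b)} (thd (lower-below l c<l))))
... | inj₂ l≤c with ℕₚ.m≤n⇒∃[o]m+o≡n l≤c | ℕₚ.m≤n⇒∃[o]m+o≡n (ℕₚ.≤-trans l≤c c≤b)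
                  | ℕₚ.m≤n⇒∃[o]m+o≡n (ℕₚ.≤-trans l≤c (ℕₚ.≤-trans c≤b b≤a))
...   | c′ , refl | b′ , refl | a′ , refl =
  trans (headSum-lower m l (l + a′) (l + b′) (l + c′))
    (go a′ b′ c′ (ℕₚ.+-cancelˡ-≤ l b′ a′ b≤a) (ℕₚ.+-cancelˡ-≤ l c′ b′ c≤b)
      (ℕₚ.≤-trans (ℕₚ.+-mono-≤ (ℕₚ.+-mono-≤ (ℕₚ.m≤n+m a′ l) (ℕₚ.m≤n+m b′ l)) (ℕₚ.m≤n+m c′ l)) s≤m)
      (λ (b≡ , c≡) → h (trans (cong (_+_ l) b≡) (ℕₚ.+-identityʳ l) , trans (cong (_+_ l) c≡) (ℕₚ.+-identityʳ l)))
      (lower-+ l a′) (lower-+ l b′) (lower-+ l c′))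
  where
  go : ∀ a b c → b ≤ a → c ≤ b → a + b + c ≤ m → ¬ ((b ≡ 0) × (c ≡ 0)) →
    ∀ {x y z} → x ≡ + a → y ≡ + b → z ≡ + c → headSum m (λ β → threeRow β x y z) ≡ + 0
  go a       zero    zero    b≤a c≤b s h refl refl refl = ⊥-elim (h (refl , refl))
  go (suc a) (suc b) c       b≤a c≤b s h refl refl refl = headSum-zero m a b c s

-- Partitions and the triangular system

data Part : ℕ → ℕ → List ℕ → Set where
  nil  : ∀ {k} → Part k 0 []
  cons : ∀ {k p m u} → 1 ≤ p → p ≤ k → Part p m u → Part k (p + m) (p ∷ u)

partitions-sound : ∀ f n k {u} → u ∈ partitionsLE f n k → Part k n u
partitions-sound zero    zero    k (here refl) = nil
partitions-sound (suc f) zero    k (here refl) = nil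
partitions-sound (suc f) (suc n) k u∈
  with find (∈ₚ.∈-concatMap⁻ (λ p → map (p ∷_) (partitionsLE f (suc n ∸ p) p))
         {xs = map suc (upTo (suc n ⊓ k))} u∈)
... | p , p∈ , u∈′ with ∈ₚ.∈-map⁻ suc p∈ | ∈ₚ.∈-map⁻ (p ∷_) u∈′
...   | i , i∈ , refl | v , v∈ , refl =
  subst (λ m → Part k m (suc i ∷ v)) (ℕₚ.m+[n∸m]≡n (ℕₚ.≤-trans i≤ (ℕₚ.m⊓n≤m (suc n) k)))
    (cons (s≤s z≤n) (ℕₚ.≤-trans i≤ (ℕₚ.m⊓n≤n (suc n) k))
      (partitions-sound f (suc n ∸ suc i) (suc i) v∈))
  where
  i≤ : suc i ≤ suc n ⊓ k
  i≤ = ∈ₚ.∈-upTo⁻ i∈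

partitions-complete : ∀ f k {n u} → Part k n u → n ≤ f → u ∈ partitionsLE f n k
partitions-complete zero    k nil n≤f = here refl
partitions-complete (suc f) k nil n≤f = here refl
partitions-complete zero    k (cons (s≤s _) _ _) ()
partitions-complete (suc f) k (cons {p = suc p} {m} {u} 1≤p p≤k π) (s≤s n≤f) =
  ∈ₚ.∈-concatMap⁺ (λ r → map (r ∷_) (partitionsLE f (suc (p + m) ∸ r) r))
    {xs = map suc (upTo (suc (p + m) ⊓ k))} (lose (∈ₚ.∈-map⁺ suc (∈ₚ.∈-upTo⁺ (ℕₚ.⊓-glb (s≤s (ℕₚ.m≤m+n p m)) p≤k)))
      (∈ₚ.∈-map⁺ (suc p ∷_) (subst (λ x → u ∈ partitionsLE f x (suc p)) (sym (ℕₚ.m+n∸m≡n p m))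
        (partitions-complete f (suc p) π (ℕₚ.≤-trans (ℕₚ.m≤n+m m p) n≤f)))))

-- Lexicographic order; partitions of the same number are never proper prefixes of each other.
infix 4 _⊏_
data _⊏_ : List ℕ → List ℕ → Set where
  this : ∀ {p q u v} → p < q → (p ∷ u) ⊏ (q ∷ v)
  next : ∀ {p u v} → u ⊏ v → (p ∷ u) ⊏ (p ∷ v)

⊏⇒≢ : ∀ {u v} → u ⊏ v → u ≢ v
⊏⇒≢ (this p<q) refl = ℕₚ.<-irrefl refl p<q
⊏⇒≢ (next u⊏v) refl = ⊏⇒≢ u⊏v refl

concatMap-increasing : {R : B → B → Set} {Q : A → A → Set} (g : A → List B) →
  (∀ x → AllPairs R (g x)) → (∀ {x y} → Q x y → All (λ u → All (R u) (g y)) (g x)) →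
  ∀ {xs} → AllPairs Q xs → AllPairs R (concatMap g xs)
concatMap-increasing g within between {xs} q =
  AllPairsₚ.concat⁺ (Allₚ.map⁺ (All.universal within xs)) (AllPairsₚ.map⁺ (AllPairs.map between q))

partitions-increasing : ∀ f n k → AllPairs _⊏_ (partitionsLE f n k)
partitions-increasing zero    zero    k = [] ∷ []
partitions-increasing (suc f) zero    k = [] ∷ []
partitions-increasing zero    (suc n) k = []
partitions-increasing (suc f) (suc n) k = concatMap-increasing {Q = _<_}
  (λ p → map (p ∷_) (partitionsLE f (suc n ∸ p) p))
  (λ p → AllPairsₚ.map⁺ (AllPairs.map next (partitions-increasing f (suc n ∸ p) p)))
  (λ {p} {q} p<q → Allₚ.map⁺ (All.universal (λ u → Allₚ.map⁺ (All.universal (λ v → this p<q)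
    (partitionsLE f (suc n ∸ q) q))) (partitionsLE f (suc n ∸ p) p)))
  (AllPairsₚ.map⁺ (AllPairsₚ.applyUpTo⁺₁ (λ i → i) (suc n ⊓ k) (λ i<j _ → s≤s i<j)))

pad : List ℕ → Maybe (ℕ × ℕ × ℕ)
pad []                  = just (0 , 0 , 0)
pad (a ∷ [])            = just (a , 0 , 0)
pad (a ∷ b ∷ [])        = just (a , b , 0)
pad (a ∷ b ∷ c ∷ [])    = just (a , b , c)
pad (_ ∷ _ ∷ _ ∷ _ ∷ _) = nothing

-- The coefficient of x^β in e_u, set to 0 when u has more than three parts.
rows : List ℕ → List ℕ → ℤ
rows u β = maybe (λ (a , b , c) → threeRow β (+ a) (+ b) (+ c)) (+ 0) (pad u)

-- The conjugate partition, when u has at most three parts.  Otherwise a point at which all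
-- coefficient functions considered below vanish.
dual : List ℕ → List ℕ
dual u = maybe (λ (a , b , c) → point c (b ∸ c) (a ∸ b)) (4 ∷ []) (pad u)

pad-sorted : ∀ {k n u a b c} → Part k n u → pad u ≡ just (a , b , c) →
  (b ≤ a) × (c ≤ b) × (a + b + c ≡ n)
pad-sorted nil refl = z≤n , z≤n , refl
pad-sorted (cons {p = a} _ _ nil) refl = z≤n , z≤n , ℕₚ.+-identityʳ (a + 0)
pad-sorted (cons {p = a} _ _ (cons {p = b} _ b≤a nil)) refl =
  b≤a , z≤n , ℕₚ.+-assoc a b 0
pad-sorted (cons {p = a} _ _ (cons {p = b} _ b≤a (cons {p = c} _ c≤b nil))) refl =
  b≤a , c≤b , trans (ℕₚ.+-assoc a b c) (cong (λ x → a + (b + x)) (sym (ℕₚ.+-identityʳ c)))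
pad-sorted (cons _ _ (cons _ _ (cons _ _ (cons _ _ _)))) ()

-- If the first two entries agree, the equal sums make the third agree as well, so the increase has
-- to occur earlier.
pad-increasing : ∀ {u v a b c a′ b′ c′} → u ⊏ v →
  pad u ≡ just (a , b , c) → pad v ≡ just (a′ , b′ , c′) → a + b + c ≡ a′ + b′ + c′ →
  (a < a′) ⊎ ((a ≡ a′) × (b < b′))
pad-increasing {p ∷ u} {q ∷ v} (this p<q) eu ev s with first u eu | first v ev
  where
  first : ∀ {p a b c} u → pad (p ∷ u) ≡ just (a , b , c) → p ≡ a
  first []          refl = refl
  first (_ ∷ [])    refl = refl
  first (_ ∷ _ ∷ []) refl = refl
... | refl | refl = inj₁ p<q
pad-increasing {_ ∷ p ∷ u} {_ ∷ q ∷ v} (next (this p<q)) eu ev s with second u eu | second v ev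
  where
  second : ∀ {o p a b c} u → pad (o ∷ p ∷ u) ≡ just (a , b , c) → (o ≡ a) × (p ≡ b)
  second []       refl = refl , refl
  second (_ ∷ []) refl = refl , refl
... | refl , refl | refl , refl = inj₂ (refl , p<q)
pad-increasing {a ∷ b ∷ c ∷ []} {_ ∷ _ ∷ c′ ∷ []} (next (next (this c<c′))) refl refl s =
  ⊥-elim (ℕₚ.<-irrefl (ℕₚ.+-cancelˡ-≡ (a + b) c c′ s) c<c′)

sumBy-++ : (f : A → ℕ) (xs ys : List A) → sumBy f (xs ++ ys) ≡ sumBy f xs + sumBy f ys
sumBy-++ f []       ys = refl
sumBy-++ f (x ∷ xs) ys = trans (cong (_+_ (f x)) (sumBy-++ f xs ys)) (sym (ℕₚ.+-assoc (f x) _ _))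

sumBy-replicate : (f : A → ℕ) (n : ℕ) (x : A) → sumBy f (replicate n x) ≡ n * f x
sumBy-replicate f zero    x = refl
sumBy-replicate f (suc n) x = cong (_+_ (f x)) (sumBy-replicate f n x)

sumBy-point : (f : ℕ → ℕ) → ∀ i j k → sumBy f (point i j k) ≡ i * f 3 + (j * f 2 + k * f 1)
sumBy-point f i j k = trans (sumBy-++ f (replicate i 3) _) (cong₂ _+_ (sumBy-replicate f i 3)
  (trans (sumBy-++ f (replicate j 2) _) (cong₂ _+_ (sumBy-replicate f j 2) (sumBy-replicate f k 1))))

-- The conjugate of u = (a,b,c) has a columns, which meet the first two rows in a + b cells. A
-- larger first part of v exceeds the first number; an equal first and larger second part exceeds
-- the other.
rows-triangular : ∀ {n u v} → Part n n u → Part n n v → u ⊏ v → rows v (dual u) ≡ + 0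
rows-triangular {n} {u} {v} πu πv u⊏v with pad u in eu | pad v in ev
... | _       | nothing = refl
... | nothing | just _  = refl
... | just (a , b , c) | just (a′ , b′ , c′)
  with pad-sorted πu eu | pad-sorted πv ev
...   | b≤a , c≤b , s | _ , _ , s′
  with ℕₚ.m≤n⇒∃[o]m+o≡n c≤b | ℕₚ.m≤n⇒∃[o]m+o≡n b≤a | pad-increasing u⊏v eu ev (trans s (sym s′))
...     | j , refl | k , refl | inj₁ a<a′ = threeRow-vanish first-descending (point c (c + j ∸ c) (c + j + k ∸ (c + j)))
  (pos (subst (_< a′) (sym (trans (sumBy-point (_⊓ 1) c (c + j ∸ c) (c + j + k ∸ (c + j))) size)) a<a′))
  where
  open +-*-Solver
  size : c * 1 + ((c + j ∸ c) * 1 + (c + j + k ∸ (c + j)) * 1) ≡ c + j + k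
  size rewrite ℕₚ.m+n∸m≡n c j | ℕₚ.m+n∸m≡n (c + j) k =
    solve 3 (λ c j k → c :* con 1 :+ (j :* con 1 :+ k :* con 1) := c :+ j :+ k) refl c j k
...     | j , refl | k , refl | inj₂ (refl , b<b′) = threeRow-vanish firstTwo-descending (point c (c + j ∸ c) (c + j + k ∸ (c + j)))
  (pos (subst (_< c + j + k + b′)
    (sym (trans (sumBy-point (_⊓ 2) c (c + j ∸ c) (c + j + k ∸ (c + j))) size)) (ℕₚ.+-monoʳ-< (c + j + k) b<b′)))
  where
  open +-*-Solver
  size : c * 2 + ((c + j ∸ c) * 2 + (c + j + k ∸ (c + j)) * 1) ≡ c + j + k + (c + j)
  size rewrite ℕₚ.m+n∸m≡n c j | ℕₚ.m+n∸m≡n (c + j) k =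
    solve 3 (λ c j k → c :* con 2 :+ (j :* con 2 :+ k :* con 1) := c :+ j :+ k :+ (c :+ j)) refl c j k

-- Solving f = Σ c_u E_u when the matrix (E_v (p u))_{u,v} is unitriangular.
module Triangular (E : List ℕ → List ℕ → ℤ) (p : List ℕ → List ℕ) where

  private
    _≟_ = Listₚ.≡-dec ℕₚ._≟_

    eliminate : List ℕ → (List ℕ → ℤ) → List ℕ → ℤ
    eliminate u f β = f β -ℤ f (p u) *ℤ E u β

  residual : List (List ℕ) → (List ℕ → ℤ) → List ℕ → ℤ
  residual []       f = f
  residual (u ∷ us) f = residual us (eliminate u f)

  coefficient : List (List ℕ) → (List ℕ → ℤ) → List ℕ → ℤ
  coefficient []       f v = + 0
  coefficient (u ∷ us) f v = if does (v ≟ u) then f (p u) else coefficient us (eliminate u f) v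

  private
    coefficient-here : ∀ u us f → coefficient (u ∷ us) f u ≡ f (p u)
    coefficient-here u us f with u ≟ u
    ... | yes _ = refl
    ... | no ≢u = ⊥-elim (≢u refl)

    coefficient-there : ∀ {u v} us f → u ≢ v → coefficient (u ∷ us) f v ≡ coefficient us (eliminate u f) v
    coefficient-there {u} {v} us f u≢v with v ≟ u
    ... | yes v≡u = ⊥-elim (u≢v (sym v≡u))
    ... | no _    = refl

    ∑-cong-∈ : {xs : List A} {f g : A → ℤ} → All (λ x → f x ≡ g x) xs → ∑ xs f ≡ ∑ xs g
    ∑-cong-∈ []       = refl
    ∑-cong-∈ (h ∷ hs) = cong₂ _+ℤ_ h (∑-cong-∈ hs)

  expansion : ∀ us → AllPairs _≢_ us → ∀ f β →
    f β ≡ ∑ us (λ u → coefficient us f u *ℤ E u β) +ℤ residual us f β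
  expansion []       []         f β = sym (ℤₚ.+-identityˡ (f β))
  expansion (u ∷ us) (u≢ ∷ us≢) f β = begin
    f β
      ≡⟨ split (f β) (f (p u) *ℤ E u β) ⟩
    f (p u) *ℤ E u β +ℤ eliminate u f β
      ≡⟨ cong (f (p u) *ℤ E u β +ℤ_) (expansion us us≢ (eliminate u f) β) ⟩
    f (p u) *ℤ E u β +ℤ (∑ us (λ v → coefficient us (eliminate u f) v *ℤ E v β) +ℤ residual us (eliminate u f) β)
      ≡⟨ sym (ℤₚ.+-assoc (f (p u) *ℤ E u β) _ _) ⟩
    (f (p u) *ℤ E u β +ℤ ∑ us (λ v → coefficient us (eliminate u f) v *ℤ E v β)) +ℤ residual us (eliminate u f) β
      ≡⟨ cong (_+ℤ residual us (eliminate u f) β) (sym (cong₂ _+ℤ_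
           (cong (_*ℤ E u β) (coefficient-here u us f))
           (∑-cong-∈ (All.map (λ {v} u≢v → cong (_*ℤ E v β) (coefficient-there us f u≢v)) u≢)))) ⟩
    ∑ (u ∷ us) (λ v → coefficient (u ∷ us) f v *ℤ E v β) +ℤ residual (u ∷ us) f β ∎
    where
    open ≡-Reasoning
    split : ∀ x y → x ≡ y +ℤ (x -ℤ y)
    split = solve-∀

  residual-vanish : ∀ us {f β} → f β ≡ + 0 → All (λ u → E u β ≡ + 0) us → residual us f β ≡ + 0
  residual-vanish []       h []       = h
  residual-vanish (u ∷ us) {f} {β} h (e ∷ es) = residual-vanish us
    (cong₂ _-ℤ_ h (trans (cong (f (p u) *ℤ_) e) (ℤₚ.*-zeroʳ (f (p u))))) es

  residual-cong : ∀ us {f β γ} → f β ≡ f γ → (∀ u → E u β ≡ E u γ) → residual us f β ≡ residual us f γ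
  residual-cong []       h e = h
  residual-cong (u ∷ us) {f} h e = residual-cong us (cong₂ _-ℤ_ h (cong (f (p u) *ℤ_) (e u))) e

  -- The step for `v` makes the value at `p v` zero, and the later steps subtract multiples of
  -- functions that vanish there. The order of the list matters for this reason.
  residual-pivot : ∀ us → AllPairs (λ u v → E v (p u) ≡ + 0) us → ∀ {v f} → v ∈ us → E v (p v) ≡ + 1 →
    residual us f (p v) ≡ + 0
  residual-pivot (u ∷ us) (t ∷ ts) {v} {f} (here refl) h = residual-vanish us
    (trans (cong (λ x → f (p u) -ℤ f (p u) *ℤ x) h) (cancel (f (p u)))) t
    where
    cancel : ∀ x → x -ℤ x *ℤ + 1 ≡ + 0
    cancel = solve-∀
  residual-pivot (u ∷ us) (t ∷ ts) (there v∈) h = residual-pivot us ts v∈ h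

  coefficient-zero : ∀ us {f} v → (∀ β → f β ≡ + 0) → coefficient us f v ≡ + 0
  coefficient-zero []       v h = refl
  coefficient-zero (u ∷ us) v h with does (v ≟ u)
  ... | true  = h (p u)
  ... | false = coefficient-zero us v (λ β → cong₂ (λ x y → x -ℤ y *ℤ E u β) (h β) (h (p u)))

  -- This connects elimination with duality: positivity of a coefficient can be proved for `L f`,
  -- without following the elimination.
  evaluate : ∀ us → AllPairs _≢_ us → ∀ {L : (List ℕ → ℤ) → ℤ} → Linear L → ∀ {f} →
    (∀ β → residual us f β ≡ + 0) → ∀ {v} → v ∈ us → L (E v) ≡ + 1 →
    (∀ {u} → u ∈ us → u ≢ v → L (E u) ≡ + 0) → L f ≡ coefficient us f v
  evaluate us us≢ {L} l {f} r {v} v∈ one zeros = begin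
    L f
      ≡⟨ congr l (λ β → trans (expansion us us≢ f β) (trans (cong (sum β +ℤ_) (r β)) (ℤₚ.+-identityʳ (sum β)))) ⟩
    L (λ β → ∑ us (λ u → coefficient us f u *ℤ E u β))
      ≡⟨ ∑-comm l us (λ u β → coefficient us f u *ℤ E u β) ⟩
    ∑ us (λ u → L (λ β → coefficient us f u *ℤ E u β))
      ≡⟨ congr (∑-linear us) (λ u → scale l (coefficient us f u) (E u)) ⟩
    ∑ us (λ u → coefficient us f u *ℤ L (E u))
      ≡⟨ single us us≢ v∈ (λ {u} u∈ u≢v → trans (cong (coefficient us f u *ℤ_) (zeros u∈ u≢v))
           (ℤₚ.*-zeroʳ (coefficient us f u))) ⟩
    coefficient us f v *ℤ L (E v)
      ≡⟨ trans (cong (coefficient us f v *ℤ_) one) (ℤₚ.*-identityʳ _) ⟩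
    coefficient us f v ∎
    where
    open ≡-Reasoning
    sum : List ℕ → ℤ
    sum β = ∑ us (λ u → coefficient us f u *ℤ E u β)
    single : ∀ ws {g : List ℕ → ℤ} → AllPairs _≢_ ws → v ∈ ws → (∀ {u} → u ∈ ws → u ≢ v → g u ≡ + 0) →
      ∑ ws g ≡ g v
    single (u ∷ ws) {g} (u≢ ∷ ws≢) (here refl) h = trans
      (cong (g u +ℤ_) (trans (∑-cong-∈ (All.tabulate (λ w∈ → h (there w∈) (λ w≡u → All.lookup u≢ w∈ (sym w≡u)))))
        (zer (∑-linear ws))))
      (ℤₚ.+-identityʳ (g u))
    single (u ∷ ws) {g} (u≢ ∷ ws≢) (there v∈) h = trans
      (cong₂ _+ℤ_ (h (here refl) (All.lookup u≢ v∈)) (single ws ws≢ v∈ (λ w∈ → h (there w∈))))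
      (ℤₚ.+-identityˡ (g v))

-- Expansion of symmetric functions with exponents at most 3

open Triangular rows dual

-- These are the coefficients of a symmetric function of degree n with all exponents at most 3. Such
-- functions are spanned by the e_u with at most three parts.
record HeightThree (n : ℕ) (f : List ℕ → ℤ) : Set where
  field
    drop-zero : ∀ β → f (0 ∷ β) ≡ f β
    permute   : ∀ {β γ} → β ↭ γ → f β ≡ f γ
    wide      : ∀ β → Any (4 ≤_) β → f β ≡ + 0
    degree    : ∀ β → sumBy (λ m → m) β ≢ n → f β ≡ + 0

rows-drop-zero : ∀ u β → rows u (0 ∷ β) ≡ rows u β
rows-drop-zero u β with pad u
... | just _  = refl
... | nothing = refl

rows-↭ : ∀ u {β γ} → β ↭ γ → rows u β ≡ rows u γ
rows-↭ u p with pad u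
... | just (a , b , c) = threeRow-↭ p (+ a) (+ b) (+ c)
... | nothing          = refl

rows-wide : ∀ u β → Any (4 ≤_) β → rows u β ≡ + 0
rows-wide u β h with pad u
... | just (a , b , c) = threeRow-wide β h (+ a) (+ b) (+ c)
... | nothing          = refl

rows-degree : ∀ {n u} → Part n n u → ∀ β → sumBy (λ m → m) β ≢ n → rows u β ≡ + 0
rows-degree {u = u} π β h with pad u in eu
... | nothing          = refl
... | just (a , b , c) with pad-sorted π eu
...   | _ , _ , refl = threeRow-vanish degree-descending β (λ e → h (sym (ℤₚ.+-injective e)))

rows-dual : ∀ {n u a b c} → Part n n u → pad u ≡ just (a , b , c) → rows u (dual u) ≡ + 1
rows-dual π eu with pad-sorted π eu
... | b≤a , c≤b , _ = trans (cong atDual eu) (go b≤a c≤b)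
  where
  atDual : Maybe (ℕ × ℕ × ℕ) → ℤ
  atDual t = maybe (λ (a , b , c) →
    threeRow (maybe (λ (a , b , c) → point c (b ∸ c) (a ∸ b)) (4 ∷ []) t) (+ a) (+ b) (+ c)) (+ 0) t
  go : ∀ {a b c} → b ≤ a → c ≤ b → atDual (just (a , b , c)) ≡ + 1
  go {c = c} b≤a c≤b with ℕₚ.m≤n⇒∃[o]m+o≡n c≤b | ℕₚ.m≤n⇒∃[o]m+o≡n b≤a
  ... | j , refl | k , refl rewrite ℕₚ.m+n∸m≡n c j | ℕₚ.m+n∸m≡n (c + j) k = threeRow-point c j k

-- The partition is the conjugate of 3^i 2^j 1^k; the four cases only decide how many zero parts
-- have to be omitted.
partition-of-point : ∀ i j k → ∃ λ u → Part (i * 3 + (j * 2 + k * 1)) (i * 3 + (j * 2 + k * 1)) u ×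
  (pad u ≡ just (i + j + k , i + j , i))
partition-of-point = go
  where
  open +-*-Solver
  sum : ∀ i j k → (i + j + k) + ((i + j) + (i + 0)) ≡ i * 3 + (j * 2 + k * 1)
  sum = solve 3 (λ i j k → (i :+ j :+ k) :+ ((i :+ j) :+ (i :+ con 0)) :=
    i :* con 3 :+ (j :* con 2 :+ k :* con 1)) refl
  top : ∀ {p m u} → 1 ≤ p → Part p m u → Part (p + m) (p + m) (p ∷ u)
  top {p} {m} 1≤p π = cons 1≤p (ℕₚ.m≤m+n p m) π
  go : ∀ i j k → ∃ λ u → Part (i * 3 + (j * 2 + k * 1)) (i * 3 + (j * 2 + k * 1)) u ×
    (pad u ≡ just (i + j + k , i + j , i))
  go (suc i) j k = a ∷ b ∷ suc i ∷ [] , subst (λ n → Part n n (a ∷ b ∷ suc i ∷ [])) (sum (suc i) j k)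
    (top (s≤s z≤n) (cons (s≤s z≤n) (ℕₚ.m≤m+n b k)
      (cons (s≤s z≤n) (ℕₚ.m≤m+n (suc i) j) nil))) , refl
    where
    a b : ℕ
    a = suc i + j + k
    b = suc i + j
  go zero (suc j) k = suc (j + k) ∷ suc j ∷ [] ,
    subst (λ n → Part n n (suc (j + k) ∷ suc j ∷ [])) (sum 0 (suc j) k)
      (top (s≤s z≤n) (cons (s≤s z≤n) (s≤s (ℕₚ.m≤m+n j k)) nil)) , refl
  go zero zero (suc k) = suc k ∷ [] , subst (λ n → Part n n (suc k ∷ [])) (sum 0 0 (suc k))
    (top (s≤s z≤n) nil) , refl
  go zero zero zero = [] , nil , refl

-- Zeros are dropped and the entries 1, 2, 3 are moved one at a time into the sorted tail
-- `point i j k`.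
vanish-at-points : (r : List ℕ → ℤ) → (∀ β → r (0 ∷ β) ≡ r β) → (∀ {β γ} → β ↭ γ → r β ≡ r γ) →
  (∀ β → Any (4 ≤_) β → r β ≡ + 0) → (∀ i j k → r (point i j k) ≡ + 0) → ∀ β → r β ≡ + 0
vanish-at-points r drop permute wide points β = trans (permute (↭-sym (Permₚ.++-identityʳ β))) (go β 0 0 0)
  where
  go : ∀ β i j k → r (β ++ point i j k) ≡ + 0
  go []      i j k = points i j k
  go (0 ∷ β) i j k = trans (drop (β ++ point i j k)) (go β i j k)
  go (1 ∷ β) i j k = trans (permute (↭-trans (↭-sym (Permₚ.shift 1 β (point i j k)))
    (Permₚ.++⁺ˡ β (↭-trans (↭-sym (Permₚ.shift 1 (replicate i 3) (replicate j 2 ++ replicate k 1)))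
      (Permₚ.++⁺ˡ (replicate i 3) (↭-sym (Permₚ.shift 1 (replicate j 2) (replicate k 1))))))))
    (go β i j (suc k))
  go (2 ∷ β) i j k = trans (permute (↭-trans (↭-sym (Permₚ.shift 2 β (point i j k)))
    (Permₚ.++⁺ˡ β (↭-sym (Permₚ.shift 2 (replicate i 3) (replicate j 2 ++ replicate k 1))))))
    (go β i (suc j) k)
  go (3 ∷ β) i j k = trans (permute (↭-sym (Permₚ.shift 3 β (point i j k)))) (go β (suc i) j k)
  go (suc (suc (suc (suc b))) ∷ β) i j k = wide _ (here (s≤s (s≤s (s≤s (s≤s z≤n)))))

module _ (n : ℕ) where

  private
    us : List (List ℕ)
    us = partitions n

    part : ∀ {u} → u ∈ us → Part n n u
    part = partitions-sound n n n

    all-parts : ∀ {P : List ℕ → Set} → (∀ {u} → Part n n u → P u) → All P us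
    all-parts h = All.tabulate (λ u∈ → h (part u∈))

  distinct : AllPairs _≢_ us
  distinct = AllPairs.map ⊏⇒≢ (partitions-increasing n n n)

  triangular : AllPairs (λ u v → rows v (dual u) ≡ + 0) us
  triangular = go us (λ u∈ → u∈) (partitions-increasing n n n)
    where
    go : ∀ vs → (∀ {u} → u ∈ vs → u ∈ us) → AllPairs _⊏_ vs → AllPairs (λ u v → rows v (dual u) ≡ + 0) vs
    go []       sub []       = []
    go (u ∷ vs) sub (h ∷ hs) = All.tabulate (λ v∈ →
        rows-triangular (part (sub (here refl))) (part (sub (there v∈))) (All.lookup h v∈))
      ∷ go vs (λ v∈ → sub (there v∈)) hs

  -- The remainder inherits the four properties, so only sorted words matter, and those of degree n
  -- are exactly pivots `dual u`.
  residual-zero : ∀ {f} → HeightThree n f → ∀ β → residual us f β ≡ + 0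
  residual-zero {f} H = vanish-at-points (residual us f)
    (λ β → residual-cong us (drop-zero β) (λ u → rows-drop-zero u β))
    (λ p → residual-cong us (permute p) (λ u → rows-↭ u p))
    (λ β w → residual-vanish us (wide β w) (all-parts (λ {u} _ → rows-wide u β w)))
    points
    where
    open HeightThree H
    points : ∀ i j k → residual us f (point i j k) ≡ + 0
    points i j k with (i * 3 + (j * 2 + k * 1)) ℕₚ.≟ n
    ... | no ≢n = residual-vanish us (degree (point i j k) (λ e → ≢n (trans (sym (sumBy-point (λ m → m) i j k)) e)))
      (all-parts (λ π → rows-degree π (point i j k) (λ e → ≢n (trans (sym (sumBy-point (λ m → m) i j k)) e))))
    ... | yes refl with partition-of-point i j k
    ...   | u , π , eu = subst (λ β → residual us f β ≡ + 0) dual-u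
      (residual-pivot us triangular (partitions-complete n n π ℕₚ.≤-refl) (rows-dual π eu))
      where
      dual-u : dual u ≡ point i j k
      dual-u rewrite eu | ℕₚ.m+n∸m≡n i j | ℕₚ.m+n∸m≡n (i + j) k = refl

  -- The coefficient at (n-2l, l, l)

  module _ (l : ℕ) (1≤n : 1 ≤ n) (l≤ : l + l + l ≤ n) where

    private
      rest : ∃ λ m → l + l + l + m ≡ n
      rest = ℕₚ.m≤n⇒∃[o]m+o≡n l≤

      m : ℕ
      m = proj₁ rest

      first-part : l + m ≡ n ∸ (l + l)
      first-part = trans (sym (ℕₚ.m+n∸m≡n (l + l) (l + m)))
        (cong (_∸ (l + l)) (trans (sym (ℕₚ.+-assoc (l + l) l m)) (proj₂ rest)))

      m≤n : m ≤ n
      m≤n = subst (m ≤_) (proj₂ rest) (ℕₚ.m≤n+m m (l + l + l))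

    pad-hookish : pad (hookish n l) ≡ just (l + m , l , l)
    pad-hookish = go l first-part
      where
      go : ∀ l → l + m ≡ n ∸ (l + l) → pad (hookish n l) ≡ just (l + m , l , l)
      go zero    e = cong (λ x → just (x , 0 , 0)) (sym e)
      go (suc l) e = cong (λ x → just (x , suc l , suc l)) (sym e)

    hookish-∈ : hookish n l ∈ us
    hookish-∈ = partitions-complete n n (go l l≤ first-part) ℕₚ.≤-refl
      where
      go : ∀ l → l + l + l ≤ n → l + m ≡ n ∸ (l + l) → Part n n (hookish n l)
      go zero    h e = subst (λ x → Part n x (n ∷ [])) (ℕₚ.+-identityʳ n) (cons 1≤n ℕₚ.≤-refl nil)
      go (suc l) h e = subst (λ x → Part n x (hookish n (suc l)))
        (trans (cong (λ x → n ∸ (suc l + suc l) + (suc l + x)) (ℕₚ.+-identityʳ (suc l)))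
          (ℕₚ.m∸n+n≡m (ℕₚ.≤-trans (ℕₚ.m≤m+n (suc l + suc l) (suc l)) h)))
        (cons (ℕₚ.≤-trans (s≤s z≤n) sl≤) (ℕₚ.m∸n≤m n (suc l + suc l))
          (cons (s≤s z≤n) sl≤ (cons (s≤s z≤n) ℕₚ.≤-refl nil)))
        where
        sl≤ : suc l ≤ n ∸ (suc l + suc l)
        sl≤ = subst (suc l ≤_) e (ℕₚ.m≤m+n (suc l) m)

    hookish-unique : ∀ {u a} → Part n n u → pad u ≡ just (a , l , l) → u ≡ hookish n l
    hookish-unique π eu = go l π eu
      where
      go : ∀ l {u a} → Part n n u → pad u ≡ just (a , l , l) → u ≡ hookish n l
      go zero    nil refl = ⊥-elim (ℕₚ.<-irrefl refl 1≤n)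
      go zero    (cons {p = a} _ _ nil) refl = cong (_∷ []) (sym (ℕₚ.+-identityʳ a))
      go zero    (cons _ _ (cons () _ nil)) refl
      go zero    (cons _ _ (cons _ _ (cons () _ nil))) refl
      go zero    (cons _ _ (cons _ _ (cons _ _ (cons _ _ _)))) ()
      go (suc l) (cons _ _ (cons _ _ (cons _ _ (cons _ _ _)))) ()
      go (suc l) (cons {p = a} _ _ (cons _ _ (cons _ _ nil))) refl = cong (_∷ suc l ∷ suc l ∷ []) (sym
        (trans (cong (λ x → a + (suc l + x) ∸ (suc l + suc l)) (ℕₚ.+-identityʳ (suc l)))
          (ℕₚ.m+n∸n≡m a (suc l + suc l))))

    hookFunctional : (List ℕ → ℤ) → ℤ
    hookFunctional f = headSum n (λ β → f (replicate l 3 ++ β))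

    hookFunctional-coefficient : ∀ {f} → HeightThree n f → hookFunctional f ≡ coefficient us f (hookish n l)
    hookFunctional-coefficient H = evaluate us distinct (pull-linear (replicate l 3 ++_) (headSum-linear n))
      (residual-zero H) hookish-∈ one zeros
      where
      one : hookFunctional (rows (hookish n l)) ≡ + 1
      one rewrite pad-hookish = headSum-triples-one n l m m≤n
      zeros : ∀ {u} → u ∈ us → u ≢ hookish n l → hookFunctional (rows u) ≡ + 0
      zeros {u} u∈ u≢ with pad u in eu
      ... | nothing = zer (headSum-linear n)
      ... | just (a , b , c) with pad-sorted (part u∈) eu
      ...   | b≤a , c≤b , s = headSum-triples-zero n l b≤a c≤b (ℕₚ.≤-reflexive s)
        (λ { (refl , refl) → u≢ (hookish-unique (part u∈) eu) })

-- Coefficients of the e_u as lists of terms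

private
  term-hit : {N : ℕ} → Vec ℕ N → ℕ → Term N → ℤ
  term-hit α k (a , i , u) = ⟦ (i ≡ᵇ k) ∧ vecEqᵇ u α ⟧ a

coeffOf-∑ : {N : ℕ} (ts : List (Term N)) (α : Vec ℕ N) (k : ℕ) → coeffOf ts α k ≡ ∑ ts (term-hit α k)
coeffOf-∑ ts α k = trans (∑-filter _ ts _) (congr (∑-linear ts) (λ { (a , i , u) → refl }))

coeffOf-++ : {N : ℕ} (xs ys : List (Term N)) (α : Vec ℕ N) (k : ℕ) →
  coeffOf (xs ++ ys) α k ≡ coeffOf xs α k +ℤ coeffOf ys α k
coeffOf-++ xs ys α k = trans (coeffOf-∑ (xs ++ ys) α k) (trans (∑-++ xs ys (term-hit α k))
  (sym (cong₂ _+ℤ_ (coeffOf-∑ xs α k) (coeffOf-∑ ys α k))))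

coeffOf-concatMap : {N : ℕ} (g : A → List (Term N)) (xs : List A) (α : Vec ℕ N) (k : ℕ) →
  coeffOf (concatMap g xs) α k ≡ ∑ xs (λ x → coeffOf (g x) α k)
coeffOf-concatMap g xs α k = trans (coeffOf-∑ (concatMap g xs) α k) (trans (∑-concatMap g xs (term-hit α k))
  (congr (∑-linear xs) (λ x → sym (coeffOf-∑ (g x) α k))))

private
  indicator-shift : ∀ w a k z → ⟦ w + a ≡ᵇ k ⟧ z ≡ shift w (λ k → ⟦ a ≡ᵇ k ⟧ z) k
  indicator-shift zero    a k       z = refl
  indicator-shift (suc w) a zero    z = refl
  indicator-shift (suc w) a (suc k) z = indicator-shift w a k z

raise : {N : ℕ} → ℤ → ℕ → Term N → Term N
raise c j (a , i , u) = (c *ℤ a , i + j , u)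

coeffOf-scale : {N : ℕ} (c : ℤ) (j : ℕ) (ts : List (Term N)) (α : Vec ℕ N) (k : ℕ) →
  coeffOf (map (raise c j) ts) α k ≡
  shift j (λ k → c *ℤ coeffOf ts α k) k
coeffOf-scale {N} c j ts α k = begin
  coeffOf (map (raise c j) ts) α k
    ≡⟨ trans (coeffOf-∑ (map (raise c j) ts) α k) (∑-map (raise c j) ts (term-hit α k)) ⟩
  ∑ ts (λ t → term-hit α k (raise c j t))
    ≡⟨ congr (∑-linear ts) (λ { (a , i , u) → scaled a i u }) ⟩
  ∑ ts (λ t → shift j (λ k → c *ℤ term-hit α k t) k)
    ≡⟨ shift-comm (∑-linear ts) j (λ t k → c *ℤ term-hit α k t) k ⟩
  shift j (λ k → ∑ ts (λ t → c *ℤ term-hit α k t)) k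
    ≡⟨ congr (shift-linear j k) (λ k → trans (scale (∑-linear ts) c (term-hit α k))
         (cong (c *ℤ_) (sym (coeffOf-∑ ts α k)))) ⟩
  shift j (λ k → c *ℤ coeffOf ts α k) k ∎
  where
  open ≡-Reasoning
  scaled : ∀ a i u → ⟦ (i + j ≡ᵇ k) ∧ vecEqᵇ u α ⟧ (c *ℤ a) ≡
    shift j (λ k → c *ℤ ⟦ (i ≡ᵇ k) ∧ vecEqᵇ u α ⟧ a) k
  scaled a i u = begin
    ⟦ (i + j ≡ᵇ k) ∧ vecEqᵇ u α ⟧ (c *ℤ a)
      ≡⟨ ⟦⟧-∧ (i + j ≡ᵇ k) (vecEqᵇ u α) (c *ℤ a) ⟩
    ⟦ i + j ≡ᵇ k ⟧ ⟦ vecEqᵇ u α ⟧ (c *ℤ a)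
      ≡⟨ trans (cong (λ s → ⟦ s ≡ᵇ k ⟧ ⟦ vecEqᵇ u α ⟧ (c *ℤ a)) (ℕₚ.+-comm i j)) (indicator-shift j i k _) ⟩
    shift j (λ k → ⟦ i ≡ᵇ k ⟧ ⟦ vecEqᵇ u α ⟧ (c *ℤ a)) k
      ≡⟨ congr (shift-linear j k) (λ k → trans (sym (⟦⟧-∧ (i ≡ᵇ k) (vecEqᵇ u α) (c *ℤ a)))
           (sym (iverson (*-linear c (eval-linear a)) ((i ≡ᵇ k) ∧ vecEqᵇ u α) (λ x → x)))) ⟩
    shift j (λ k → c *ℤ ⟦ (i ≡ᵇ k) ∧ vecEqᵇ u α ⟧ a) k ∎

nth : List ℤ → ℕ → ℤ
nth []       k       = + 0
nth (c ∷ cs) zero    = c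
nth (c ∷ cs) (suc k) = nth cs k

nth-applyUpTo : ∀ (g : ℕ → ℤ) m → (∀ k → m ≤ k → g k ≡ + 0) → ∀ k → nth (applyUpTo g m) k ≡ g k
nth-applyUpTo g zero    h k       = sym (h k z≤n)
nth-applyUpTo g (suc m) h zero    = refl
nth-applyUpTo g (suc m) h (suc k) = nth-applyUpTo (g ∘ suc) m (λ j m≤j → h (suc j) (s≤s m≤j)) k

-- `constant` says that `ts` is free of q, as products of the e_m are; powers of q then come from
-- the coefficient list alone.
module _ {N : ℕ} (ts : List (Term N)) (α : Vec ℕ N) (constant : ∀ k → coeffOf ts α (suc k) ≡ + 0) where

  private
    D₀ : ℤ
    D₀ = coeffOf ts α 0

    head-step : ∀ c cs j k →
      shift j (λ k → c *ℤ coeffOf ts α k) k +ℤ shift (suc j) (λ k → nth cs k *ℤ D₀) k ≡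
      shift j (λ k → nth (c ∷ cs) k *ℤ D₀) k
    head-step c cs j k = begin
      shift j (λ k → c *ℤ coeffOf ts α k) k +ℤ shift (suc j) rest k
        ≡⟨ cong (shift j (λ k → c *ℤ coeffOf ts α k) k +ℤ_)
             (trans (cong (λ w → shift w rest k) (ℕₚ.+-comm 1 j)) (shift-+ j 1 rest k)) ⟩
      shift j (λ k → c *ℤ coeffOf ts α k) k +ℤ shift j (shift 1 rest) k
        ≡⟨ sym (add (shift-linear j k) _ _) ⟩
      shift j (λ k → c *ℤ coeffOf ts α k +ℤ shift 1 rest k) k
        ≡⟨ congr (shift-linear j k) (λ { zero → ℤₚ.+-identityʳ _
             ; (suc k) → trans (cong (λ x → c *ℤ x +ℤ rest k) (constant k))
                 (trans (cong (_+ℤ rest k) (ℤₚ.*-zeroʳ c)) (ℤₚ.+-identityˡ (rest k))) }) ⟩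
      shift j (λ k → nth (c ∷ cs) k *ℤ D₀) k ∎
      where
      open ≡-Reasoning
      rest : Poly
      rest k = nth cs k *ℤ D₀

    -- `go` enters only through its two equations. The argument `o` is the list with which `scaleQ`
    -- was called: a local function takes the arguments of its parent as parameters, and they stay
    -- fixed in the recursion.
    go-coeff : (go : List ℤ → ℕ → List ℤ → List (Term N)) → (∀ o j → go o j [] ≡ []) →
      (∀ o j c cs → go o j (c ∷ cs) ≡ map (raise c j) ts ++ go o (suc j) cs) →
      ∀ o j cs k → coeffOf (go o j cs) α k ≡ shift j (λ k → nth cs k *ℤ D₀) k
    go-coeff go h h′ o j []       k rewrite h o j = sym (zer (shift-linear j k))
    go-coeff go h h′ o j (c ∷ cs) k rewrite h′ o j c cs = begin
      coeffOf (map (raise c j) ts ++ go o (suc j) cs) α k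
        ≡⟨ coeffOf-++ (map (raise c j) ts) (go o (suc j) cs) α k ⟩
      _ ≡⟨ cong₂ _+ℤ_ (coeffOf-scale c j ts α k) (go-coeff go h h′ o (suc j) cs k) ⟩
      shift j (λ k → c *ℤ coeffOf ts α k) k +ℤ shift (suc j) (λ k → nth cs k *ℤ D₀) k
        ≡⟨ head-step c cs j k ⟩
      shift j (λ k → nth (c ∷ cs) k *ℤ D₀) k ∎
      where open ≡-Reasoning

    go-coeff-++ : (go : List ℤ → ℕ → List ℤ → List (Term N)) → (∀ o j → go o j [] ≡ []) →
      (∀ o j c cs → go o j (c ∷ cs) ≡ map (raise c j) ts ++ go o (suc j) cs) →
      ∀ xs o j cs k → coeffOf (xs ++ go o j cs) α k ≡ coeffOf xs α k +ℤ shift j (λ k → nth cs k *ℤ D₀) k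
    go-coeff-++ go h h′ xs o j cs k =
      trans (coeffOf-++ xs (go o j cs) α k) (cong (coeffOf xs α k +ℤ_) (go-coeff go h h′ o j cs k))

    -- localGo is found by unification to be the function go local to scaleQ, which cannot be
    -- named; abstracting c ∷ cs and 1 makes its arguments distinct variables.
    mutual
      localGo : List ℤ → ℕ → List ℤ → List (Term N)
      localGo = _

      scaleQ-∷ : ∀ c cs k → coeffOf (scaleQ (c ∷ cs) ts) α k ≡
        coeffOf (map (raise c 0) ts) α k +ℤ
        shift 1 (λ k → nth cs k *ℤ D₀) k
      scaleQ-∷ c cs k with c ∷ cs | 1
      ... | o | w = go-coeff-++ localGo (λ _ _ → refl) (λ _ _ _ _ → refl)
        (map (raise c 0) ts) o w cs k

  coeffOf-scaleQ : ∀ cs k → coeffOf (scaleQ cs ts) α k ≡ nth cs k *ℤ coeffOf ts α 0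
  coeffOf-scaleQ []       k = refl
  coeffOf-scaleQ (c ∷ cs) k = trans (scaleQ-∷ c cs k)
    (trans (cong (_+ℤ shift 1 (λ k → nth cs k *ℤ D₀) k) (coeffOf-scale c 0 ts α k)) (head-step c cs 0 k))

-- Multiplication by e_m on coefficient functions

private
  lowered : ℕ → (ℕ → ℤ) → ℤ
  lowered zero    g = + 0
  lowered (suc b) g = g b

  lowered-linear : ∀ b {L : ℕ → (D → ℤ) → ℤ} → (∀ b → Linear (L b)) → Linear (λ f → lowered b (λ b → L b f))
  lowered-linear zero    l = zero-linear
  lowered-linear (suc b) l = l b

  -- Counting down in the integers tests |S| = m one variable at a time, in step with the recursion
  -- of `timesE`.
  hits : {N : ℕ} → Vec Bool N → ℤ → Bool
  hits []          m = isZero m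
  hits (true ∷ S)  m = hits S (pr m)
  hits (false ∷ S) m = hits S m

  hits-neg : {N : ℕ} (S : Vec Bool N) (m : ℕ) → hits S -[1+ m ] ≡ false
  hits-neg []          m = refl
  hits-neg (true ∷ S)  m = hits-neg S (suc m)
  hits-neg (false ∷ S) m = hits-neg S m

  hits-count : {N : ℕ} (S : Vec Bool N) (m : ℕ) → (countᵇ (λ b → b) (toList S) ≡ᵇ m) ≡ hits S (+ m)
  hits-count []          zero    = refl
  hits-count []          (suc m) = refl
  hits-count (true ∷ S)  zero    = sym (hits-neg S 0)
  hits-count (true ∷ S)  (suc m) = hits-count S m
  hits-count (false ∷ S) m       = hits-count S m

-- timesE m f is the coefficient function of e_m · f.
timesE : {N : ℕ} → ℤ → (Vec ℕ N → ℤ) → Vec ℕ N → ℤ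
timesE m f []      = ⟦ isZero m ⟧ f []
timesE m f (b ∷ α) = timesE m (λ γ → f (b ∷ γ)) α +ℤ lowered b (λ b′ → timesE (pr m) (λ γ → f (b′ ∷ γ)) α)

timesE-linear : {N : ℕ} (m : ℤ) (α : Vec ℕ N) → Linear (λ f → timesE m f α)
timesE-linear m []      = iverson-linear (isZero m) (eval-linear [])
timesE-linear m (b ∷ α) = +-linear (pull-linear (b ∷_) (timesE-linear m α))
  (lowered-linear b (λ b′ → pull-linear (b′ ∷_) (timesE-linear (pr m) α)))

timesE-neg : {N : ℕ} (m : ℕ) (f : Vec ℕ N → ℤ) (α : Vec ℕ N) → timesE -[1+ m ] f α ≡ + 0
timesE-neg m f []          = refl
timesE-neg m f (zero ∷ α)  = cong (_+ℤ + 0) (timesE-neg m _ α)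
timesE-neg m f (suc b ∷ α) = cong₂ _+ℤ_ (timesE-neg m _ α) (timesE-neg (suc m) _ α)

timesE-zero : {N : ℕ} (f : Vec ℕ N → ℤ) (α : Vec ℕ N) → timesE (+ 0) f α ≡ f α
timesE-zero f []          = refl
timesE-zero f (zero ∷ α)  = trans (ℤₚ.+-identityʳ _) (timesE-zero (λ γ → f (0 ∷ γ)) α)
timesE-zero f (suc b ∷ α) = trans (cong₂ _+ℤ_ (timesE-zero (λ γ → f (suc b ∷ γ)) α) (timesE-neg 0 _ α))
  (ℤₚ.+-identityʳ (f (suc b ∷ α)))

private
  addSubset : {N : ℕ} → Vec Bool N → Vec ℕ N → Vec ℕ N
  addSubset S v = Vec.zipWith _+_ (Vec.map (λ b → if b then 1 else 0) S) v

  subset-sum : {N : ℕ} (m : ℤ) (v α : Vec ℕ N) (z : ℤ) →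
    ∑ (allVecs allBool N) (λ S → ⟦ hits S m ⟧ ⟦ vecEqᵇ (addSubset S v) α ⟧ z) ≡
    timesE m (λ γ → ⟦ vecEqᵇ v γ ⟧ z) α
  subset-sum m []       []      z = ℤₚ.+-identityʳ _
  subset-sum {suc N} m (v₀ ∷ v) (b ∷ α) z = begin
    ∑ (allVecs allBool (suc N)) F
      ≡⟨ ∑-concatMap (λ s → map (s ∷_) subsets) allBool F ⟩
    ∑ (map (true ∷_) subsets) F +ℤ (∑ (map (false ∷_) subsets) F +ℤ + 0)
      ≡⟨ cong₂ _+ℤ_ (trans (∑-map (true ∷_) subsets F) (present b))
           (trans (ℤₚ.+-identityʳ _) (trans (∑-map (false ∷_) subsets F) absent)) ⟩
    lowered b (λ b′ → timesE (pr m) (λ γ → ⟦ vecEqᵇ (v₀ ∷ v) (b′ ∷ γ) ⟧ z) α) +ℤ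
    timesE m (λ γ → ⟦ vecEqᵇ (v₀ ∷ v) (b ∷ γ) ⟧ z) α
      ≡⟨ ℤₚ.+-comm (lowered b (λ b′ → timesE (pr m) (λ γ → ⟦ vecEqᵇ (v₀ ∷ v) (b′ ∷ γ) ⟧ z) α)) _ ⟩
    timesE m (λ γ → ⟦ vecEqᵇ (v₀ ∷ v) γ ⟧ z) (b ∷ α) ∎
    where
    open ≡-Reasoning
    subsets = allVecs allBool N
    F : Vec Bool (suc N) → ℤ
    F S = ⟦ hits S m ⟧ ⟦ vecEqᵇ (addSubset S (v₀ ∷ v)) (b ∷ α) ⟧ z
    match : ∀ m c → ∑ subsets (λ S → ⟦ hits S m ⟧ ⟦ (v₀ ≡ᵇ c) ∧ vecEqᵇ (addSubset S v) α ⟧ z) ≡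
      timesE m (λ γ → ⟦ vecEqᵇ (v₀ ∷ v) (c ∷ γ) ⟧ z) α
    match m c = begin
      ∑ subsets (λ S → ⟦ hits S m ⟧ ⟦ (v₀ ≡ᵇ c) ∧ vecEqᵇ (addSubset S v) α ⟧ z)
        ≡⟨ congr (∑-linear subsets) (λ S → cong (⟦ hits S m ⟧_) (swap (v₀ ≡ᵇ c) (vecEqᵇ (addSubset S v) α))) ⟩
      ∑ subsets (λ S → ⟦ hits S m ⟧ ⟦ vecEqᵇ (addSubset S v) α ⟧ ⟦ v₀ ≡ᵇ c ⟧ z)
        ≡⟨ subset-sum m v α (⟦ v₀ ≡ᵇ c ⟧ z) ⟩
      timesE m (λ γ → ⟦ vecEqᵇ v γ ⟧ ⟦ v₀ ≡ᵇ c ⟧ z) α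
        ≡⟨ congr (timesE-linear m α) (λ γ → sym (swap (v₀ ≡ᵇ c) (vecEqᵇ v γ))) ⟩
      timesE m (λ γ → ⟦ vecEqᵇ (v₀ ∷ v) (c ∷ γ) ⟧ z) α ∎
      where
      swap : ∀ p q → ⟦ p ∧ q ⟧ z ≡ ⟦ q ⟧ ⟦ p ⟧ z
      swap p q = trans (⟦⟧-∧ p q z) (⟦⟧-comm p q z)
    absent : ∑ subsets (λ S → F (false ∷ S)) ≡ timesE m (λ γ → ⟦ vecEqᵇ (v₀ ∷ v) (b ∷ γ) ⟧ z) α
    absent = match m b
    present : ∀ b → ∑ subsets (λ S → ⟦ hits S (pr m) ⟧ ⟦ vecEqᵇ (addSubset (true ∷ S) (v₀ ∷ v)) (b ∷ α) ⟧ z) ≡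
      lowered b (λ b′ → timesE (pr m) (λ γ → ⟦ vecEqᵇ (v₀ ∷ v) (b′ ∷ γ) ⟧ z) α)
    present zero    = vanish (∑-linear subsets) (λ S → ⟦⟧-zero (hits S (pr m)))
    present (suc b) = match (pr m) b

coeffOf-timesE : {N : ℕ} (m : ℕ) (ys : List (Term N)) (α : Vec ℕ N) (k : ℕ) →
  coeffOf (mulTerms (eTerms N m) ys) α k ≡ timesE (+ m) (λ γ → coeffOf ys γ k) α
coeffOf-timesE {N} m ys α k = begin
  coeffOf (mulTerms (eTerms N m) ys) α k
    ≡⟨ coeffOf-concatMap (λ t → map (times t) ys) (eTerms N m) α k ⟩
  ∑ (eTerms N m) (λ t → coeffOf (map (times t) ys) α k)
    ≡⟨ congr (∑-linear (eTerms N m)) (λ t → trans (coeffOf-∑ (map (times t) ys) α k)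
         (∑-map (times t) ys (term-hit α k))) ⟩
  ∑ (eTerms N m) (λ t → ∑ ys (λ y → term-hit α k (times t y)))
    ≡⟨ trans (∑-map subsetTerm (filterᵇ size subsets) _) (∑-filter size subsets _) ⟩
  ∑ subsets (λ S → ⟦ size S ⟧ ∑ ys (λ y → term-hit α k (times (subsetTerm S) y)))
    ≡⟨ congr (∑-linear subsets) (λ S → ∑-comm (iverson-linear (size S) (eval-linear S)) ys
         (λ y S → term-hit α k (times (subsetTerm S) y))) ⟩
  ∑ subsets (λ S → ∑ ys (λ y → ⟦ size S ⟧ term-hit α k (times (subsetTerm S) y)))
    ≡⟨ ∑-comm (∑-linear subsets) ys (λ y S → ⟦ size S ⟧ term-hit α k (times (subsetTerm S) y)) ⟩
  ∑ ys (λ y → ∑ subsets (λ S → ⟦ size S ⟧ term-hit α k (times (subsetTerm S) y)))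
    ≡⟨ congr (∑-linear ys) single ⟩
  ∑ ys (λ y → timesE (+ m) (λ γ → term-hit γ k y) α)
    ≡⟨ sym (∑-comm (timesE-linear (+ m) α) ys (λ y γ → term-hit γ k y)) ⟩
  timesE (+ m) (λ γ → ∑ ys (term-hit γ k)) α
    ≡⟨ congr (timesE-linear (+ m) α) (λ γ → sym (coeffOf-∑ ys γ k)) ⟩
  timesE (+ m) (λ γ → coeffOf ys γ k) α ∎
  where
  open ≡-Reasoning
  subsets = allVecs allBool N
  size : Vec Bool N → Bool
  size S = countᵇ (λ b → b) (toList S) ≡ᵇ m
  subsetTerm : Vec Bool N → Term N
  subsetTerm S = (+ 1 , 0 , Vec.map (λ b → if b then 1 else 0) S)
  times : Term N → Term N → Term N
  times (a , i , u) (b , j , v) = (a *ℤ b , i + j , Vec.zipWith _+_ u v)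
  single : ∀ y → ∑ subsets (λ S → ⟦ size S ⟧ term-hit α k (times (subsetTerm S) y)) ≡
    timesE (+ m) (λ γ → term-hit γ k y) α
  single (b , j , v) = begin
    ∑ subsets (λ S → ⟦ size S ⟧ ⟦ (j ≡ᵇ k) ∧ vecEqᵇ (addSubset S v) α ⟧ (+ 1 *ℤ b))
      ≡⟨ congr (∑-linear subsets) (λ S → trans (cong₂ ⟦_⟧_ (hits-count S m)
           (trans (cong (⟦ (j ≡ᵇ k) ∧ vecEqᵇ (addSubset S v) α ⟧_) (ℤₚ.*-identityˡ b))
             (swap (vecEqᵇ (addSubset S v) α)))) refl) ⟩
    ∑ subsets (λ S → ⟦ hits S (+ m) ⟧ ⟦ vecEqᵇ (addSubset S v) α ⟧ ⟦ j ≡ᵇ k ⟧ b)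
      ≡⟨ subset-sum (+ m) v α (⟦ j ≡ᵇ k ⟧ b) ⟩
    timesE (+ m) (λ γ → ⟦ vecEqᵇ v γ ⟧ ⟦ j ≡ᵇ k ⟧ b) α
      ≡⟨ congr (timesE-linear (+ m) α) (λ γ → sym (swap (vecEqᵇ v γ))) ⟩
    timesE (+ m) (λ γ → ⟦ (j ≡ᵇ k) ∧ vecEqᵇ v γ ⟧ b) α ∎
    where
    swap : ∀ p → ⟦ (j ≡ᵇ k) ∧ p ⟧ b ≡ ⟦ p ⟧ ⟦ j ≡ᵇ k ⟧ b
    swap p = trans (⟦⟧-∧ (j ≡ᵇ k) p b) (⟦⟧-comm (j ≡ᵇ k) p b)

coeffOf-oneTerms : {N : ℕ} (α : Vec ℕ N) (k : ℕ) →
  coeffOf oneTerms α k ≡ ⟦ 0 ≡ᵇ k ⟧ ⟦ vecEqᵇ (Vec.replicate N 0) α ⟧ (+ 1)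
coeffOf-oneTerms {N} α k = trans (coeffOf-∑ oneTerms α k)
  (trans (ℤₚ.+-identityʳ _) (⟦⟧-∧ (0 ≡ᵇ k) (vecEqᵇ (Vec.replicate N 0) α) (+ 1)))

eλ-constant : ∀ N u (α : Vec ℕ N) k → coeffOf (eλ N u) α (suc k) ≡ + 0
eλ-constant N []      α k = coeffOf-oneTerms α (suc k)
eλ-constant N (m ∷ u) α k = trans (coeffOf-timesE m (eλ N u) α (suc k))
  (vanish (timesE-linear (+ m) α) (λ γ → eλ-constant N u γ k))

-- Products of at most three e_m, read one variable at a time

private
  one₀ : {N : ℕ} → Vec ℕ N → ℤ
  one₀ α = coeffOf oneTerms α 0

  one₀-∷ : {N : ℕ} (b : ℕ) (α : Vec ℕ N) → one₀ (b ∷ α) ≡ ⟦ b ≡ᵇ 0 ⟧ one₀ α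
  one₀-∷ zero    α = trans (coeffOf-oneTerms (0 ∷ α) 0) (sym (coeffOf-oneTerms α 0))
  one₀-∷ (suc b) α = coeffOf-oneTerms (suc b ∷ α) 0

  e₁ : {N : ℕ} → ℤ → Vec ℕ N → ℤ
  e₁ c = timesE c one₀

  e₂ : {N : ℕ} → ℤ → ℤ → Vec ℕ N → ℤ
  e₂ b c = timesE b (e₁ c)

  e₃ : {N : ℕ} → ℤ → ℤ → ℤ → Vec ℕ N → ℤ
  e₃ a b c = timesE a (e₂ b c)

  timesE-∷ : {N : ℕ} (m : ℤ) (f : Vec ℕ (suc N) → ℤ) (b : ℕ) (α : Vec ℕ N) {g h : Vec ℕ N → ℤ} →
    (∀ γ → f (suc b ∷ γ) ≡ g γ) → (∀ γ → f (b ∷ γ) ≡ h γ) →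
    timesE m f (suc b ∷ α) ≡ timesE m g α +ℤ timesE (pr m) h α
  timesE-∷ m f b α p q = cong₂ _+ℤ_ (congr (timesE-linear m α) p) (congr (timesE-linear (pr m) α) q)

  e₁-0 : {N : ℕ} (c : ℤ) (α : Vec ℕ N) → e₁ c (0 ∷ α) ≡ e₁ c α
  e₁-0 c α = trans (ℤₚ.+-identityʳ _) (congr (timesE-linear c α) (one₀-∷ 0))

  e₁-1 : {N : ℕ} (c : ℤ) (α : Vec ℕ N) → e₁ c (1 ∷ α) ≡ e₁ (pr c) α
  e₁-1 c α = trans (timesE-∷ c one₀ 0 α (one₀-∷ 1) (one₀-∷ 0))
    (trans (cong (_+ℤ e₁ (pr c) α) (zer (timesE-linear c α))) (ℤₚ.+-identityˡ _))

  e₁-2+ : {N : ℕ} (c : ℤ) (b : ℕ) (α : Vec ℕ N) → e₁ c (suc (suc b) ∷ α) ≡ + 0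
  e₁-2+ c b α = trans (timesE-∷ c one₀ (suc b) α (one₀-∷ (suc (suc b))) (one₀-∷ (suc b)))
    (cong₂ _+ℤ_ (zer (timesE-linear c α)) (zer (timesE-linear (pr c) α)))

  e₂-0 : {N : ℕ} (b c : ℤ) (α : Vec ℕ N) → e₂ b c (0 ∷ α) ≡ e₂ b c α
  e₂-0 b c α = trans (ℤₚ.+-identityʳ _) (congr (timesE-linear b α) (e₁-0 c))

  e₂-1 : {N : ℕ} (b c : ℤ) (α : Vec ℕ N) → e₂ b c (1 ∷ α) ≡ e₂ b (pr c) α +ℤ e₂ (pr b) c α
  e₂-1 b c α = timesE-∷ b (e₁ c) 0 α (e₁-1 c) (e₁-0 c)

  e₂-2 : {N : ℕ} (b c : ℤ) (α : Vec ℕ N) → e₂ b c (2 ∷ α) ≡ e₂ (pr b) (pr c) α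
  e₂-2 b c α = trans (timesE-∷ b (e₁ c) 1 α (e₁-2+ c 0) (e₁-1 c))
    (trans (cong (_+ℤ e₂ (pr b) (pr c) α) (zer (timesE-linear b α))) (ℤₚ.+-identityˡ _))

  e₂-3+ : {N : ℕ} (b c : ℤ) (m : ℕ) (α : Vec ℕ N) → e₂ b c (suc (suc (suc m)) ∷ α) ≡ + 0
  e₂-3+ b c m α = trans (timesE-∷ b (e₁ c) (suc (suc m)) α (e₁-2+ c (suc m)) (e₁-2+ c m))
    (cong₂ _+ℤ_ (zer (timesE-linear b α)) (zer (timesE-linear (pr b) α)))

  -- If the first variable has exponent m, then m of the three factors use it, and each of these
  -- loses one from its degree. This is the exchange of rows and columns behind `threeRow`.
  e₃-∷ : {N : ℕ} (m : ℕ) (a b c : ℤ) (α : Vec ℕ N) →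
    e₃ a b c (m ∷ α) ≡ column m (λ a b c → e₃ a b c α) a b c
  e₃-∷ 0 a b c α = trans (ℤₚ.+-identityʳ _) (congr (timesE-linear a α) (e₂-0 b c))
  e₃-∷ 1 a b c α = trans (timesE-∷ a (e₂ b c) 0 α (e₂-1 b c) (e₂-0 b c))
    (trans (cong (_+ℤ e₃ (pr a) b c α) (add (timesE-linear a α) (e₂ b (pr c)) (e₂ (pr b) c)))
      (rearrange (e₃ a b (pr c) α) (e₃ a (pr b) c α) (e₃ (pr a) b c α)))
    where
    rearrange : ∀ x y z → (x +ℤ y) +ℤ z ≡ z +ℤ (y +ℤ x)
    rearrange = solve-∀
  e₃-∷ 2 a b c α = trans (timesE-∷ a (e₂ b c) 1 α (e₂-2 b c) (e₂-1 b c))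
    (trans (cong (e₃ a (pr b) (pr c) α +ℤ_) (add (timesE-linear (pr a) α) (e₂ b (pr c)) (e₂ (pr b) c)))
      (rearrange (e₃ a (pr b) (pr c) α) (e₃ (pr a) b (pr c) α) (e₃ (pr a) (pr b) c α)))
    where
    rearrange : ∀ x y z → x +ℤ (y +ℤ z) ≡ z +ℤ (y +ℤ x)
    rearrange = solve-∀
  e₃-∷ 3 a b c α = trans (timesE-∷ a (e₂ b c) 2 α (e₂-3+ b c 0) (e₂-2 b c))
    (trans (cong (_+ℤ e₃ (pr a) (pr b) (pr c) α) (zer (timesE-linear a α))) (ℤₚ.+-identityˡ _))
  e₃-∷ (suc (suc (suc (suc m)))) a b c α =
    trans (timesE-∷ a (e₂ b c) (suc (suc (suc m))) α (e₂-3+ b c (suc m)) (e₂-3+ b c m))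
      (cong₂ _+ℤ_ (zer (timesE-linear a α)) (zer (timesE-linear (pr a) α)))

  e₃-threeRow : {N : ℕ} (α : Vec ℕ N) (a b c : ℤ) → e₃ a b c α ≡ threeRow (toList α) a b c
  e₃-threeRow []      a b c = refl
  e₃-threeRow (m ∷ α) a b c = trans (e₃-∷ m a b c α) (column-cong m (e₃-threeRow α) a b c)

-- Missing factors are supplied as e_0 = 1, so that the formula for three factors covers all cases.
coeffOf-eλ : ∀ N u {t} (α : Vec ℕ N) → pad u ≡ just t → coeffOf (eλ N u) α 0 ≡ rows u (toList α)
coeffOf-eλ N [] α _ = trans (sym (timesE-zero one₀ α)) (trans (sym (timesE-zero (e₁ (+ 0)) α))
  (trans (sym (timesE-zero (e₂ (+ 0) (+ 0)) α)) (e₃-threeRow α (+ 0) (+ 0) (+ 0))))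
coeffOf-eλ N (a ∷ []) α _ = trans (coeffOf-timesE a oneTerms α 0)
  (trans (congr (timesE-linear (+ a) α) (λ γ → trans (sym (timesE-zero one₀ γ)) (sym (timesE-zero (e₁ (+ 0)) γ))))
    (e₃-threeRow α (+ a) (+ 0) (+ 0)))
coeffOf-eλ N (a ∷ b ∷ []) α _ = trans (coeffOf-timesE a (eλ N (b ∷ [])) α 0)
  (trans (congr (timesE-linear (+ a) α) (λ γ → trans (coeffOf-timesE b oneTerms γ 0)
      (congr (timesE-linear (+ b) γ) (λ η → sym (timesE-zero one₀ η)))))
    (e₃-threeRow α (+ a) (+ b) (+ 0)))
coeffOf-eλ N (a ∷ b ∷ c ∷ []) α _ = trans (coeffOf-timesE a (eλ N (b ∷ c ∷ [])) α 0)
  (trans (congr (timesE-linear (+ a) α) (λ γ → trans (coeffOf-timesE b (eλ N (c ∷ [])) γ 0)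
      (congr (timesE-linear (+ b) γ) (λ η → coeffOf-timesE c oneTerms η 0))))
    (e₃-threeRow α (+ a) (+ b) (+ c)))

-- Colourings as assignments

∑below : ℕ → (ℕ → ℤ) → ℤ
∑below zero    g = + 0
∑below (suc N) g = g 0 +ℤ ∑below N (g ∘ suc)

∑below-linear : ∀ N → Linear (∑below N)
∑below-linear zero    = zero-linear
∑below-linear (suc N) = +-linear (eval-linear 0) (pull-linear suc (∑below-linear N))

∑-tabulate : ∀ N (h : Fin N → A) (g : A → ℤ) (g′ : ℕ → ℤ) → (∀ i → g (h i) ≡ g′ (toℕ i)) →
  ∑ (tabulate h) g ≡ ∑below N g′
∑-tabulate zero    h g g′ e = refl
∑-tabulate (suc N) h g g′ e =
  cong₂ _+ℤ_ (e zero) (∑-tabulate N (h ∘ suc) g (g′ ∘ suc) (λ i → e (suc i)))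

assignSum : List V → ℕ → (List (V × ℕ) → ℤ) → ℤ
assignSum []      N f = f []
assignSum (x ∷ S) N f = ∑below N (λ c → assignSum S N (λ κ → f ((x , c) ∷ κ)))

assignSum-linear : (S : List V) (N : ℕ) → Linear (assignSum S N)
assignSum-linear []      N = eval-linear []
assignSum-linear (x ∷ S) N = bind-linear (∑below-linear N) (λ c → pull-linear ((x , c) ∷_) (assignSum-linear S N))

assignSum-cong : (S : List V) (N : ℕ) {f g : List (V × ℕ) → ℤ} →
  (∀ κ → map proj₁ κ ≡ S → f κ ≡ g κ) → assignSum S N f ≡ assignSum S N g
assignSum-cong []      N h = h [] refl
assignSum-cong (x ∷ S) N h = congr (∑below-linear N) (λ c →
  assignSum-cong S N (λ κ e → h ((x , c) ∷ κ) (cong (x ∷_) e)))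

∑-allVecs : ∀ n N (s : Fin n → V) (F : List (V × ℕ) → ℤ) →
  ∑ (allVecs (allFin N) n) (λ κ → F (tabulate (λ i → s i , toℕ (lookup κ i)))) ≡ assignSum (tabulate s) N F
∑-allVecs zero    N s F = ℤₚ.+-identityʳ (F [])
∑-allVecs (suc n) N s F = trans
  (∑-concatMap (λ x → map (x ∷_) (allVecs (allFin N) n)) (allFin N) _)
  (∑-tabulate N (λ i → i) _ _ (λ c → trans (∑-map (c ∷_) (allVecs (allFin N) n) _)
    (∑-allVecs n N (s ∘ suc) (λ κ → F ((s zero , toℕ c) ∷ κ)))))

zeros : List (V × ℕ) → List V
zeros []                = []
zeros ((v , zero) ∷ κ)  = v ∷ zeros κ
zeros ((v , suc c) ∷ κ) = zeros κ

others : List (V × ℕ) → List (V × ℕ)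
others []                = []
others ((v , zero) ∷ κ)  = others κ
others ((v , suc c) ∷ κ) = (v , c) ∷ others κ

-- An assignment with N + 1 colours is a set `A` of colour 0 and an assignment of the rest with N
-- colours, each lowered by one.
assignSum-peel : (S : List V) (N : ℕ) (g : List V → List (V × ℕ) → ℤ) →
  assignSum S (suc N) (λ κ → g (zeros κ) (others κ)) ≡ splitSum S (λ A R → assignSum R N (g A))
assignSum-peel []      N g = refl
assignSum-peel (x ∷ S) N g = cong₂ _+ℤ_ (assignSum-peel S N (λ A κ → g (x ∷ A) κ))
  (trans (congr (∑below-linear N) (λ c → assignSum-peel S N (λ A κ → g A ((x , c) ∷ κ))))
    (splitSum-comm (∑below-linear N) S (λ A R c → assignSum R N (λ κ → g A ((x , c) ∷ κ)))))

sumBy-map : (f : B → ℕ) (g : A → B) (xs : List A) → sumBy f (map g xs) ≡ sumBy (f ∘ g) xs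
sumBy-map f g []       = refl
sumBy-map f g (x ∷ xs) = cong (_+_ (f (g x))) (sumBy-map f g xs)

sumBy-peel : (h : V × ℕ → ℕ) (κ : List (V × ℕ)) →
  sumBy h κ ≡ sumBy (λ v → h (v , 0)) (zeros κ) + sumBy (λ (v , c) → h (v , suc c)) (others κ)
sumBy-peel h []                = refl
sumBy-peel h ((v , zero) ∷ κ)  =
  trans (cong (_+_ (h (v , 0))) (sumBy-peel h κ)) (sym (ℕₚ.+-assoc (h (v , 0)) _ _))
sumBy-peel h ((v , suc c) ∷ κ) = trans (cong (_+_ (h (v , suc c))) (sumBy-peel h κ))
  (left-comm (h (v , suc c)) (sumBy (λ v → h (v , 0)) (zeros κ)) (sumBy (λ (v , c) → h (v , suc c)) (others κ)))
  where
  open +-*-Solver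
  left-comm : ∀ a b c → a + (b + c) ≡ b + (a + c)
  left-comm = solve 3 (λ a b c → a :+ (b :+ c) := b :+ (a :+ c)) refl

classSizes : List (V × ℕ) → List ℕ → Bool
classSizes κ []      = true
classSizes κ (b ∷ β) = (length (zeros κ) ≡ᵇ b) ∧ classSizes (others κ) β

length-zeros : (κ : List (V × ℕ)) → length (zeros κ) ≡ # (λ p → proj₂ p ≡ᵇ 0) κ
length-zeros []                = refl
length-zeros ((v , zero) ∷ κ)  = cong suc (length-zeros κ)
length-zeros ((v , suc c) ∷ κ) = length-zeros κ

#-others : (c : ℕ) (κ : List (V × ℕ)) → # (λ p → proj₂ p ≡ᵇ suc c) κ ≡ # (λ p → proj₂ p ≡ᵇ c) (others κ)
#-others c []                 = refl
#-others c ((v , zero) ∷ κ)   = #-others c κ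
#-others c ((v , suc c′) ∷ κ) = cong (_+_ (bit (c′ ≡ᵇ c))) (#-others c κ)

classSizes-vecEqᵇ : ∀ {N} (κ : List (V × ℕ)) (α : Vec ℕ N) →
  vecEqᵇ (Vec.tabulate (λ (c : Fin N) → # (λ p → proj₂ p ≡ᵇ toℕ c) κ)) α ≡ classSizes κ (toList α)
classSizes-vecEqᵇ κ []      = refl
classSizes-vecEqᵇ κ (a ∷ α) = cong₂ _∧_ (cong (_≡ᵇ a) (sym (length-zeros κ)))
  (trans (cong (λ v → vecEqᵇ v α) (Vecₚ.tabulate-cong (λ c → #-others (toℕ c) κ)))
    (classSizes-vecEqᵇ (others κ) α))

module Assignments {V : Set} (e : V → V → Bool) where

  open Digraph e

  pairs : (ℕ → ℕ → Bool) → List (V × ℕ) → ℕ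
  pairs r κ = sumBy (λ (v , c) → # (λ (w , c′) → r c c′ ∧ e v w) κ) κ

  -- Equality and order of colours are unchanged when both are lowered by one and never lead from a
  -- positive colour to 0. So only the pairs that start in the smallest class are counted
  -- separately.
  pairs-peel : ∀ r κ → (∀ c c′ → r (suc c) (suc c′) ≡ r c c′) → (∀ c → r (suc c) 0 ≡ false) →
    pairs r κ ≡ sumBy (λ v → # (λ w → r 0 0 ∧ e v w) (zeros κ) +
                             # (λ (w , c) → r 0 (suc c) ∧ e v w) (others κ)) (zeros κ)
                + pairs r (others κ)
  pairs-peel r κ rs r0 = trans (sumBy-peel _ κ) (cong₂ _+_
    (sumBy-cong (λ v → sumBy-peel (λ (w , c′) → bit (r 0 c′ ∧ e v w)) κ) (zeros κ))
    (sumBy-cong (λ (v , c) → trans (sumBy-peel (λ (w , c′) → bit (r (suc c) c′ ∧ e v w)) κ)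
      (cong₂ _+_ (trans (sumBy-cong (λ w → cong (λ b → bit (b ∧ e v w)) (r0 c)) (zeros κ)) (sumBy-zero (zeros κ)))
        (sumBy-cong (λ (w , c′) → cong (λ b → bit (b ∧ e v w)) (rs c c′)) (others κ)))) (others κ)))

  clashes ascents : List (V × ℕ) → ℕ
  clashes = pairs _≡ᵇ_
  ascents = pairs _<ᵇ_

  clashes-peel : ∀ κ → clashes κ ≡ cross (zeros κ) (zeros κ) + clashes (others κ)
  clashes-peel κ = trans (pairs-peel _≡ᵇ_ κ (λ _ _ → refl) (λ _ → refl))
    (cong (_+ clashes (others κ)) (sumBy-cong (λ v →
      trans (cong (_+_ (deg v (zeros κ))) (sumBy-zero (others κ))) (ℕₚ.+-identityʳ _)) (zeros κ)))

  ascents-peel : ∀ κ → ascents κ ≡ cross (zeros κ) (map proj₁ (others κ)) + ascents (others κ)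
  ascents-peel κ = trans (pairs-peel _<ᵇ_ κ (λ _ _ → refl) (λ _ → refl))
    (cong (_+ ascents (others κ)) (sumBy-cong (λ v →
      trans (cong (_+ # (λ (w , c) → e v w) (others κ)) (sumBy-zero (zeros κ)))
        (sym (sumBy-map (λ w → bit (e v w)) proj₁ (others κ)))) (zeros κ)))

  weight : List (V × ℕ) → List ℕ → Poly
  weight κ β k = ⟦ clashes κ ≡ᵇ 0 ⟧ ⟦ (ascents κ ≡ᵇ k) ∧ classSizes κ β ⟧ (+ 1)

  private
    class : ℕ → List ℕ → ℕ → List V → List (V × ℕ) → ℤ
    class b β k A κ = ⟦ cross A A ≡ᵇ 0 ⟧ ⟦ length A ≡ᵇ b ⟧ shift (cross A (map proj₁ κ)) (weight κ β) k

    weight-peel : ∀ κ b β k → weight κ (b ∷ β) k ≡ class b β k (zeros κ) (others κ)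
    weight-peel κ b β k rewrite clashes-peel κ | ascents-peel κ =
      arith (cross Z Z) (clashes O) (length Z ≡ᵇ b) (classSizes O β) (cross Z (map proj₁ O)) (ascents O)
      where
      Z = zeros κ
      O = others κ
      arith : ∀ z o s t w a → ⟦ z + o ≡ᵇ 0 ⟧ ⟦ (w + a ≡ᵇ k) ∧ (s ∧ t) ⟧ (+ 1) ≡
        ⟦ z ≡ᵇ 0 ⟧ ⟦ s ⟧ shift w (λ k → ⟦ o ≡ᵇ 0 ⟧ ⟦ (a ≡ᵇ k) ∧ t ⟧ (+ 1)) k
      arith (suc z) o s t w a = refl
      arith zero (suc o) s t w a = sym (trans (cong (⟦ s ⟧_) (zer (shift-linear w k))) (⟦⟧-zero s))
      arith zero zero false t w a rewrite 𝔹ₚ.∧-zeroʳ (w + a ≡ᵇ k) = refl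
      arith zero zero true  t w a = trans (⟦⟧-∧ (w + a ≡ᵇ k) t (+ 1)) (trans (indicator-shift w a k _)
        (congr (shift-linear w k) (λ k → sym (⟦⟧-∧ (a ≡ᵇ k) t (+ 1)))))

  colourings-weight : ∀ β S k → assignSum S (length β) (λ κ → weight κ β k) ≡ colourings S β k
  colourings-weight []      []      zero    = refl
  colourings-weight []      []      (suc k) = refl
  colourings-weight []      (x ∷ S) k       = refl
  colourings-weight (b ∷ β) S       k       = begin
    assignSum S (suc (length β)) (λ κ → weight κ (b ∷ β) k)
      ≡⟨ congr (assignSum-linear S (suc (length β))) (λ κ → weight-peel κ b β k) ⟩
    assignSum S (suc (length β)) (λ κ → class b β k (zeros κ) (others κ))
      ≡⟨ assignSum-peel S (length β) (class b β k) ⟩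
    splitSum S (λ A R → assignSum R (length β) (class b β k A))
      ≡⟨ splitSum-cong S (λ {A} {R} _ → inner A R) ⟩
    colourings S (b ∷ β) k ∎
    where
    open ≡-Reasoning
    inner : ∀ A R → assignSum R (length β) (class b β k A) ≡
      ⟦ cross A A ≡ᵇ 0 ⟧ ⟦ length A ≡ᵇ b ⟧ shift (cross A R) (colourings R β) k
    inner A R = begin
      assignSum R (length β) (class b β k A)
        ≡⟨ assignSum-cong R (length β) (λ κ e →
             cong (λ R → ⟦ cross A A ≡ᵇ 0 ⟧ ⟦ length A ≡ᵇ b ⟧ shift (cross A R) (weight κ β) k) e) ⟩
      assignSum R (length β) (λ κ → ⟦ cross A A ≡ᵇ 0 ⟧ ⟦ length A ≡ᵇ b ⟧ shift (cross A R) (weight κ β) k)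
        ≡⟨ trans (iverson lin (cross A A ≡ᵇ 0) _) (cong (⟦ cross A A ≡ᵇ 0 ⟧_) (iverson lin (length A ≡ᵇ b) _)) ⟩
      ⟦ cross A A ≡ᵇ 0 ⟧ ⟦ length A ≡ᵇ b ⟧ assignSum R (length β) (λ κ → shift (cross A R) (weight κ β) k)
        ≡⟨ cong (λ z → ⟦ cross A A ≡ᵇ 0 ⟧ ⟦ length A ≡ᵇ b ⟧ z) (trans
             (shift-comm lin (cross A R) (λ κ → weight κ β) k)
             (congr (shift-linear (cross A R) k) (colourings-weight β R))) ⟩
      ⟦ cross A A ≡ᵇ 0 ⟧ ⟦ length A ≡ᵇ b ⟧ shift (cross A R) (colourings R β) k ∎
      where
      lin = assignSum-linear R (length β)

-- Dyck paths

<ᵇ-true : ∀ {m n} → m < n → (m <ᵇ n) ≡ true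
<ᵇ-true {zero}  {suc n} (s≤s h) = refl
<ᵇ-true {suc m} {suc n} (s≤s h) = <ᵇ-true h

<ᵇ-false : ∀ {m n} → n ≤ m → (m <ᵇ n) ≡ false
<ᵇ-false {m}     {zero}  h       = refl
<ᵇ-false {suc m} {suc n} (s≤s h) = <ᵇ-false h

<ᵇ-sound : ∀ m n → (m <ᵇ n) ≡ true → m < n
<ᵇ-sound zero    (suc n) h = s≤s z≤n
<ᵇ-sound (suc m) (suc n) h = s≤s (<ᵇ-sound m n h)

count-# : (p : A → Bool) (xs : List A) → countᵇ p xs ≡ # p xs
count-# p []       = refl
count-# p (x ∷ xs) with p x
... | true  = cong suc (count-# p xs)
... | false = count-# p xs

#-filter : (p q : A → Bool) (xs : List A) → # q (filterᵇ p xs) ≡ # (λ x → q x ∧ p x) xs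
#-filter p q []       = refl
#-filter p q (x ∷ xs) with p x
... | true  = cong₂ _+_ (cong bit (sym (𝔹ₚ.∧-identityʳ (q x)))) (#-filter p q xs)
... | false = trans (#-filter p q xs) (cong (λ b → bit b + # (λ x → q x ∧ p x) xs) (sym (𝔹ₚ.∧-zeroʳ (q x))))

#-concatMap : (q : B → Bool) (g : A → List B) (xs : List A) →
  # q (concatMap g xs) ≡ sumBy (λ x → # q (g x)) xs
#-concatMap q g []       = refl
#-concatMap q g (x ∷ xs) = trans (sumBy-++ _ (g x) (concatMap g xs)) (cong (_+_ (# q (g x))) (#-concatMap q g xs))

#-≤-length : (p : A → Bool) (xs : List A) → # p xs ≤ length xs
#-≤-length p []       = z≤n
#-≤-length p (x ∷ xs) with p x
... | true  = s≤s (#-≤-length p xs)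
... | false = ℕₚ.m≤n⇒m≤1+n (#-≤-length p xs)

-- The incomparability graph and its chromatic quasisymmetric function

module DyckGraph (n : ℕ) (d : ℕ → ℕ) where

  edge : Fin n → Fin n → Bool
  edge i j = (toℕ i <ᵇ toℕ j) ∧ incᵇ n d (elt i) (elt j)

  open Digraph edge using (colourings)
  open Assignments edge

  vertices : List (Fin n)
  vertices = allFin n

  assignment : {N : ℕ} → Vec (Fin N) n → List (Fin n × ℕ)
  assignment κ = tabulate (λ i → i , toℕ (lookup κ i))

  sumBy-assignment : {N : ℕ} (κ : Vec (Fin N) n) (f : Fin n × ℕ → ℕ) →
    sumBy f (assignment κ) ≡ sumBy (λ i → f (i , toℕ (lookup κ i))) vertices
  sumBy-assignment κ f = trans
    (cong (sumBy f) (sym (Listₚ.map-tabulate (λ i → i) (λ i → i , toℕ (lookup κ i)))))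
    (sumBy-map f (λ i → i , toℕ (lookup κ i)) vertices)

  #-edges : {N : ℕ} (κ : Vec (Fin N) n) (r : ℕ → ℕ → Bool) →
    # (λ (i , j) → r (toℕ (lookup κ i)) (toℕ (lookup κ j))) (edges n d) ≡ pairs r (assignment κ)
  #-edges κ r = begin
    # q (edges n d)
      ≡⟨ #-filter _ q (concatMap (λ i → map (i ,_) vertices) vertices) ⟩
    # (λ (i , j) → q (i , j) ∧ edge i j) (concatMap (λ i → map (i ,_) vertices) vertices)
      ≡⟨ #-concatMap _ (λ i → map (i ,_) vertices) vertices ⟩
    sumBy (λ i → # (λ (i , j) → q (i , j) ∧ edge i j) (map (i ,_) vertices)) vertices
      ≡⟨ sumBy-cong (λ i → sumBy-map _ (i ,_) vertices) vertices ⟩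
    sumBy (λ i → # (λ j → q (i , j) ∧ edge i j) vertices) vertices
      ≡⟨ sumBy-cong (λ i → sym (sumBy-assignment κ _)) vertices ⟩
    sumBy (λ i → # (λ (w , c) → r (toℕ (lookup κ i)) c ∧ edge i w) (assignment κ)) vertices
      ≡⟨ sym (sumBy-assignment κ _) ⟩
    pairs r (assignment κ) ∎
    where
    open ≡-Reasoning
    q : Fin n × Fin n → Bool
    q (i , j) = r (toℕ (lookup κ i)) (toℕ (lookup κ j))

  properᵇ-clashes : {N : ℕ} (κ : Vec (Fin N) n) → properᵇ (edges n d) κ ≡ (clashes (assignment κ) ≡ᵇ 0)
  properᵇ-clashes κ = trans (go (edges n d)) (cong (_≡ᵇ 0) (#-edges κ _≡ᵇ_))
    where
    go : ∀ es → properᵇ es κ ≡ (# (λ (i , j) → toℕ (lookup κ i) ≡ᵇ toℕ (lookup κ j)) es ≡ᵇ 0)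
    go []             = refl
    go ((i , j) ∷ es) with toℕ (lookup κ i) ≡ᵇ toℕ (lookup κ j)
    ... | true  = refl
    ... | false = go es

  asc-# : {N : ℕ} (κ : Vec (Fin N) n) → asc (edges n d) κ ≡
    # (λ (i , j) → toℕ (lookup κ i) <ᵇ toℕ (lookup κ j)) (edges n d)
  asc-# κ = count-# _ (edges n d)

  content-classSizes : {N : ℕ} (κ : Vec (Fin N) n) (α : Vec ℕ N) →
    vecEqᵇ (content κ) α ≡ classSizes (assignment κ) (toList α)
  content-classSizes κ α = trans (cong (λ v → vecEqᵇ v α) (Vecₚ.tabulate-cong (λ c →
      trans (count-# _ vertices) (sym (sumBy-assignment κ (λ (v , c′) → bit (c′ ≡ᵇ toℕ c)))))))
    (classSizes-vecEqᵇ (assignment κ) α)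

  private
    coeffOf-chromQSF-∑ : {N : ℕ} (α : Vec ℕ N) (k : ℕ) → coeffOf (chromQSF n d N) α k ≡
      ∑ (allVecs (allFin N) n) (λ κ → ⟦ properᵇ (edges n d) κ ⟧
        ⟦ (asc (edges n d) κ ≡ᵇ k) ∧ vecEqᵇ (content κ) α ⟧ (+ 1))
    coeffOf-chromQSF-∑ {N} α k = trans (coeffOf-∑ (chromQSF n d N) α k)
      (trans (∑-map _ (filterᵇ (properᵇ (edges n d)) (allVecs (allFin N) n)) _)
        (∑-filter (properᵇ (edges n d)) (allVecs (allFin N) n) _))

  coeffOf-chromQSF : {N : ℕ} (α : Vec ℕ N) (k : ℕ) →
    coeffOf (chromQSF n d N) α k ≡ colourings vertices (toList α) k
  coeffOf-chromQSF {N} α k = begin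
    coeffOf (chromQSF n d N) α k
      ≡⟨ coeffOf-chromQSF-∑ α k ⟩
    ∑ (allVecs (allFin N) n) (λ κ → ⟦ properᵇ (edges n d) κ ⟧
        ⟦ (asc (edges n d) κ ≡ᵇ k) ∧ vecEqᵇ (content κ) α ⟧ (+ 1))
      ≡⟨ congr (∑-linear (allVecs (allFin N) n)) (λ κ → cong₂ (λ p b → ⟦ p ⟧ ⟦ b ⟧ (+ 1)) (properᵇ-clashes κ)
           (cong₂ _∧_ (cong (_≡ᵇ k) (trans (asc-# κ) (#-edges κ _<ᵇ_))) (content-classSizes κ α))) ⟩
    ∑ (allVecs (allFin N) n) (λ κ → weight (assignment κ) (toList α) k)
      ≡⟨ ∑-allVecs n N (λ i → i) (λ κ → weight κ (toList α) k) ⟩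
    assignSum vertices N (λ κ → weight κ (toList α) k)
      ≡⟨ cong (λ N → assignSum vertices N (λ κ → weight κ (toList α) k)) (sym (Vecₚ.length-toList α)) ⟩
    assignSum vertices (length (toList α)) (λ κ → weight κ (toList α) k)
      ≡⟨ colourings-weight (toList α) vertices k ⟩
    colourings vertices (toList α) k ∎
    where open ≡-Reasoning

  -- There are no more ascents than edges. The bound makes each coefficient, a function of k, a
  -- finite list.
  colourings-bounded : ∀ k → length (edges n d) < k → ∀ β → colourings vertices β k ≡ + 0
  colourings-bounded k h β = begin
    colourings vertices β k
      ≡⟨ cong (λ γ → colourings vertices γ k) (sym (Vecₚ.toList∘fromList β)) ⟩
    colourings vertices (toList (fromList β)) k
      ≡⟨ trans (sym (coeffOf-chromQSF (fromList β) k)) (coeffOf-chromQSF-∑ (fromList β) k) ⟩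
    ∑ κs (λ κ → ⟦ properᵇ (edges n d) κ ⟧ ⟦ (asc (edges n d) κ ≡ᵇ k) ∧ vecEqᵇ (content κ) (fromList β) ⟧ (+ 1))
      ≡⟨ vanish (∑-linear κs) (λ κ → trans (cong (λ b → ⟦ properᵇ (edges n d) κ ⟧
           ⟦ b ∧ vecEqᵇ (content κ) (fromList β) ⟧ (+ 1)) (few κ)) (⟦⟧-zero (properᵇ (edges n d) κ))) ⟩
    + 0 ∎
    where
    open ≡-Reasoning
    κs = allVecs (allFin (length β)) n
    few : ∀ (κ : Vec (Fin (length β)) n) → (asc (edges n d) κ ≡ᵇ k) ≡ false
    few κ = ≡ᵇ-≢ _ k (λ e → ℕₚ.<-irrefl e (ℕₚ.≤-<-trans
      (ℕₚ.≤-trans (ℕₚ.≤-reflexive (asc-# κ)) (#-≤-length _ (edges n d))) h))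

  _≺_ : Fin n → Fin n → Set
  i ≺ j = toℕ i < toℕ j

  vertices-sorted : AllPairs _≺_ vertices
  vertices-sorted = AllPairsₚ.tabulate⁺-< (λ i<j → i<j)

  loopless : ∀ i → edge i i ≡ false
  loopless i rewrite <ᵇ-false (ℕₚ.≤-refl {toℕ i}) = refl

  backward : ∀ {i j} → i ≺ j → edge j i ≡ false
  backward i≺j rewrite <ᵇ-false (ℕₚ.<⇒≤ i≺j) = refl

  module _ (dyck : IsDyckPath n d) where

    -- For i < j only one of the two order relations in `incᵇ` can hold, because d_j ≥ j > i
    -- excludes the reverse one.
    adjacency : ∀ {i j} → i ≺ j → edge i j ≡ not (d (elt i) <ᵇ elt j)
    adjacency {i} {j} i≺j rewrite <ᵇ-true i≺j | ≡ᵇ-≢ (toℕ i) (toℕ j) (ℕₚ.<⇒≢ i≺j)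
      | <ᵇ-true (ℕₚ.≤-trans (s≤s i≺j) (Finₚ.toℕ<n j)) | <ᵇ-true (s≤s (Finₚ.toℕ<n j))
      | 𝔹ₚ.∧-identityʳ (d (elt i) <ᵇ elt j)
      = trans (cong (λ b → not (d (elt i) <ᵇ elt j) ∧ not b) later) (𝔹ₚ.∧-identityʳ _)
      where
      later : precᵇ n d (elt j) (elt i) ≡ false
      later with elt j <ᵇ n in j<n
      ... | false = refl
      ... | true rewrite <ᵇ-false (ℕₚ.≤-trans (ℕₚ.<⇒≤ (s≤s i≺j))
        (proj₁ (proj₁ dyck (elt j) (s≤s z≤n) (<ᵇ-sound (elt j) n j<n)))) = refl

    nonadjacent⇒< : ∀ {i j} → i ≺ j → edge i j ≡ false → d (elt i) < elt j
    nonadjacent⇒< {i} {j} i≺j h = <ᵇ-sound (d (elt i)) (elt j)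
      (𝔹ₚ.not-injective (trans (sym (adjacency i≺j)) h))

    adjacent⇒≥ : ∀ {i j} → i ≺ j → edge i j ≡ true → elt j ≤ d (elt i)
    adjacent⇒≥ {i} {j} i≺j h with ℕₚ.<-≤-connex (d (elt i)) (elt j)
    ... | inj₂ ≥ = ≥
    ... | inj₁ < with trans (sym h) (trans (adjacency i≺j) (cong not (<ᵇ-true <)))
    ...   | ()

    ≥⇒adjacent : ∀ {i j} → i ≺ j → elt j ≤ d (elt i) → edge i j ≡ true
    ≥⇒adjacent i≺j h = trans (adjacency i≺j) (cong not (<ᵇ-false h))

    d-mono : ∀ {i} j → 1 ≤ i → i ≤ j → j < n → d i ≤ d j
    d-mono {i} j 1≤i i≤j j<n with ℕₚ.m≤n⇒m<n∨m≡n i≤j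
    ... | inj₂ refl = ℕₚ.≤-refl
    d-mono (suc j) 1≤i i≤j j<n | inj₁ (s≤s i≤j′) = ℕₚ.≤-trans
      (d-mono j 1≤i i≤j′ (ℕₚ.<-trans (ℕₚ.n<1+n j) j<n)) (proj₂ dyck j (ℕₚ.≤-trans 1≤i i≤j′) j<n)

    -- From k ≤ d_i follow j ≤ d_i and k ≤ d_i ≤ d_j.
    interval : ∀ {i j k} → i ≺ j → j ≺ k → edge i k ≡ true → (edge i j ≡ true) × (edge j k ≡ true)
    interval {i} {j} {k} i≺j j≺k h =
      ≥⇒adjacent i≺j (ℕₚ.≤-trans (ℕₚ.<⇒≤ (s≤s j≺k)) k≤) ,
      ≥⇒adjacent j≺k (ℕₚ.≤-trans k≤ (d-mono (elt j) (s≤s z≤n) (ℕₚ.<⇒≤ (s≤s i≺j))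
        (ℕₚ.≤-trans (s≤s j≺k) (Finₚ.toℕ<n k))))
      where
      k≤ : elt k ≤ d (elt i)
      k≤ = adjacent⇒≥ (ℕₚ.<-trans i≺j j≺k) h

    module _ (bounce : bounceNumber n d ≡ 3) where

      -- A bounce sequence with three entries stops at the third. The fuel is a variable of its own
      -- in `go` so that it can be matched while `n` stays fixed; if exactly 3 units run out before
      -- n is reached, the list has four entries.
      m₂≡n : 3 ≤ n → dext n d (suc (m₁ n d)) ≡ n
      m₂≡n 3≤n = go n 3≤n bounce
        where
        go : ∀ f → 3 ≤ f → length (bounceFrom f n d (m₀ n d)) ≡ 3 → dext n d (suc (m₁ n d)) ≡ n
        go (suc zero)          (s≤s ())       h
        go (suc (suc zero))    (s≤s (s≤s ())) h
        go (suc (suc (suc f))) _ h with m₀ n d ≡ᵇ n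
        go (suc (suc (suc f))) (s≤s (s≤s (s≤s _))) () | true
        ... | false with m₁ n d ≡ᵇ n
        go (suc (suc (suc f))) (s≤s (s≤s (s≤s _))) () | false | true
        ... | false with dext n d (suc (m₁ n d)) ≡ᵇ n in eq
        ...   | true = ≡ᵇ-sound _ n eq
        go (suc (suc (suc zero))) (s≤s (s≤s (s≤s _))) () | false | false | false
        go (suc (suc (suc (suc f)))) (s≤s (s≤s (s≤s _))) h | false | false | false
          with dext n d (suc (dext n d (suc (m₁ n d)))) ≡ᵇ n
        go (suc (suc (suc (suc f)))) (s≤s (s≤s (s≤s _))) () | false | false | false | true
        go (suc (suc (suc (suc f)))) (s≤s (s≤s (s≤s _))) () | false | false | false | false

      dext-d : ∀ {i} → i < n → dext n d i ≡ d i
      dext-d i<n rewrite <ᵇ-true i<n = refl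

      -- A chain of four elements overtakes the bounce path: y > m_0, z > m_1 and w > m_2 = n.
      height : ∀ {x y z w} → x ≺ y → y ≺ z → z ≺ w →
        edge x y ≡ false → edge y z ≡ false → edge z w ≡ false → ⊥
      height {x} {y} {z} {w} x≺y y≺z z≺w exy eyz ezw =
        ℕₚ.<-irrefl (m₂≡n 3≤n) (ℕₚ.<-≤-trans m₂<w (Finₚ.toℕ<n w))
        where
        open ℕₚ.≤-Reasoning
        z<n : elt z < n
        z<n = ℕₚ.≤-trans (s≤s z≺w) (Finₚ.toℕ<n w)
        y<n : elt y < n
        y<n = ℕₚ.<-trans (s≤s y≺z) z<n
        x<n : elt x < n
        x<n = ℕₚ.<-trans (s≤s x≺y) y<n
        3≤n : 3 ≤ n
        3≤n = ℕₚ.≤-trans (s≤s (ℕₚ.≤-trans (s≤s (ℕₚ.≤-trans (s≤s z≤n) x≺y)) y≺z)) (ℕₚ.<⇒≤ z<n)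
        m₀<y : m₀ n d < elt y
        m₀<y = begin-strict
          dext n d 1 ≡⟨ dext-d (ℕₚ.≤-<-trans (s≤s z≤n) x<n) ⟩
          d 1        ≤⟨ d-mono (elt x) (s≤s z≤n) (s≤s z≤n) x<n ⟩
          d (elt x)  <⟨ nonadjacent⇒< x≺y exy ⟩
          elt y      ∎
        m₁<z : m₁ n d < elt z
        m₁<z = begin-strict
          dext n d (suc (m₀ n d)) ≡⟨ dext-d (ℕₚ.≤-<-trans m₀<y y<n) ⟩
          d (suc (m₀ n d))        ≤⟨ d-mono (elt y) (s≤s z≤n) m₀<y y<n ⟩
          d (elt y)               <⟨ nonadjacent⇒< y≺z eyz ⟩
          elt z                   ∎
        m₂<w : dext n d (suc (m₁ n d)) < elt w
        m₂<w = begin-strict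
          dext n d (suc (m₁ n d)) ≡⟨ dext-d (ℕₚ.≤-<-trans m₁<z z<n) ⟩
          d (suc (m₁ n d))        ≤⟨ d-mono (elt z) (s≤s z≤n) m₁<z z<n ⟩
          d (elt z)               <⟨ nonadjacent⇒< z≺w ezw ⟩
          elt w                   ∎

      open UnitInterval _≺_ edge backward loopless interval height
        using (colourings-↭; colourings-wide; headSum-triples-nonneg)
      open Digraph edge using (colourings-zero)

      heightThree : ∀ k → HeightThree n (λ β → colourings vertices β k)
      heightThree k = record
        { drop-zero = λ β → colourings-zero vertices β k
        ; permute   = λ p → colourings-↭ p vertices vertices-sorted k
        ; wide      = λ β h → colourings-wide β h vertices vertices-sorted k
        ; degree    = λ β h → UnitInterval.colourings-degree _≺_ edge backward loopless interval height β vertices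
                        (λ e → h (trans e (Listₚ.length-tabulate (λ i → i)))) k }

      private
        us : List (List ℕ)
        us = partitions n

        coefficientAt : List ℕ → ℕ → ℤ
        coefficientAt u k = coefficient us (λ β → colourings vertices β k) u

      -- For more than three parts the list is empty, in accordance with `rows u` = 0. Otherwise the
      -- exponents of q from 0 up to the number of edges suffice by `colourings-bounded`.
      eCoefficient : List ℕ → List ℤ
      eCoefficient u = maybe (λ _ → applyUpTo (coefficientAt u) (suc (length (edges n d)))) [] (pad u)

      private
        term-eλ : ∀ {N} (α : Vec ℕ N) k u → coefficientAt u k *ℤ rows u (toList α) ≡
          coeffOf (scaleQ (eCoefficient u) (eλ N u)) α k
        term-eλ {N} α k u = trans (go (pad u) refl)
          (sym (coeffOf-scaleQ (eλ N u) α (eλ-constant N u α) (eCoefficient u) k))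
          where
          go : ∀ t → pad u ≡ t → coefficientAt u k *ℤ rows u (toList α) ≡
            nth (eCoefficient u) k *ℤ coeffOf (eλ N u) α 0
          go nothing  e rewrite e = ℤₚ.*-zeroʳ (coefficientAt u k)
          go (just t) e = cong₂ _*ℤ_
            (trans (sym (nth-applyUpTo (coefficientAt u) (suc (length (edges n d)))
                (λ k h → coefficient-zero us u (colourings-bounded k h)) k))
              (cong (λ t → nth (maybe (λ _ → applyUpTo (coefficientAt u) (suc (length (edges n d)))) [] t) k) (sym e)))
            (sym (coeffOf-eλ N u α e))

      chromQSF-expansion : (N : ℕ) (α : Vec ℕ N) (k : ℕ) →
        coeffOf (chromQSF n d N) α k ≡ coeffOf (eExpansion n N eCoefficient) α k
      chromQSF-expansion N α k = begin
        coeffOf (chromQSF n d N) α k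
          ≡⟨ coeffOf-chromQSF α k ⟩
        F (toList α)
          ≡⟨ expansion us (distinct n) F (toList α) ⟩
        ∑ us (λ u → coefficientAt u k *ℤ rows u (toList α)) +ℤ residual us F (toList α)
          ≡⟨ cong₂ _+ℤ_ (congr (∑-linear us) (term-eλ α k)) (residual-zero n (heightThree k) (toList α)) ⟩
        ∑ us (λ u → coeffOf (scaleQ (eCoefficient u) (eλ N u)) α k) +ℤ + 0
          ≡⟨ ℤₚ.+-identityʳ _ ⟩
        ∑ us (λ u → coeffOf (scaleQ (eCoefficient u) (eλ N u)) α k)
          ≡⟨ sym (coeffOf-concatMap (λ u → scaleQ (eCoefficient u) (eλ N u)) us α k) ⟩
        coeffOf (eExpansion n N eCoefficient) α k ∎
        where
        open ≡-Reasoning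
        F : List ℕ → ℤ
        F β = colourings vertices β k

      eCoefficient-hookish : ∀ l → 1 ≤ n → l + l + l ≤ n → All (λ z → + 0 ≤ℤ z) (eCoefficient (hookish n l))
      eCoefficient-hookish l 1≤n l≤ = go (pad (hookish n l))
        where
        nonneg : ∀ k → + 0 ≤ℤ coefficientAt (hookish n l) k
        nonneg k = subst (+ 0 ≤ℤ_) (hookFunctional-coefficient n l 1≤n l≤ (heightThree k))
          (headSum-triples-nonneg n l vertices vertices-sorted
            (ℕₚ.≤-reflexive (Listₚ.length-tabulate (λ i → i))) k)
        go : ∀ t → All (λ z → + 0 ≤ℤ z)
          (maybe (λ _ → applyUpTo (coefficientAt (hookish n l)) (suc (length (edges n d)))) [] t)
        go nothing  = []
        go (just _) = Allₚ.applyUpTo⁺₂ (coefficientAt (hookish n l)) (suc (length (edges n d))) nonneg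

theorem3p5 : (n : ℕ) (d : ℕ → ℕ) → IsDyckPath n d → bounceNumber n d ≡ 3 →
    (l : ℕ) → l ≤ sizeS₃ n d → l ≤ sizeS₂ n d → l ≤ sizeS₁ n d →
    Σ (List ℕ → List ℤ) (λ coef →
    ((N : ℕ) (α : Vec ℕ N) (k : ℕ) →
    coeffOf (chromQSF n d N) α k ≡ coeffOf (eExpansion n N coef) α k)
    × All (λ z → + 0 ≤ℤ z) (coef (hookish n l)))
theorem3p5 n d dyck bounce l l≤a l≤b l≤c =
  eCoefficient dyck bounce , chromQSF-expansion dyck bounce ,
  eCoefficient-hookish dyck bounce l (positive n bounce) (triple l l≤a l≤b l≤c)
  where
  open DyckGraph n d
  -- For n = 0 the bounce sequence has a single entry.
  positive : ∀ n → bounceNumber n d ≡ 3 → 1 ≤ n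
  positive (suc n) h = s≤s z≤n
  -- A positive lower bound for a truncated difference makes the difference exact, so the three
  -- block sizes can be added up; l = 0 is treated apart for this reason.
  stack : ∀ {l} x y → suc l ≤ x ∸ y → y + suc l ≤ x
  stack x       zero    h = h
  stack (suc x) (suc y) h = s≤s (stack x y h)
  triple : ∀ l → l ≤ sizeS₃ n d → l ≤ sizeS₂ n d → l ≤ sizeS₁ n d → l + l + l ≤ n
  triple zero    _  _  _  = z≤n
  triple (suc l) h₃ h₂ h₁ = ℕₚ.≤-trans (ℕₚ.+-monoˡ-≤ (suc l)
    (ℕₚ.≤-trans (ℕₚ.+-monoˡ-≤ (suc l) h₁) (stack (m₁ n d) (m₀ n d) h₂))) (stack n (m₁ n d) h₃)
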